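{- Any instance of minimum latency vertex cover (MLVC) can be reduced in polynomial time to an instance of graphic matroid MLOP.
   Context: MLVC: given a graph $G$ (and, in decision form, an integer), minimize $\sum_{(u,v)\in E(G)}\max\{\pi(u),\pi(v)\}$ over bijections $\pi:V(G)\to\{1,\dots,|V(G)|\}$. Graphic matroid MLOP: given a graph $H$, minimize $\sum_{i=1}^{|E(H)|} r(\{e:\sigma(e)\le i\})$ over bijections $\sigma:E(H)\to\{1,\dots,|E(H)|\}$, where $r(A)$ is the size of a largest acyclic subset of $A\subseteq E(H)$. -}

module Defs where

open import Data.Nat using (ℕ; zero; suc; _+_; _*_; _^_; _≤_; _<_; _⊔_)
open import Data.Nat.Binary.Base using (ℕᵇ; 2[1+_]; 1+[2_]) renaming (zero to zeroᵇ; fromℕ to toBin)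
open import Data.Fin using (Fin; toℕ; _↑ˡ_) renaming (zero to fzero; suc to fsuc; _≤_ to _≤ᶠ_; _<_ to _<ᶠ_)
open import Data.Fin.Permutation using (Permutation′; _⟨$⟩ʳ_)
open import Data.Fin.Subset using (Subset; _∈_; _⊆_; ∣_∣)
open import Data.Vec using (tabulate)
open import Data.List using (List; []; _∷_; _++_; [_]; length; map; concat; lookup; _∷ʳ_)
open import Data.List.Relation.Unary.All using (All)
open import Data.List.Relation.Unary.Unique.Propositional using (Unique)
open import Data.Nat.ListAction using (sum)
open import Data.Maybe using (Maybe; just; nothing)
open import Data.Bool using (Bool; true; false)
open import Data.Product using (Σ; ∃; _×_; _,_; proj₁; proj₂)
open import Data.Sum using (_⊎_)
open import Data.Unit using (⊤)
open import Relation.Nullary using (¬_; does)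
open import Relation.Binary.PropositionalEquality using (_≡_)
open import Function.Bundles using (_⇔_)

-- Finite simple graphs.
-- Vertices are Fin n.  Edges are stored as a duplicate-free list of
-- pairs (u , v) with u < v (so no loops, no parallel edges, and every
-- edge has a unique representation).  The i-th edge is  lookup edges i.

record Graph : Set where
  field
    n       : ℕ
    edges   : List (Fin n × Fin n)
    ordered : All (λ uv → proj₁ uv <ᶠ proj₂ uv) edges
    nodup   : Unique edges

open Graph public

m : Graph → ℕ
m G = length (edges G)

edge : (G : Graph) → Fin (m G) → Fin (n G) × Fin (n G)
edge G = lookup (edges G)

-- cost of a bijection π : V → {1..n} (position of v is 1 + toℕ (π v))
mlvcCost : (G : Graph) → Permutation′ (n G) → ℕ
mlvcCost G π =
  sum (map (λ uv → suc (toℕ (π ⟨$⟩ʳ proj₁ uv)) ⊔ suc (toℕ (π ⟨$⟩ʳ proj₂ uv))) (edges G))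

MLVC-yes : Graph × ℕ → Set
MLVC-yes (G , k) = Σ (Permutation′ (n G)) λ π → mlvcCost G π ≤ k

-- Graphic matroid of a graph H: ground set = edge indices Fin (m H).

Adj : (H : Graph) → Subset (m H) → Fin (n H) → Fin (n H) → Set
Adj H B x y = Σ (Fin (m H)) λ e → e ∈ B × (edge H e ≡ (x , y) ⊎ edge H e ≡ (y , x))

WalkIn : (H : Graph) → Subset (m H) → List (Fin (n H)) → Set
WalkIn H B (x ∷ y ∷ r) = Adj H B x y × WalkIn H B (y ∷ r)
WalkIn H B _ = ⊤

HasCycle : (H : Graph) → Subset (m H) → Set
HasCycle H B =
  Σ (Fin (n H)) λ a → Σ (Fin (n H)) λ b → Σ (Fin (n H)) λ c →
  Σ (List (Fin (n H))) λ rest →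
    Unique (a ∷ b ∷ c ∷ rest) × WalkIn H B ((a ∷ b ∷ c ∷ rest) ∷ʳ a)

Acyclic : (H : Graph) → Subset (m H) → Set
Acyclic H B = ¬ HasCycle H B

IsRank : (H : Graph) → Subset (m H) → ℕ → Set
IsRank H A r =
  (Σ (Subset (m H)) λ B → B ⊆ A × Acyclic H B × ∣ B ∣ ≡ r) ×
  (∀ (B : Subset (m H)) → B ⊆ A → Acyclic H B → ∣ B ∣ ≤ r)

-- {e : σ(e) ≤ i}, for i = 1 + toℕ j, j : Fin m
prefix : (H : Graph) → Permutation′ (m H) → Fin (m H) → Subset (m H)
prefix H σ j = tabulate (λ e → does ((σ ⟨$⟩ʳ e) Data.Fin.≤? j))

sumFin : (k : ℕ) → (Fin k → ℕ) → ℕ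
sumFin zero    f = 0
sumFin (suc k) f = f fzero + sumFin k (λ i → f (fsuc i))

MLOP-yes : Graph × ℕ → Set
MLOP-yes (H , k) =
  Σ (Permutation′ (m H)) λ σ →
  Σ (Fin (m H) → ℕ) λ ρ →
    (∀ j → IsRank H (prefix H σ j) (ρ j)) × sumFin (m H) ρ ≤ k

-- Machine model: deterministic single-tape Turing machines.
-- Tape alphabet Fin (4 + extra): 0 = blank, 1,2,3 = input symbols
-- '0', '1', '#'.  Input alphabet: Fin 3.

data Move : Set where
  mvL mvR mvS : Move

record TM : Set where
  field
    Q     : ℕ
    extra : ℕ
    start : Fin Q
    -- nothing = halt
    δ     : Fin Q → Fin (4 + extra) → Maybe (Fin Q × Fin (4 + extra) × Move)

module Machine (M : TM) where
  open TM M

  Sym : Set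
  Sym = Fin (4 + extra)

  blank : Sym
  blank = fzero

  inj : Fin 3 → Sym
  inj i = fsuc (i ↑ˡ extra)

  dec : Sym → Maybe (Fin 3)
  dec fzero = nothing
  dec (fsuc fzero) = just fzero
  dec (fsuc (fsuc fzero)) = just (fsuc fzero)
  dec (fsuc (fsuc (fsuc fzero))) = just (fsuc (fsuc fzero))
  dec _ = nothing

  record Config : Set where
    constructor cfg
    field
      state : Fin Q
      left  : List Sym   -- cells left of the head, nearest first
      head  : Sym
      right : List Sym   -- cells right of the head, nearest first

  step : Config → Fin Q × Sym × Move → Config
  step (cfg _ l _ r) (q , w , mvS) = cfg q l w r
  step (cfg _ [] _ r) (q , w , mvL) = cfg q [] blank (w ∷ r)
  step (cfg _ (x ∷ l) _ r) (q , w , mvL) = cfg q l x (w ∷ r)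
  step (cfg _ l _ []) (q , w , mvR) = cfg q (w ∷ l) blank []
  step (cfg _ l _ (x ∷ r)) (q , w , mvR) = cfg q (w ∷ l) x r

  runWithin : ℕ → Config → Maybe Config
  runWithin fuel c with δ (Config.state c) (Config.head c)
  ... | nothing = just c
  runWithin zero    c | just t = nothing
  runWithin (suc f) c | just t = runWithin f (step c t)

  initial : List (Fin 3) → Config
  initial []       = cfg start [] blank []
  initial (x ∷ xs) = cfg start [] (inj x) (map inj xs)

  readOut : List Sym → List (Fin 3)
  readOut [] = []
  readOut (x ∷ xs) with dec x
  ... | nothing = []
  ... | just y  = y ∷ readOut xs

  output : Config → List (Fin 3)
  output c = readOut (Config.head c ∷ Config.right c)

ComputesWithin : (M : TM) → ℕ → List (Fin 3) → List (Fin 3) → Set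
ComputesWithin M t w out =
  Σ (Machine.Config M) λ c →
    Machine.runWithin M t (Machine.initial M w) ≡ just c × Machine.output M c ≡ out

PolyTimeComputable : {A B : Set} → (A → List (Fin 3)) → (B → List (Fin 3)) → (A → B) → Set
PolyTimeComputable encA encB f =
  Σ TM λ M → Σ ℕ λ c → Σ ℕ λ d →
    ∀ x → ComputesWithin M (c * length (encA x) ^ d + c) (encA x) (encB (f x))

b0 b1 sep : Fin 3
b0 = fzero
b1 = fsuc fzero
sep = fsuc (fsuc fzero)

-- bijective base-2 digits of a natural number (length ~ log n)
encBin : ℕᵇ → List (Fin 3)
encBin zeroᵇ    = []
encBin 1+[2 x ] = b0 ∷ encBin x
encBin 2[1+ x ] = b1 ∷ encBin x

encℕ : ℕ → List (Fin 3)
encℕ k = encBin (toBin k) ∷ʳ sep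

encInstance : Graph × ℕ → List (Fin 3)
encInstance (G , k) =
  encℕ (n G) ++ encℕ k ++
  concat (map (λ uv → encℕ (toℕ (proj₁ uv)) ++ encℕ (toℕ (proj₂ uv))) (edges G))

PolyReduction : (Graph × ℕ → Set) → (Graph × ℕ → Set) → Set
PolyReduction P Q =
  Σ (Graph × ℕ → Graph × ℕ) λ f →
    (∀ x → P x ⇔ Q (f x)) × PolyTimeComputable encInstance encInstance f

{-# OPTIONS --safe #-}

-- An instance (G , k) is mapped to the cone over the support of G: a new vertex (the apex) is joined
-- by a spoke to each of the p non-isolated vertices, and k grows by 1 + 2 + ... + p. Isolated vertices
-- must be left out because n is given in binary, so that there may be exponentially many of them.
--
-- An ordering of the vertices yields one of the edges of the cone: when a vertex comes, add its spoke and then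
-- its edges to the earlier vertices; the rank is the number of vertices so far. Conversely, run Kruskal's
-- algorithm along an ordering of the edges, so that each increase of the rank merges two classes, one of
-- which loses its representative (never the apex); order the vertices by the time at which they lose.
-- An edge that is spanned while the list of losers is L either lies within L or joins a loser to the
-- representative of its class, so at most |L| + |E(G[L])| edges are spanned, which is exactly the number
-- of edges that the first construction can place before its rank exceeds |L|.
--
-- For the running time, the reduction is written in a small language of loops on stacks. A stack is a
-- track of the tape with its top at the left end, and a Turing machine performs a push or a pop by
-- sweeping over the tape and back.

module Submission where

open import Data.Nat using (ℕ; zero; suc; _+_; _*_; _^_; _∸_; _≤_; _<_; _⊔_; z≤n; s≤s; s≤s⁻¹; _≤?_; _<?_)
open import Data.Nat.Properties
open import Data.Nat.ListAction using (sum)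
open import Data.Nat.ListAction.Properties using (sum-++)
open import Data.Nat.Binary.Base using (2[1+_]; 1+[2_]) renaming (zero to zeroᵇ; fromℕ to toBin; suc to sucᵇ; toℕ to fromBin)
open import Data.Nat.Binary.Properties using (fromℕ≡fromℕ'; toℕ-fromℕ')
open import Data.Nat.Solver using (module +-*-Solver)
open +-*-Solver using (solve; _:+_; _:*_; _:=_; con)
open import Data.Fin using (Fin; toℕ; fromℕ; inject₁; fromℕ<; inject≤; punchOut; join; splitAt; combine; remQuot; _↑ˡ_) renaming (zero to fzero; suc to fsuc; _≤?_ to _≤ᶠ?_)
open import Data.Fin.Properties using (injective⇒≤; any?; punchOut-injective; toℕ<n; toℕ-injective; toℕ-fromℕ; toℕ-fromℕ<; fromℕ<-toℕ; toℕ-inject₁; inject₁-injective; fromℕ≢inject₁; toℕ-inject≤; splitAt-join; remQuot-combine) renaming (_≟_ to _≟ᶠ_)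
open import Data.Fin.Permutation using (Permutation′; permutation; _⟨$⟩ʳ_; _⟨$⟩ˡ_; inverseʳ; inverseˡ; flip)
open import Data.Fin.Subset using (Subset; inside; outside; _⊆_; ∣_∣) renaming (_∈_ to _∈ˢ_; _∉_ to _∉ˢ_; ⊥ to ∅)
open import Data.Fin.Subset.Properties using (∉⊥; ∣⊥∣≡0)
open import Data.Vec as Vec using (Vec; []; _∷_; _[_]≔_; _[_]%=_; here; there)
open import Data.Vec.Properties using ([]≔-updates; []≔-minimal; lookup∘tabulate; lookup⇒[]=; []=⇒lookup; lookup∘updateAt; lookup∘updateAt′; lookup-replicate; updateAt-updateAt; updateAt-id; updateAt-commutes; updateAt-cong-local)
open import Data.List using (List; []; _∷_; _++_; _∷ʳ_; _ʳ++_; length; lookup; map; filter; upTo; concat; concatMap; replicate)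
open import Data.List.Properties using (≡-dec; length-map; length-++; length-replicate; length-ʳ++; length-upTo; map-++; map-∘; map-cong; map-id; concat-++; filter-all; filter-none; filter-accept; filter-reject; filter-++; ++-assoc; ++-identityʳ; ʳ++-ʳ++; ++-ʳ++; ʳ++-defn)
open import Data.List.Relation.Unary.All as All using (All; []; _∷_)
import Data.List.Relation.Unary.All.Properties as All
open import Data.List.Relation.Unary.AllPairs using ([]; _∷_)
open import Data.List.Relation.Unary.Any as Any using (here; there)
open import Data.List.Relation.Unary.Any.Properties using (lookup-index)
open import Data.List.Relation.Unary.Unique.Propositional using (Unique)
import Data.List.Relation.Unary.Unique.Propositional.Properties as Unique
open import Data.List.Membership.Propositional using (_∈_; _∉_)
open import Data.List.Membership.Propositional.Properties using (∈-lookup; ∈-map⁺; ∈-map⁻; ∈-++⁺ˡ; ∈-++⁺ʳ; ∈-++⁻; ∈-filter⁺; ∈-filter⁻; ∈-upTo⁺)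
import Data.List.Membership.DecPropositional as DecMembership
open import Data.Maybe as Maybe using (Maybe; just; nothing)
open import Data.Bool using (Bool; true; false; if_then_else_)
open import Data.Product using (Σ; ∃; _×_; _,_; proj₁; proj₂)
open import Data.Sum as Sum using (_⊎_; inj₁; inj₂)
open import Data.Unit using (⊤; tt)
open import Function using (_∘_; id; const)
open import Function.Bundles using (mk⇔)
open import Relation.Nullary using (Dec; yes; no; does; ¬_; contradiction)
open import Relation.Nullary.Decidable using (_×-dec_; dec-true)
open import Relation.Binary using (tri<; tri≈; tri>)
open import Relation.Binary.PropositionalEquality
import Algebra.Properties.CommutativeMonoid.Sum as MonoidSum
open import Defs

-- Finite sets, sums and sorting

-- The number 1 + 2 + ... + p is what the spokes cost in the first construction, as the spoke of the
-- i-th non-isolated vertex arrives at rank i; every other edge arrives at a rank that is at most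
-- its latency. In the other direction ranks and latencies cannot be compared edge by edge, since an
-- ordering of the edges may first grow many classes away from the apex. The comparison is amortized
-- instead. Suppose that t edges have come, that there are l losers, and that c edges of G lie
-- between losers. The first construction, applied to the losers alone, fills l + c positions, so l
-- + c - t positions are still open, and by the bound on spanned edges this is never negative. The
-- invariant says that the ranks so far, plus l for each open position, add up to at least the cost
-- of that construction. When all edges have come, no position is open and the losers are all the
-- non-isolated vertices, so the invariant becomes the desired inequality. Adding the triangular
-- number needs no multiplication on the machine: the count of distinct vertices is added to k each
-- time a new vertex is discovered, and that count is at most the length of the input.

module ∑ = MonoidSum +-0-commutativeMonoid

sumFin-cong : ∀ k {f g : Fin k → ℕ} → (∀ i → f i ≡ g i) → sumFin k f ≡ sumFin k g
sumFin-cong zero    eq = refl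
sumFin-cong (suc k) eq = cong₂ _+_ (eq fzero) (sumFin-cong k (eq ∘ fsuc))

sumFin≡∑ : ∀ k f → sumFin k f ≡ ∑.sum f
sumFin≡∑ zero    f = refl
sumFin≡∑ (suc k) f = cong (f fzero +_) (sumFin≡∑ k (f ∘ fsuc))

sumFin-permute : ∀ {k} (f : Fin k → ℕ) (π : Permutation′ k) → sumFin k f ≡ sumFin k (λ i → f (π ⟨$⟩ʳ i))
sumFin-permute {k} f π = trans (sumFin≡∑ k f) (trans (∑.sum-permute f π) (sym (sumFin≡∑ k _)))

sumFin-lookup : ∀ {A : Set} (f : A → ℕ) xs → sumFin (length xs) (λ i → f (lookup xs i)) ≡ sum (map f xs)
sumFin-lookup f []       = refl
sumFin-lookup f (x ∷ xs) = cong (f x +_) (sumFin-lookup f xs)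

sumFin-mono-≤ : ∀ k {f g : Fin k → ℕ} → (∀ i → f i ≤ g i) → sumFin k f ≤ sumFin k g
sumFin-mono-≤ zero    le = z≤n
sumFin-mono-≤ (suc k) le = +-mono-≤ (le fzero) (sumFin-mono-≤ k (le ∘ fsuc))

sumFin-mono-< : ∀ k {f g : Fin k → ℕ} → (∀ i → f i ≤ g i) → ∀ i → f i < g i → sumFin k f < sumFin k g
sumFin-mono-< (suc k) le fzero    lt = +-mono-<-≤ lt (sumFin-mono-≤ k (le ∘ fsuc))
sumFin-mono-< (suc k) le (fsuc i) lt = +-mono-≤-< (le fzero) (sumFin-mono-< k (le ∘ fsuc) i lt)

sumFin-1 : ∀ k → sumFin k (λ _ → 1) ≡ k
sumFin-1 zero    = refl
sumFin-1 (suc k) = cong suc (sumFin-1 k)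

sumBelow : ℕ → (ℕ → ℕ) → ℕ
sumBelow zero    f = 0
sumBelow (suc t) f = sumBelow t f + f t

sumBelow-suc : ∀ t f → sumBelow (suc t) f ≡ f 0 + sumBelow t (f ∘ suc)
sumBelow-suc zero    f = +-comm 0 (f 0)
sumBelow-suc (suc t) f = trans (cong (_+ f (suc t)) (sumBelow-suc t f)) (+-assoc (f 0) _ _)

sumFin≡sumBelow : ∀ k f → sumFin k (f ∘ toℕ) ≡ sumBelow k f
sumFin≡sumBelow zero    f = refl
sumFin≡sumBelow (suc k) f = trans (cong (f 0 +_) (sumFin≡sumBelow k (f ∘ suc))) (sym (sumBelow-suc k f))

-- If some `j` had no preimage, `punchOut` would remove it from the codomain and leave an injection
-- of a finite set into a smaller one.
injective⇒permutation : ∀ {k} (f : Fin k → Fin k) → (∀ {i j} → f i ≡ f j → i ≡ j) →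
  Σ (Permutation′ k) λ π → ∀ i → π ⟨$⟩ʳ i ≡ f i
injective⇒permutation {k} f inj = permutation f (proj₁ ∘ preimage f inj) (proj₂ ∘ preimage f inj)
    (λ i → inj (proj₂ (preimage f inj (f i)))) , λ _ → refl
  where
  preimage : ∀ {k} (f : Fin k → Fin k) → (∀ {i j} → f i ≡ f j → i ≡ j) → ∀ j → ∃ λ i → f i ≡ j
  preimage {suc k} f inj j with any? (λ i → f i ≟ᶠ j)
  ... | yes p = p
  ... | no ¬p = contradiction (injective⇒≤ {f = λ i → punchOut {i = j} (λ eq → ¬p (i , sym eq))}
                  (λ {i} {i′} eq → inj (punchOut-injective {i = j} (λ eq → ¬p (i , sym eq)) (λ eq → ¬p (i′ , sym eq)) eq))) 1+n≰n

module Sorting {k : ℕ} (key : Fin k → ℕ) where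

  -- Ties between equal keys are broken by index.
  κ : Fin k → ℕ
  κ u = key u * k + toℕ u

  κ-mono : ∀ {u v} → key u < key v → κ u < κ v
  κ-mono {u} {v} lt = begin-strict
    key u * k + toℕ u <⟨ +-monoʳ-< (key u * k) (toℕ<n u) ⟩
    key u * k + k     ≡⟨ +-comm (key u * k) k ⟩
    suc (key u) * k   ≤⟨ *-monoˡ-≤ k lt ⟩
    key v * k         ≤⟨ m≤m+n _ _ ⟩
    key v * k + toℕ v ∎
    where open ≤-Reasoning

  κ-injective : ∀ {u v} → κ u ≡ κ v → u ≡ v
  κ-injective {u} {v} eq with <-cmp (key u) (key v)
  ... | tri< lt _ _ = contradiction eq (<⇒≢ (κ-mono lt))
  ... | tri> _ _ gt = contradiction (sym eq) (<⇒≢ (κ-mono gt))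
  ... | tri≈ _ key≡ _ = toℕ-injective (+-cancelˡ-≡ (key u * k) _ _ (trans eq (cong (λ x → x * k + toℕ v) (sym key≡))))

  below : Fin k → Fin k → ℕ
  below v u with κ u <? κ v
  ... | yes _ = 1
  ... | no _  = 0

  below≤1 : ∀ v u → below v u ≤ 1
  below≤1 v u with κ u <? κ v
  ... | yes _ = ≤-refl
  ... | no _  = z≤n

  below-self : ∀ v → below v v ≡ 0
  below-self v with κ v <? κ v
  ... | yes lt = contradiction lt (<-irrefl refl)
  ... | no _   = refl

  below-1 : ∀ {u v} → κ u < κ v → below v u ≡ 1
  below-1 {u} {v} lt with κ u <? κ v
  ... | yes _ = refl
  ... | no ≮  = contradiction lt ≮

  below-mono : ∀ {v w} → κ v < κ w → ∀ u → below v u ≤ below w u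
  below-mono {v} {w} lt u with κ u <? κ v
  ... | no _  = z≤n
  ... | yes p = ≤-reflexive (sym (below-1 (<-trans p lt)))

  position : Fin k → ℕ
  position v = sumFin k (below v)

  position<k : ∀ v → position v < k
  position<k v = subst (position v <_) (sumFin-1 k)
    (sumFin-mono-< k (below≤1 v) v (subst (_< 1) (sym (below-self v)) (s≤s z≤n)))

  position-mono : ∀ {v w} → κ v < κ w → position v < position w
  position-mono {v} {w} lt = sumFin-mono-< k (below-mono lt) v (subst₂ _<_ (sym (below-self v)) (sym (below-1 lt)) (s≤s z≤n))

  position-injective : ∀ {v w} → position v ≡ position w → v ≡ w
  position-injective {v} {w} eq with <-cmp (κ v) (κ w)
  ... | tri< lt _ _ = contradiction eq (<⇒≢ (position-mono lt))
  ... | tri> _ _ gt = contradiction (sym eq) (<⇒≢ (position-mono gt))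
  ... | tri≈ _ κ≡ _ = κ-injective κ≡

  toPosition : Fin k → Fin k
  toPosition v = fromℕ< (position<k v)

  toℕ-toPosition : ∀ v → toℕ (toPosition v) ≡ position v
  toℕ-toPosition v = toℕ-fromℕ< (position<k v)

  toPosition-injective : ∀ {v w} → toPosition v ≡ toPosition w → v ≡ w
  toPosition-injective {v} {w} eq = position-injective (trans (sym (toℕ-toPosition v)) (trans (cong toℕ eq) (toℕ-toPosition w)))

  abstract
    sorting : Permutation′ k
    sorting = proj₁ (injective⇒permutation toPosition toPosition-injective)

    sorting-mono : ∀ {u v} → key u < key v → toℕ (sorting ⟨$⟩ʳ u) < toℕ (sorting ⟨$⟩ʳ v)
    sorting-mono {u} {v} lt = subst₂ _<_ (sym (toℕ-sorting u)) (sym (toℕ-sorting v)) (position-mono (κ-mono lt))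
      where
      toℕ-sorting : ∀ v → toℕ (sorting ⟨$⟩ʳ v) ≡ position v
      toℕ-sorting v = trans (cong toℕ (proj₂ (injective⇒permutation toPosition toPosition-injective) v)) (toℕ-toPosition v)

-- Subsets with an adjoined element, and counting with duplicate-free lists

∈-adjoin : ∀ {n} (B : Subset n) e → e ∈ˢ B [ e ]≔ inside
∈-adjoin B e = []≔-updates B e

⊆-adjoin : ∀ {n} {B : Subset n} e {f} → f ∈ˢ B → f ∈ˢ B [ e ]≔ inside
⊆-adjoin {B = B} e {f} f∈ with f ≟ᶠ e
... | yes refl = ∈-adjoin B e
... | no f≢e   = []≔-minimal B f e f≢e f∈

adjoin-∈ : ∀ {n} (B : Subset n) e {f} → f ∈ˢ B [ e ]≔ inside → f ≡ e ⊎ f ∈ˢ B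
adjoin-∈ (_ ∷ B) fzero    here       = inj₁ refl
adjoin-∈ (_ ∷ B) fzero    (there f∈) = inj₂ (there f∈)
adjoin-∈ (_ ∷ B) (fsuc e) here       = inj₂ here
adjoin-∈ (_ ∷ B) (fsuc e) (there f∈) = Sum.map (cong fsuc) there (adjoin-∈ B e f∈)

∣adjoin∣ : ∀ {n} (B : Subset n) e → e ∉ˢ B → ∣ B [ e ]≔ inside ∣ ≡ suc ∣ B ∣
∣adjoin∣ (inside  ∷ B) fzero    e∉ = contradiction here e∉
∣adjoin∣ (outside ∷ B) fzero    e∉ = refl
∣adjoin∣ (inside  ∷ B) (fsuc e) e∉ = cong suc (∣adjoin∣ B e (e∉ ∘ there))
∣adjoin∣ (outside ∷ B) (fsuc e) e∉ = ∣adjoin∣ B e (e∉ ∘ there)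

unadjoin : ∀ {n k} (B : Subset n) → ∣ B ∣ ≡ suc k → ∃ λ B₀ → ∃ λ e → e ∉ˢ B₀ × B ≡ B₀ [ e ]≔ inside × ∣ B₀ ∣ ≡ k
unadjoin (inside  ∷ B) refl = outside ∷ B , fzero , (λ ()) , refl , refl
unadjoin (outside ∷ B) eq with unadjoin B eq
... | B₀ , e , e∉ , B≡ , size = outside ∷ B₀ , fsuc e , (λ { (there e∈) → e∉ e∈ }) , cong (outside ∷_) B≡ , size

pigeonhole-∈ : ∀ {A : Set} {t} (f : Fin t → A) (zs : List A) → (∀ {i j} → f i ≡ f j → i ≡ j) → (∀ i → f i ∈ zs) → t ≤ length zs
pigeonhole-∈ f zs inj f∈ = injective⇒≤ {f = λ i → Any.index (f∈ i)}
  (λ {i} {j} eq → inj (trans (lookup-index (f∈ i)) (trans (cong (lookup zs) eq) (sym (lookup-index (f∈ j))))))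

Unique-lookup-injective : ∀ {A : Set} {xs : List A} → Unique xs → ∀ {i j} → lookup xs i ≡ lookup xs j → i ≡ j
Unique-lookup-injective (_ ∷ _)   {fzero}  {fzero}  eq = refl
Unique-lookup-injective {xs = x ∷ xs} (x∉ ∷ _)  {fzero}  {fsuc j} eq = contradiction eq (All.lookup x∉ (∈-lookup j))
Unique-lookup-injective {xs = x ∷ xs} (x∉ ∷ _)  {fsuc i} {fzero}  eq = contradiction (sym eq) (All.lookup x∉ (∈-lookup i))
Unique-lookup-injective (_ ∷ un)  {fsuc i} {fsuc j} eq = cong fsuc (Unique-lookup-injective un eq)

Unique-⊆⇒length≤ : ∀ {A : Set} {xs zs : List A} → Unique xs → (∀ {x} → x ∈ xs → x ∈ zs) → length xs ≤ length zs
Unique-⊆⇒length≤ {xs = xs} {zs} un sub = pigeonhole-∈ (lookup xs) zs (Unique-lookup-injective un) (λ i → sub (∈-lookup i))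

Unique-rotate : ∀ {A : Set} {a : A} {xs} → Unique (a ∷ xs) → Unique (xs ∷ʳ a)
Unique-rotate {a = a} {xs} (a∉ ∷ un) = Unique.++⁺ un ([] ∷ []) λ { (x∈ , here refl) → All.lookup a∉ x∈ refl }

Unique-head : ∀ {A : Set} {a : A} {xs} → Unique (a ∷ xs) → a ∉ xs
Unique-head (a∉ ∷ _) = All.All¬⇒¬Any a∉

-- Cycles

module Cycles (H : Graph) where

  V : Set
  V = Fin (n H)

  E : Set
  E = Fin (m H)

  EdgeSet : Set
  EdgeSet = Subset (m H)

  open DecMembership (_≟ᶠ_ {n H}) using (_∈?_)

  end : V → List V → V
  end u []      = u
  end u (v ∷ l) = end v l

  end-∷ʳ : ∀ u l v → end u (l ∷ʳ v) ≡ v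
  end-∷ʳ u []      v = refl
  end-∷ʳ u (w ∷ l) v = end-∷ʳ w l v

  edge-injective : ∀ {e f} → edge H e ≡ edge H f → e ≡ f
  edge-injective = Unique-lookup-injective (nodup H)

  edge-ordered : ∀ {e u v} → edge H e ≡ (u , v) → toℕ u < toℕ v
  edge-ordered {e} eq = subst (λ (u , v) → toℕ u < toℕ v) eq (All.lookup (ordered H) (∈-lookup e))

  Adj-mono : ∀ {B B′} → B ⊆ B′ → ∀ {u v} → Adj H B u v → Adj H B′ u v
  Adj-mono sub (e , e∈ , eq) = e , sub e∈ , eq

  WalkIn-mono : ∀ {B B′} → B ⊆ B′ → ∀ l → WalkIn H B l → WalkIn H B′ l
  WalkIn-mono sub []          w       = tt
  WalkIn-mono sub (_ ∷ [])    w       = tt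
  WalkIn-mono {B} sub (_ ∷ _ ∷ l) (a , w) = Adj-mono {B} sub a , WalkIn-mono sub (_ ∷ l) w

  Acyclic-mono : ∀ {B B′} → B ⊆ B′ → Acyclic H B′ → Acyclic H B
  Acyclic-mono sub ac (a , b , c , l , un , w) = ac (a , b , c , l , un , WalkIn-mono sub _ w)

  -- Labels have to be constant on the components of `B` but may agree on different ones.
  -- Connectedness is therefore never decided: distinct labels certify that a new edge closes no
  -- cycle.
  Respects : (V → V) → EdgeSet → Set
  Respects lab B = ∀ {e} → e ∈ˢ B → lab (proj₁ (edge H e)) ≡ lab (proj₂ (edge H e))

  Adj-respects : ∀ {lab B} → Respects lab B → ∀ {u v} → Adj H B u v → lab u ≡ lab v
  Adj-respects {lab} r (e , e∈ , inj₁ eq) = subst (λ (u , v) → lab u ≡ lab v) eq (r e∈)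
  Adj-respects {lab} r (e , e∈ , inj₂ eq) = sym (subst (λ (u , v) → lab u ≡ lab v) eq (r e∈))

  WalkIn-respects : ∀ {lab B} → Respects lab B → ∀ u l → WalkIn H B (u ∷ l) → lab u ≡ lab (end u l)
  WalkIn-respects r u []      w       = refl
  WalkIn-respects {lab} r u (v ∷ l) (a , w) = trans (Adj-respects {lab} r a) (WalkIn-respects {lab} r v l w)

  module Extend {lab : V → V} {B : EdgeSet} (resp : Respects lab B) (acyclic : Acyclic H B)
    (e₀ : E) {x y : V} (e₀≡ : edge H e₀ ≡ (x , y)) (lab≢ : lab x ≢ lab y) where

    B⁺ : EdgeSet
    B⁺ = B [ e₀ ]≔ inside

    Joins : V → V → Set
    Joins u v = (u ≡ x × v ≡ y) ⊎ (u ≡ y × v ≡ x)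

    split-Adj : ∀ {u v} → Adj H B⁺ u v → Adj H B u v ⊎ Joins u v
    split-Adj (e , e∈ , eq) with adjoin-∈ B e₀ e∈
    ... | inj₂ e∈B = inj₁ (e , e∈B , eq)
    split-Adj (e , e∈ , inj₁ eq) | inj₁ refl with refl ← trans (sym eq) e₀≡ = inj₂ (inj₁ (refl , refl))
    split-Adj (e , e∈ , inj₂ eq) | inj₁ refl with refl ← trans (sym eq) e₀≡ = inj₂ (inj₂ (refl , refl))

    avoid-Adj : ∀ {z u v} → z ≡ x ⊎ z ≡ y → z ≢ u → z ≢ v → Adj H B⁺ u v → Adj H B u v
    avoid-Adj z≡ z≢u z≢v a with split-Adj a
    ... | inj₁ a′ = a′
    avoid-Adj (inj₁ refl) z≢u z≢v _ | inj₂ (inj₁ (refl , refl)) = contradiction refl z≢u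
    avoid-Adj (inj₂ refl) z≢u z≢v _ | inj₂ (inj₁ (refl , refl)) = contradiction refl z≢v
    avoid-Adj (inj₁ refl) z≢u z≢v _ | inj₂ (inj₂ (refl , refl)) = contradiction refl z≢v
    avoid-Adj (inj₂ refl) z≢u z≢v _ | inj₂ (inj₂ (refl , refl)) = contradiction refl z≢u

    -- The only edge that can be new in `B⁺` has both `x` and `y` as ends, so a walk that misses one
    -- of them never uses it.
    avoid : ∀ {z} → z ≡ x ⊎ z ≡ y → ∀ l → z ∉ l → WalkIn H B⁺ l → WalkIn H B l
    avoid z≡ []          z∉ w = tt
    avoid z≡ (_ ∷ [])    z∉ w = tt
    avoid z≡ (u ∷ v ∷ l) z∉ (a , w) = avoid-Adj z≡ (λ eq → z∉ (here eq)) (λ eq → z∉ (there (here eq))) a , avoid z≡ (v ∷ l) (z∉ ∘ there) w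

    -- Distinct vertices let a path cross `e₀` only once: the end from which it crosses does not
    -- recur, so `avoid` puts the remainder back into `B`. Labels are constant before and after the
    -- crossing.
    path : ∀ u l → Unique (u ∷ l) → WalkIn H B⁺ (u ∷ l) →
      WalkIn H B (u ∷ l) ⊎ (lab u ≡ lab x × lab (end u l) ≡ lab y) ⊎ (lab u ≡ lab y × lab (end u l) ≡ lab x)
    path u []      un w = inj₁ tt
    path u (v ∷ l) un@(_ ∷ un′) (a , w) with split-Adj a
    ... | inj₁ a′ with path v l un′ w
    ... | inj₁ w′                = inj₁ (a′ , w′)
    ... | inj₂ (inj₁ (p , q))    = inj₂ (inj₁ (trans (Adj-respects {lab} resp a′) p , q))
    ... | inj₂ (inj₂ (p , q))    = inj₂ (inj₂ (trans (Adj-respects {lab} resp a′) p , q))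
    path u (v ∷ l) un (a , w) | inj₂ (inj₁ (refl , refl)) = inj₂ (inj₁ (refl ,
      sym (WalkIn-respects {lab} resp v l (avoid (inj₁ refl) (v ∷ l) (Unique-head un) w))))
    path u (v ∷ l) un (a , w) | inj₂ (inj₂ (refl , refl)) = inj₂ (inj₂ (refl ,
      sym (WalkIn-respects {lab} resp v l (avoid (inj₂ refl) (v ∷ l) (Unique-head un) w))))

    -- The cycle is cut at its first edge. If that edge lies in `B`, the rest is a path between
    -- equal labels, which cannot cross `e₀`. If it is `e₀`, the second edge is not `e₀` again, for
    -- then `a` would be `c`; the rest avoids `b`, hence lies in `B` and would give `x` and `y` the
    -- same label.
    extend-acyclic : Acyclic H B⁺
    extend-acyclic (a , b , c , l , un , (ab , w)) with split-Adj ab | Unique-rotate un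
    ... | inj₁ ab′ | un′ with path b ((c ∷ l) ∷ʳ a) un′ w
    ... | inj₁ w′ = acyclic (a , b , c , l , un , (ab′ , w′))
    ... | inj₂ (inj₁ (p , q)) = lab≢ (trans (sym p) (trans (sym (Adj-respects {lab} resp ab′)) (trans (cong lab (sym (end-∷ʳ b (c ∷ l) a))) q)))
    ... | inj₂ (inj₂ (p , q)) = lab≢ (trans (sym q) (trans (cong lab (end-∷ʳ b (c ∷ l) a)) (trans (Adj-respects {lab} resp ab′) p)))
    extend-acyclic (a , b , c , l , un , (ab , (bc , w))) | inj₂ j | un′ with split-Adj bc
    ... | inj₂ j′ = All.lookup (proj₁ (∷⁻ un)) (there (here refl)) (join-unique j j′)
      where
      ∷⁻ : ∀ {a : V} {xs} → Unique (a ∷ xs) → All (a ≢_) xs × Unique xs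
      ∷⁻ (p ∷ q) = p , q
      join-unique : ∀ {a b c} → Joins a b → Joins b c → a ≡ c
      join-unique (inj₁ (refl , refl)) (inj₁ (refl , refl)) = refl
      join-unique (inj₁ (refl , refl)) (inj₂ (refl , refl)) = refl
      join-unique (inj₂ (refl , refl)) (inj₁ (refl , refl)) = refl
      join-unique (inj₂ (refl , refl)) (inj₂ (refl , refl)) = refl
    ... | inj₁ bc′ = joined j (trans (WalkIn-respects {lab} resp b ((c ∷ l) ∷ʳ a)
          (bc′ , avoid (endpoint j) ((c ∷ l) ∷ʳ a) (Unique-head un′) w)) (cong lab (end-∷ʳ b (c ∷ l) a)))
      where
      endpoint : ∀ {a b} → Joins a b → b ≡ x ⊎ b ≡ y
      endpoint (inj₁ (_ , p)) = inj₂ p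
      endpoint (inj₂ (_ , p)) = inj₁ p
      joined : ∀ {a b} → Joins a b → ¬ (lab b ≡ lab a)
      joined (inj₁ (refl , refl)) eq = lab≢ (sym eq)
      joined (inj₂ (refl , refl)) eq = lab≢ eq

  -- Simple paths and the cycles that they close

  record Path (B : EdgeSet) (u v : V) : Set where
    constructor mkPath
    field
      inner  : List V
      unique : Unique (u ∷ inner)
      walk   : WalkIn H B (u ∷ inner)
      ends   : end u inner ≡ v

  Path-refl : ∀ {B u} → Path B u u
  Path-refl = mkPath [] ([] ∷ []) tt refl

  Path-suffix : ∀ {B u} w l → u ∈ w ∷ l → Unique (w ∷ l) → WalkIn H B (w ∷ l) → Path B u (end w l)
  Path-suffix w l       (here refl) un       walk       = mkPath l un walk refl
  Path-suffix w (v ∷ l) (there u∈)  (_ ∷ un) (_ , walk) = Path-suffix v l u∈ un walk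

  Path-cons : ∀ {B u w v} → Adj H B u w → Path B w v → Path B u v
  Path-cons {B} {u} {w} a (mkPath l un walk refl) with u ∈? (w ∷ l)
  ... | yes u∈ = Path-suffix w l u∈ un walk
  ... | no u∉  = mkPath (w ∷ l) (All.¬Any⇒All¬ _ u∉ ∷ un) (a , walk) refl

  Path-trans : ∀ {B u w v} → Path B u w → Path B w v → Path B u v
  Path-trans {B} {u} (mkPath l un walk refl) q = go u l walk q
    where
    go : ∀ u l {v} → WalkIn H B (u ∷ l) → Path B (end u l) v → Path B u v
    go u []      walk       q = q
    go u (w ∷ l) (a , walk) q = Path-cons a (go w l walk q)

  Path-mono : ∀ {B B′} → B ⊆ B′ → ∀ {u v} → Path B u v → Path B′ u v
  Path-mono sub (mkPath l un walk e) = mkPath l un (WalkIn-mono sub _ walk) e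

  walk-∷ʳ : ∀ {B} u l {z} → WalkIn H B (u ∷ l) → Adj H B (end u l) z → WalkIn H B ((u ∷ l) ∷ʳ z)
  walk-∷ʳ u []      w       a = a , tt
  walk-∷ʳ u (v ∷ l) (b , w) a = b , walk-∷ʳ v l w a

  -- A cycle needs three distinct vertices. A path without edges would make `e₀` a loop, and a path
  -- with a single edge would make that edge parallel to `e₀`; a simple graph has neither.
  path⇒cycle : ∀ {B e₀ x y} → edge H e₀ ≡ (x , y) → e₀ ∉ˢ B → Path B x y → HasCycle H (B [ e₀ ]≔ inside)
  path⇒cycle e₀≡ e₀∉ (mkPath [] un walk refl) = contradiction (edge-ordered e₀≡) (<-irrefl refl)
  path⇒cycle {e₀ = e₀} e₀≡ e₀∉ (mkPath (_ ∷ []) un ((e , e∈ , inj₁ eq) , _) refl) =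
    contradiction (subst (_∈ˢ _) (edge-injective (trans eq (sym e₀≡))) e∈) e₀∉
  path⇒cycle e₀≡ e₀∉ (mkPath (_ ∷ []) un ((e , e∈ , inj₂ eq) , _) refl) =
    contradiction (edge-ordered eq) (<⇒≯ (edge-ordered e₀≡))
  path⇒cycle {B} {e₀} e₀≡ e₀∉ (mkPath (b ∷ c ∷ l) un walk refl) =
    _ , b , c , l , un , walk-∷ʳ _ (b ∷ c ∷ l) (WalkIn-mono (⊆-adjoin e₀) (_ ∷ b ∷ c ∷ l) walk) (e₀ , ∈-adjoin B e₀ , inj₂ e₀≡)

  -- lab v is the representative of the class of v; losers lists the other vertices, the last one to lose first.
  record Partition (r : V) (U : V → Set) : Set where
    field
      lab            : V → V
      lab-idem       : ∀ v → lab (lab v) ≡ lab v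
      lab-root       : lab r ≡ r
      lab-U          : ∀ {v} → U v → U (lab v)
      losers         : List V
      losers-unique  : Unique losers
      losers-U       : ∀ {v} → v ∈ losers → U v
      loser⇒         : ∀ {v} → v ∈ losers → lab v ≢ v
      ⇒loser         : ∀ {v} → lab v ≢ v → v ∈ losers
  open Partition public

  discrete : ∀ {r U} → Partition r U
  discrete = record { lab = id ; lab-idem = λ _ → refl ; lab-root = refl ; lab-U = id ; losers = [] ; losers-unique = []
    ; losers-U = λ () ; loser⇒ = λ () ; ⇒loser = λ v≢v → contradiction refl v≢v }

  -- Either of the two representatives may lose, so `loser` is not specified further. The field
  -- `only` limits the coarsening: it is what allows a path to be built between any two vertices
  -- that the merge has put together.
  record Merged {r U} (P : Partition r U) (x y : V) : Set where
    field
      result   : Partition r U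
      loser    : V
      losers≡  : losers result ≡ loser ∷ losers P
      coarser  : ∀ {u v} → lab P u ≡ lab P v → lab result u ≡ lab result v
      joined   : lab result x ≡ lab result y
      only     : ∀ {u v} → lab result u ≡ lab result v →
                 lab P u ≡ lab P v ⊎ (lab P u ≡ lab P x × lab P v ≡ lab P y) ⊎ (lab P u ≡ lab P y × lab P v ≡ lab P x)

  module MergeInto {r U} (P : Partition r U) {x y : V} (Ux : U x) (Uy : U y) (lab≢ : lab P x ≢ lab P y) (y≢r : lab P y ≢ r) where
    a b : V
    a = lab P x
    b = lab P y

    relabel : V → V
    relabel l with l ≟ᶠ b
    ... | yes _ = a
    ... | no _  = l

    relabel-b : relabel b ≡ a
    relabel-b with b ≟ᶠ b
    ... | yes _ = refl
    ... | no b≢ = contradiction refl b≢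

    relabel-≢ : ∀ {l} → l ≢ b → relabel l ≡ l
    relabel-≢ {l} l≢ with l ≟ᶠ b
    ... | yes l≡ = contradiction l≡ l≢
    ... | no _   = refl

    newLab : V → V
    newLab v = relabel (lab P v)

    new-a : newLab a ≡ a
    new-a = trans (cong relabel (lab-idem P x)) (relabel-≢ lab≢)

    idem : ∀ v → newLab (newLab v) ≡ newLab v
    idem v with lab P v ≟ᶠ b
    ... | yes _ = new-a
    ... | no l≢ = trans (cong relabel (lab-idem P v)) (relabel-≢ l≢)

    b∉ : b ∉ losers P
    b∉ b∈ = loser⇒ P b∈ (lab-idem P y)

    new-U : ∀ {v} → U v → U (newLab v)
    new-U {v} Uv with lab P v ≟ᶠ b
    ... | yes _ = lab-U P Ux
    ... | no _  = lab-U P Uv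

    new-loser⇒ : ∀ {v} → v ∈ b ∷ losers P → newLab v ≢ v
    new-loser⇒ {v} (here refl) eq = lab≢ (trans (sym (trans (cong relabel (lab-idem P y)) relabel-b)) eq)
    new-loser⇒ {v} (there v∈) eq with lab P v ≟ᶠ b
    ... | yes _ = loser⇒ P v∈ (subst (λ z → lab P z ≡ z) eq (lab-idem P x))
    ... | no _  = loser⇒ P v∈ eq

    ⇒new-loser : ∀ {v} → newLab v ≢ v → v ∈ b ∷ losers P
    ⇒new-loser {v} neq with v ≟ᶠ b
    ... | yes v≡ = here v≡
    ... | no v≢  = there (⇒loser P (λ eq → neq (trans (relabel-≢ (λ l≡ → v≢ (trans (sym eq) l≡))) eq)))

    only : ∀ {u v} → newLab u ≡ newLab v →
      lab P u ≡ lab P v ⊎ (lab P u ≡ a × lab P v ≡ b) ⊎ (lab P u ≡ b × lab P v ≡ a)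
    only {u} {v} eq with lab P u ≟ᶠ b | lab P v ≟ᶠ b
    ... | yes p | yes q = inj₁ (trans p (sym q))
    ... | yes p | no _  = inj₂ (inj₂ (p , sym eq))
    ... | no _  | yes q = inj₂ (inj₁ (eq , q))
    ... | no _  | no _  = inj₁ eq

    merged : Merged P x y
    merged = record
      { result = record
          { lab = newLab ; lab-idem = idem
          ; lab-root = trans (cong relabel (lab-root P)) (relabel-≢ (λ r≡ → y≢r (sym r≡)))
          ; lab-U = new-U ; losers = b ∷ losers P ; losers-unique = All.¬Any⇒All¬ _ b∉ ∷ losers-unique P
          ; losers-U = λ { (here refl) → lab-U P Uy ; (there v∈) → losers-U P v∈ }
          ; loser⇒ = new-loser⇒ ; ⇒loser = ⇒new-loser }
      ; loser = b ; losers≡ = refl ; coarser = cong relabel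
      ; joined = trans (relabel-≢ lab≢) (sym relabel-b)
      ; only = only
      }

  -- The root represents at most one of the two classes, so one of the two directions of merging
  -- spares it.
  merge : ∀ {r U} (P : Partition r U) {x y} → U x → U y → lab P x ≢ lab P y → Merged P x y
  merge {r} P {x} {y} Ux Uy lab≢ with lab P y ≟ᶠ r
  ... | no y≢r   = MergeInto.merged P Ux Uy lab≢ y≢r
  ... | yes y≡r = record { result = result ; loser = loser ; losers≡ = losers≡ ; coarser = coarser ; joined = sym joined
      ; only = λ eq → Sum.map₂ Sum.swap (only eq) }
    where open Merged (MergeInto.merged P Uy Ux (lab≢ ∘ sym) (λ x≡r → lab≢ (trans x≡r (sym y≡r))))

  root∉losers : ∀ {r U} (P : Partition r U) → r ∉ losers P
  root∉losers P r∈ = loser⇒ P r∈ (lab-root P)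

  -- When the edges are added one at a time, an edge within a class would close a cycle with the
  -- path that connects its ends, so each edge merges two classes and produces one loser. Counting
  -- losers thus bounds the size of a forest.
  forest-partition : ∀ {r U} k B → ∣ B ∣ ≡ k → Acyclic H B →
    (∀ {e} → e ∈ˢ B → U (proj₁ (edge H e)) × U (proj₂ (edge H e))) →
    Σ (Partition r U) λ P → length (losers P) ≡ k × (∀ {u v} → lab P u ≡ lab P v → Path B u v)
  forest-partition zero B size ac BU = discrete , refl , λ { refl → Path-refl }
  forest-partition {r} {U} (suc k) B size ac BU with unadjoin B size
  ... | B₀ , e , e∉ , refl , size₀
    with forest-partition {r} {U} k B₀ size₀ (Acyclic-mono (⊆-adjoin e) ac) (λ f∈ → BU (⊆-adjoin e f∈))
  ... | P , len , conn with lab P (proj₁ (edge H e)) ≟ᶠ lab P (proj₂ (edge H e))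
  ... | yes eq = contradiction (path⇒cycle refl e∉ (conn eq)) ac
  ... | no neq = result , trans (cong length losers≡) (cong suc len) , connected
    where
    open Merged (merge P (proj₁ (BU (∈-adjoin B₀ e))) (proj₂ (BU (∈-adjoin B₀ e))) neq)
    sub : ∀ {u v} → lab P u ≡ lab P v → Path B u v
    sub eq = Path-mono (⊆-adjoin e) (conn eq)
    connected : ∀ {u v} → lab result u ≡ lab result v → Path B u v
    connected eq with only eq
    ... | inj₁ eq′            = sub eq′
    ... | inj₂ (inj₁ (p , q)) = Path-trans (sub p) (Path-cons (e , ∈-adjoin B₀ e , inj₁ refl) (sub (sym q)))
    ... | inj₂ (inj₂ (p , q)) = Path-trans (sub p) (Path-cons (e , ∈-adjoin B₀ e , inj₂ refl) (sub (sym q)))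

-- The cone over the support of a graph

tri : ℕ → ℕ
tri zero    = 0
tri (suc p) = suc p + tri p

-- Case distinction on `Fin (suc n)` seen as the image of `inject₁` together with the last element
-- `fromℕ n`, which will be the apex.
onTop : ∀ {A : Set} {n} → A → (Fin n → A) → Fin (suc n) → A
onTop {n = zero}  a f _        = a
onTop {n = suc _} a f fzero    = f fzero
onTop {n = suc _} a f (fsuc v) = onTop a (f ∘ fsuc) v

onTop-fromℕ : ∀ {A : Set} {n} (a : A) (f : Fin n → A) → onTop a f (fromℕ n) ≡ a
onTop-fromℕ {n = zero}  a f = refl
onTop-fromℕ {n = suc n} a f = onTop-fromℕ a (f ∘ fsuc)

onTop-inject₁ : ∀ {A : Set} {n} (a : A) (f : Fin n → A) i → onTop a f (inject₁ i) ≡ f i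
onTop-inject₁ {n = suc n} a f fzero    = refl
onTop-inject₁ {n = suc n} a f (fsuc i) = onTop-inject₁ a (f ∘ fsuc) i

does-true : ∀ {P : Set} (d : Dec P) → does d ≡ true → P
does-true (yes p) _ = p

∣tabulate∣ : ∀ {A : Set} {P : A → Set} (P? : ∀ x → Dec (P x)) xs → ∣ Vec.tabulate (does ∘ P? ∘ lookup xs) ∣ ≡ length (filter P? xs)
∣tabulate∣ P? []       = refl
∣tabulate∣ P? (x ∷ xs) with does (P? x)
... | true  = cong suc (∣tabulate∣ P? xs)
... | false = ∣tabulate∣ P? xs

insert-middle : ∀ a b p {c q} → a + c ≡ p + q → a + (b + c) ≡ p + (b + q)
insert-middle a b p {c} {q} eq = trans (solve 3 (λ a b c → a :+ (b :+ c) := b :+ (a :+ c)) refl a b c)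
  (trans (cong (b +_) eq) (solve 3 (λ a b c → b :+ (a :+ c) := a :+ (b :+ c)) refl p b q))

module Cone (G : Graph) (ws : List (Fin (n G))) (ws-unique : Unique ws)
  (covers : ∀ {u v} → (u , v) ∈ edges G → u ∈ ws × v ∈ ws) where

  N : ℕ
  N = n G

  -- As the largest number, the apex leaves the old vertices their numbers, so the edges of `G` can
  -- be copied to the output unchanged, and it is the upper end of every spoke.
  apex : Fin (suc N)
  apex = fromℕ N

  lift : Fin N × Fin N → Fin (suc N) × Fin (suc N)
  lift (u , v) = inject₁ u , inject₁ v

  star : Fin N → Fin (suc N) × Fin (suc N)
  star w = inject₁ w , apex

  base spokes coneEdges : List (Fin (suc N) × Fin (suc N))
  base      = map lift (edges G)
  spokes    = map star ws
  coneEdges = base ++ spokes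

  lift-injective : ∀ {e f} → lift e ≡ lift f → e ≡ f
  lift-injective eq = cong₂ _,_ (inject₁-injective (cong proj₁ eq)) (inject₁-injective (cong proj₂ eq))

  star-injective : ∀ {v w} → star v ≡ star w → v ≡ w
  star-injective eq = inject₁-injective (cong proj₁ eq)

  inject₁<apex : ∀ w → toℕ (inject₁ w) < toℕ apex
  inject₁<apex w = subst₂ _<_ (sym (toℕ-inject₁ w)) (sym (toℕ-fromℕ N)) (toℕ<n w)

  H : Graph
  H = record
    { n       = suc N
    ; edges   = coneEdges
    ; ordered = All.++⁺
        (All.map⁺ (All.map (λ {(u , v)} lt → subst₂ _<_ (sym (toℕ-inject₁ u)) (sym (toℕ-inject₁ v)) lt) (ordered G)))
        (All.map⁺ (All.tabulate (λ {w} _ → inject₁<apex w)))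
    ; nodup   = Unique.++⁺ (Unique.map⁺ lift-injective (nodup G)) (Unique.map⁺ star-injective ws-unique) disjoint
    }
    where
    disjoint : ∀ {e} → e ∈ base × e ∈ spokes → _
    disjoint (e∈b , e∈s) with ∈-map⁻ lift e∈b | ∈-map⁻ star e∈s
    ... | _ , _ , refl | _ , _ , eq = fromℕ≢inject₁ (sym (cong proj₂ eq))

  open Cycles H
  open DecMembership (_≟ᶠ_ {suc N}) using (_∈?_)

  data ConeEdge : Fin (suc N) × Fin (suc N) → Set where
    is-base  : ∀ {u v} → (u , v) ∈ edges G → ConeEdge (lift (u , v))
    is-spoke : ∀ {w} → w ∈ ws → ConeEdge (star w)

  coneEdge : ∀ {e} → e ∈ coneEdges → ConeEdge e
  coneEdge e∈ with ∈-++⁻ base e∈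
  ... | inj₁ e∈b with ∈-map⁻ lift e∈b
  ... | _ , uv∈ , refl = is-base uv∈
  coneEdge e∈ | inj₂ e∈s with ∈-map⁻ star e∈s
  ... | _ , w∈ , refl = is-spoke w∈

  coneEdge′ : ∀ e → ConeEdge (edge H e)
  coneEdge′ e = coneEdge (∈-lookup e)

  -- From a linear ordering of the edges of the cone to an ordering of the vertices

  -- Carried along in the partition so that no vertex outside `ws` ever loses; this is how the final
  -- number of losers is bounded by `length ws`.
  Touched : Fin (suc N) → Set
  Touched v = v ≡ apex ⊎ v ∈ map inject₁ ws

  touched : ∀ {e} → ConeEdge e → Touched (proj₁ e) × Touched (proj₂ e)
  touched (is-base uv∈)  = inj₂ (∈-map⁺ inject₁ (proj₁ (covers uv∈))) , inj₂ (∈-map⁺ inject₁ (proj₂ (covers uv∈)))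
  touched (is-spoke w∈) = inj₂ (∈-map⁺ inject₁ w∈) , inj₁ refl

  Within : List (Fin (suc N)) → Fin (suc N) × Fin (suc N) → Set
  Within L (u , v) = u ∈ L × v ∈ L

  within? : ∀ L e → Dec (Within L e)
  within? L (u , v) = (u ∈? L) ×-dec (v ∈? L)

  count : List (Fin (suc N)) → List (Fin (suc N) × Fin (suc N)) → ℕ
  count L es = length (filter (within? L) es)

  -- The list is in reverse order: its last element has position 1, an element outside has position 0.
  pos : List (Fin (suc N)) → Fin (suc N) → ℕ
  pos []      v = 0
  pos (w ∷ L) v with v ≟ᶠ w
  ... | yes _ = suc (length L)
  ... | no _  = pos L v

  pos≤ : ∀ L v → pos L v ≤ length L
  pos≤ []      v = z≤n
  pos≤ (w ∷ L) v with v ≟ᶠ w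
  ... | yes _ = ≤-refl
  ... | no _  = m≤n⇒m≤1+n (pos≤ L v)

  pos-there : ∀ {w L v} → w ∉ L → v ∈ L → pos (w ∷ L) v ≡ pos L v
  pos-there {w} {L} {v} w∉ v∈ with v ≟ᶠ w
  ... | yes refl = contradiction v∈ w∉
  ... | no _     = refl

  pos>0 : ∀ {L v} → v ∈ L → 0 < pos L v
  pos>0 {w ∷ L} {v} v∈ with v ≟ᶠ w
  ... | yes _ = s≤s z≤n
  pos>0 {w ∷ L} {v} (here v≡w) | no v≢w = contradiction v≡w v≢w
  pos>0 {w ∷ L} {v} (there v∈) | no _   = pos>0 v∈

  pos-injective : ∀ {L u v} → u ∈ L → v ∈ L → pos L u ≡ pos L v → u ≡ v
  pos-injective {w ∷ L} {u} {v} u∈ v∈ eq with u ≟ᶠ w | v ≟ᶠ w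
  ... | yes p | yes q = trans p (sym q)
  ... | yes _ | no _  = contradiction (sym eq) (<⇒≢ (s≤s (pos≤ L v)))
  ... | no _  | yes _ = contradiction eq (<⇒≢ (s≤s (pos≤ L u)))
  pos-injective {w ∷ L} (here p) _ eq | no u≢ | no _ = contradiction p u≢
  pos-injective {w ∷ L} (there _) (here q) eq | no _ | no v≢ = contradiction q v≢
  pos-injective {w ∷ L} (there u∈) (there v∈) eq | no _ | no _ = pos-injective u∈ v∈ eq

  -- An edge that is not yet inside the list costs nothing, so the sum over all of `base` is the
  -- MLVC cost of the subgraph that the list induces, and it can be followed while the list grows.
  latency : List (Fin (suc N)) → Fin (suc N) × Fin (suc N) → ℕ
  latency L e with within? L e
  ... | yes _ = pos L (proj₁ e) ⊔ pos L (proj₂ e)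
  ... | no _  = 0

  latencies : List (Fin (suc N)) → List (Fin (suc N) × Fin (suc N)) → ℕ
  latencies L es = sum (map (latency L) es)

  latency-in : ∀ {L e} → Within L e → latency L e ≡ pos L (proj₁ e) ⊔ pos L (proj₂ e)
  latency-in {L} {e} p with within? L e
  ... | yes _ = refl
  ... | no ¬p = contradiction p ¬p

  latency-out : ∀ {L e} → ¬ Within L e → latency L e ≡ 0
  latency-out {L} {e} ¬p with within? L e
  ... | yes p = contradiction p ¬p
  ... | no _  = refl

  count-in : ∀ {L e es} → Within L e → count L (e ∷ es) ≡ suc (count L es)
  count-in {L} p = cong length (filter-accept (within? L) p)

  count-out : ∀ {L e es} → ¬ Within L e → count L (e ∷ es) ≡ count L es
  count-out {L} ¬p = cong length (filter-reject (within? L) ¬p)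

  -- Every edge that enters the list together with w has latency at most 1 + length L.
  latencies-∷ : ∀ {w L} → w ∉ L → ∀ es →
    latencies (w ∷ L) es + suc (length L) * count L es ≤ latencies L es + suc (length L) * count (w ∷ L) es
  latencies-∷ {w} {L} w∉ [] = ≤-refl
  latencies-∷ {w} {L} w∉ (e@(u , v) ∷ es) = add (within? L e) (within? (w ∷ L) e)
    where
    l = suc (length L)
    a = latencies (w ∷ L) es
    b = latencies L es
    c = count L es
    d = count (w ∷ L) es
    rec : a + l * c ≤ b + l * d
    rec = latencies-∷ w∉ es
    add : Dec (Within L e) → Dec (Within (w ∷ L) e) →
      latency (w ∷ L) e + a + l * count L (e ∷ es) ≤ latency L e + b + l * count (w ∷ L) (e ∷ es)
    add (yes p) (no ¬q) = contradiction (there (proj₁ p) , there (proj₂ p)) ¬q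
    add (yes p@(u∈ , v∈)) (yes q)
      rewrite latency-in p | latency-in q | count-in {es = es} p | count-in {es = es} q | pos-there w∉ u∈ | pos-there w∉ v∈ = begin
      x + a + l * suc c     ≡⟨ solve 4 (λ x a l c → x :+ a :+ l :* (con 1 :+ c) := x :+ l :+ (a :+ l :* c)) refl x a l c ⟩
      x + l + (a + l * c)   ≤⟨ +-monoʳ-≤ (x + l) rec ⟩
      x + l + (b + l * d)   ≡⟨ solve 4 (λ x a l c → x :+ a :+ l :* (con 1 :+ c) := x :+ l :+ (a :+ l :* c)) refl x b l d ⟨
      x + b + l * suc d     ∎
      where
      open ≤-Reasoning
      x = pos L u ⊔ pos L v
    add (no ¬p) (yes q)
      rewrite latency-out ¬p | latency-in q | count-out {es = es} ¬p | count-in {es = es} q = begin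
      x + a + l * c     ≡⟨ +-assoc x a (l * c) ⟩
      x + (a + l * c)   ≤⟨ +-mono-≤ (⊔-lub (pos≤ (w ∷ L) u) (pos≤ (w ∷ L) v)) rec ⟩
      l + (b + l * d)   ≡⟨ solve 3 (λ l b d → l :+ (b :+ l :* d) := b :+ l :* (con 1 :+ d)) refl l b d ⟩
      b + l * suc d     ∎
      where
      open ≤-Reasoning
      x = pos (w ∷ L) u ⊔ pos (w ∷ L) v
    add (no ¬p) (no ¬q)
      rewrite latency-out ¬p | latency-out ¬q | count-out {es = es} ¬p | count-out {es = es} ¬q = rec

  -- Each edge inside a class is charged to a loser that it ties to the representative, or to itself
  -- if both its ends are losers.
  data Charged (lb : V → V) : V × V → (V × V) ⊎ V → Set where
    to-lower : ∀ {x y} → lb x ≡ y → Charged lb (x , y) (inj₂ x)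
    to-upper : ∀ {x y} → lb y ≡ x → Charged lb (x , y) (inj₂ y)
    to-self  : ∀ {x y} → lb x ≢ x → lb y ≢ y → Charged lb (x , y) (inj₁ (x , y))

  -- A charged vertex knows the other end of the edge, namely its representative. The reversed pair
  -- is excluded by the orientation of edges.
  Charged-injective : ∀ {lb e f c} → Charged lb e c → Charged lb f c →
    toℕ (proj₁ e) < toℕ (proj₂ e) → toℕ (proj₁ f) < toℕ (proj₂ f) → e ≡ f
  Charged-injective (to-lower refl) (to-lower refl) _ _ = refl
  Charged-injective (to-lower refl) (to-upper refl) p q = contradiction p (<⇒≯ q)
  Charged-injective (to-upper refl) (to-lower refl) p q = contradiction p (<⇒≯ q)
  Charged-injective (to-upper refl) (to-upper refl) _ _ = refl
  Charged-injective (to-self _ _)   (to-self _ _)   _ _ = refl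

  charge : ∀ lb {x y} → lb x ≡ lb y → ∃ (Charged lb (x , y))
  charge lb {x} {y} eq with lb y ≟ᶠ y | lb x ≟ᶠ x
  ... | yes y≡ | _      = inj₂ x , to-lower (trans eq y≡)
  ... | no _   | yes x≡ = inj₂ y , to-upper (trans (sym eq) x≡)
  ... | no y≢  | no x≢  = inj₁ (x , y) , to-self x≢ y≢

  targets : List V → List ((V × V) ⊎ V)
  targets L = map inj₁ (filter (within? L) base) ++ map inj₂ L

  length-targets : ∀ L → length (targets L) ≡ length L + count L base
  length-targets L = trans (length-++ (map inj₁ (filter (within? L) base)))
    (trans (cong₂ _+_ (length-map inj₁ (filter (within? L) base)) (length-map inj₂ L)) (+-comm (count L base) (length L)))

  Charged-target : ∀ {U} (P : Partition apex U) {x y c} → (x , y) ∈ coneEdges → toℕ x < toℕ y → lab P x ≡ lab P y →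
    Charged (lab P) (x , y) c → c ∈ targets (losers P)
  Charged-target P e∈ x<y eq (to-lower refl) = ∈-++⁺ʳ _ (∈-map⁺ inj₂ (⇒loser P (λ ≡x → <⇒≢ x<y (cong toℕ (sym ≡x)))))
  Charged-target P e∈ x<y eq (to-upper refl) = ∈-++⁺ʳ _ (∈-map⁺ inj₂ (⇒loser P (λ ≡y → <⇒≢ x<y (cong toℕ ≡y))))
  Charged-target P e∈ x<y eq (to-self x≢ y≢) with coneEdge e∈
  ... | is-base uv∈ = ∈-++⁺ˡ (∈-map⁺ inj₁ (∈-filter⁺ (within? (losers P)) (∈-map⁺ lift uv∈) (⇒loser P x≢ , ⇒loser P y≢)))
  -- No spoke is charged to itself, because the apex represents its own class.
  ... | is-spoke _  = contradiction (lab-root P) y≢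

  in-prefix : ∀ σ {e j} → toℕ (σ ⟨$⟩ʳ e) ≤ toℕ j → e ∈ˢ prefix H σ j
  in-prefix σ {e} {j} le = lookup⇒[]= e _ (trans (lookup∘tabulate _ e) (dec-true ((σ ⟨$⟩ʳ e) ≤ᶠ? j) le))

  prefix-in : ∀ σ {e j} → e ∈ˢ prefix H σ j → toℕ (σ ⟨$⟩ʳ e) ≤ toℕ j
  prefix-in σ {e} {j} e∈ = does-true ((σ ⟨$⟩ʳ e) ≤ᶠ? j) (trans (sym (lookup∘tabulate _ e)) ([]=⇒lookup e∈))

  module FromOrder (σ : Permutation′ (m H)) (ρ : Fin (m H) → ℕ) (ranks : ∀ j → IsRank H (prefix H σ j) (ρ j)) where

    ρ̂ : ℕ → ℕ
    ρ̂ t with t <? m H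
    ... | yes t<m = ρ (fromℕ< t<m)
    ... | no _    = 0

    ρ̂-< : ∀ {t} (t<m : t < m H) → ρ̂ t ≡ ρ (fromℕ< t<m)
    ρ̂-< {t} t<m with t <? m H
    ... | yes _  = refl
    ... | no t≮m = contradiction t<m t≮m

    time : E → ℕ
    time e = toℕ (σ ⟨$⟩ʳ e)

    -- State of Kruskal's algorithm after `t` edges. The forest `basis` of accepted edges has one
    -- edge per loser, which turns the number of losers into a lower bound on the given ranks.
    record State (t : ℕ) : Set where
      field
        part     : Partition apex Touched
        basis    : EdgeSet
        acyclic  : Acyclic H basis
        early    : ∀ {e} → e ∈ˢ basis → time e < t
        size     : ∣ basis ∣ ≡ length (losers part)
        spanned  : ∀ e → time e < t → lab part (proj₁ (edge H e)) ≡ lab part (proj₂ (edge H e))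
        -- Form without subtraction: the first construction on the losers costs `tri` plus
        -- `latencies` and fills as many positions as the last factor says; those beyond `t` are
        -- still open, and each is credited with the current number of losers.
        progress : tri (length (losers part)) + latencies (losers part) base + length (losers part) * t
                   ≤ sumBelow t ρ̂ + length (losers part) * (length (losers part) + count (losers part) base)

    spanned-count : ∀ {U} (P : Partition apex U) {t} → t ≤ m H →
      (∀ e → time e < t → lab P (proj₁ (edge H e)) ≡ lab P (proj₂ (edge H e))) →
      t ≤ length (losers P) + count (losers P) base
    spanned-count P {t} t≤m sp = ≤-trans (pigeonhole-∈ (λ i → proj₁ (charged i)) (targets (losers P)) injective
        (λ i → Charged-target P (∈-lookup (at i)) (edge-ordered refl) (sp (at i) (at-early i)) (proj₂ (charged i))))
      (≤-reflexive (length-targets (losers P)))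
      where
      at : Fin t → E
      at i = σ ⟨$⟩ˡ inject≤ i t≤m
      time-at : ∀ i → time (at i) ≡ toℕ i
      time-at i = trans (cong toℕ (inverseʳ σ)) (toℕ-inject≤ i t≤m)
      at-early : ∀ i → time (at i) < t
      at-early i = subst (_< t) (sym (time-at i)) (toℕ<n i)
      charged : ∀ i → ∃ (Charged (lab P) (edge H (at i)))
      charged i = charge (lab P) (sp (at i) (at-early i))
      injective : ∀ {i j} → proj₁ (charged i) ≡ proj₁ (charged j) → i ≡ j
      injective {i} {j} eq = toℕ-injective (trans (sym (time-at i)) (trans (cong time (edge-injective
        (Charged-injective (proj₂ (charged i)) (subst (Charged (lab P) (edge H (at j))) (sym eq) (proj₂ (charged j)))
          (edge-ordered {at i} refl) (edge-ordered {at j} refl)))) (time-at j)))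

    initial : State 0
    initial = record { part = discrete ; basis = ∅ ; acyclic = no-cycle ; early = λ e∈ → contradiction e∈ ∉⊥ ; size = ∣⊥∣≡0 (m H)
      ; spanned = λ _ () ; progress = ≤-reflexive (cong (_+ 0) (no-latency base)) }
      where
      no-cycle : Acyclic H ∅
      no-cycle (_ , _ , _ , _ , _ , ((_ , e∈ , _) , _)) = ∉⊥ e∈
      no-latency : ∀ es → latencies [] es ≡ 0
      no-latency []             = refl
      no-latency ((u , v) ∷ es) = cong₂ _+_ (latency-out {[]} {u , v} λ { (() , _) }) (no-latency es)

    next : ∀ {t} → t < m H → State t → State (suc t)
    next {t} t<m s = advance (lab part x ≟ᶠ lab part y)
      where
      open State s
      L = losers part
      l = length L
      c = count L base
      now : Fin (m H)
      now = fromℕ< t<m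
      e : E
      e = σ ⟨$⟩ˡ now
      x y : V
      x = proj₁ (edge H e)
      y = proj₂ (edge H e)
      time-e : time e ≡ t
      time-e = trans (cong toℕ (inverseʳ σ)) (toℕ-fromℕ< t<m)
      e-only : ∀ {f} → time f ≡ t → f ≡ e
      e-only {f} eq = trans (sym (inverseˡ σ)) (cong (σ ⟨$⟩ˡ_) (toℕ-injective (trans eq (sym (toℕ-fromℕ< t<m)))))
      earlier : ∀ {f} → time f < suc t → time f < t ⊎ f ≡ e
      earlier {f} (s≤s le) with m≤n⇒m<n∨m≡n le
      ... | inj₁ lt = inj₁ lt
      ... | inj₂ eq = inj₂ (e-only eq)
      rank≥ : ∀ B → (∀ {f} → f ∈ˢ B → time f < suc t) → Acyclic H B → ∣ B ∣ ≤ ρ̂ t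
      rank≥ B B-early ac = subst (∣ B ∣ ≤_) (sym (ρ̂-< t<m)) (proj₂ (ranks now) B
        (λ f∈ → in-prefix σ (subst (_ ≤_) (sym (toℕ-fromℕ< t<m)) (s≤s⁻¹ (B-early f∈)))) ac)
      advance : Dec (lab part x ≡ lab part y) → State (suc t)
      -- One open position is used up, so the left side grows by `l`, and the old forest shows that
      -- the current rank is at least `l`.
      advance (yes eq) = record { part = part ; basis = basis ; acyclic = acyclic ; early = m≤n⇒m≤1+n ∘ early ; size = size
        ; spanned = λ f lt → Sum.[ spanned f , (λ { refl → eq }) ] (earlier lt) ; progress = begin
            tri l + latencies L base + l * suc t     ≡⟨ solve 3 (λ a l t → a :+ l :* (con 1 :+ t) := a :+ l :* t :+ l) refl (tri l + latencies L base) l t ⟩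
            tri l + latencies L base + l * t + l     ≤⟨ +-mono-≤ progress (≤-trans (≤-reflexive (sym size)) (rank≥ basis (m≤n⇒m≤1+n ∘ early) acyclic)) ⟩
            sumBelow t ρ̂ + l * (l + c) + ρ̂ t         ≡⟨ solve 3 (λ a b c → a :+ b :+ c := a :+ c :+ b) refl (sumBelow t ρ̂) (l * (l + c)) (ρ̂ t) ⟩
            sumBelow t ρ̂ + ρ̂ t + l * (l + c)         ∎ }
        where open ≤-Reasoning
      advance (no neq) = record { part = result ; basis = basis⁺ ; acyclic = extend-acyclic ; early = early⁺
        ; size = trans size⁺ (sym (cong length losers≡))
        ; spanned = λ f lt → Sum.[ coarser ∘ spanned f , (λ { refl → joined }) ] (earlier lt)
        ; progress = subst (λ K → tri (length K) + latencies K base + length K * suc t ≤ sumBelow (suc t) ρ̂ + length K * (length K + count K base))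
            (sym losers≡) progress⁺ }
        where
        open Merged (merge part (proj₁ (touched (coneEdge′ e))) (proj₂ (touched (coneEdge′ e))) neq)
        basis⁺ : EdgeSet
        basis⁺ = basis [ e ]≔ inside
        open Extend {lab part} {basis} (λ f∈ → spanned _ (early f∈)) acyclic e refl neq using (extend-acyclic)
        early⁺ : ∀ {f} → f ∈ˢ basis⁺ → time f < suc t
        early⁺ f∈ with adjoin-∈ basis e f∈
        ... | inj₁ refl = s≤s (≤-reflexive time-e)
        ... | inj₂ f∈B  = m≤n⇒m≤1+n (early f∈B)
        size⁺ : ∣ basis⁺ ∣ ≡ suc l
        size⁺ = trans (∣adjoin∣ basis e (λ e∈ → <-irrefl time-e (early e∈))) (cong suc size)
        loser∉ : loser ∉ L
        loser∉ = Unique-head (subst Unique losers≡ (losers-unique result))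
        K = loser ∷ L
        d = count K base
        g = latencies L base
        g⁺ = latencies K base
        q = sumBelow t ρ̂
        k = suc l
        progress⁺ : tri k + g⁺ + k * suc t ≤ q + ρ̂ t + k * (k + d)
        -- Adding `k * c` makes `latencies-∷` applicable without subtraction. Of the remaining
        -- growth, `t` is bounded by `spanned-count` and one `k` by the new rank; the other `k`,
        -- which comes from `tri k`, fits exactly because `l * l + l + k` is `k * k`.
        progress⁺ = +-cancelʳ-≤ (k * c) _ _ (begin
          tri k + g⁺ + k * suc t + k * c
            ≡⟨ solve 5 (λ T g l t c → (con 1 :+ l) :+ T :+ g :+ (con 1 :+ l) :* (con 1 :+ t) :+ (con 1 :+ l) :* c
                 := T :+ l :* t :+ (g :+ (con 1 :+ l) :* c) :+ t :+ (con 1 :+ l) :+ (con 1 :+ l)) refl (tri l) g⁺ l t c ⟩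
          tri l + l * t + (g⁺ + k * c) + t + k + k
            ≤⟨ +-mono-≤ (+-monoˡ-≤ k (+-mono-≤ (+-monoʳ-≤ (tri l + l * t) (latencies-∷ loser∉ base)) (spanned-count part (<⇒≤ t<m) spanned)))
                 (≤-trans (≤-reflexive (sym size⁺)) (rank≥ basis⁺ early⁺ extend-acyclic)) ⟩
          tri l + l * t + (g + k * d) + (l + c) + k + ρ̂ t
            ≡⟨ solve 7 (λ T g l t c d r → T :+ l :* t :+ (g :+ (con 1 :+ l) :* d) :+ (l :+ c) :+ (con 1 :+ l) :+ r
                 := T :+ g :+ l :* t :+ ((con 1 :+ l) :* d :+ (l :+ c) :+ (con 1 :+ l) :+ r)) refl (tri l) g l t c d (ρ̂ t) ⟩
          tri l + g + l * t + (k * d + (l + c) + k + ρ̂ t)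
            ≤⟨ +-monoˡ-≤ _ progress ⟩
          q + l * (l + c) + (k * d + (l + c) + k + ρ̂ t)
            ≡⟨ solve 5 (λ q l c d r → q :+ l :* (l :+ c) :+ ((con 1 :+ l) :* d :+ (l :+ c) :+ (con 1 :+ l) :+ r)
                 := q :+ r :+ (con 1 :+ l) :* ((con 1 :+ l) :+ d) :+ (con 1 :+ l) :* c) refl q l c d (ρ̂ t) ⟩
          q + ρ̂ t + k * (k + d) + k * c ∎)
          where open ≤-Reasoning

    states : ∀ t → t ≤ m H → State t
    states zero    _   = initial
    states (suc t) t<m = next t<m (states t (<⇒≤ t<m))

    sumρ : sumFin (m H) ρ ≡ sumBelow (m H) ρ̂
    sumρ = trans (sumFin-cong (m H) (λ j → sym (trans (ρ̂-< (toℕ<n j)) (cong ρ (fromℕ<-toℕ j (toℕ<n j)))))) (sumFin≡sumBelow (m H) ρ̂)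

    -- At the end all spokes are spanned, so every vertex of `ws` has lost to the apex. Then the
    -- capacity `l + count L base` equals `m H`, and the products on the two sides of `progress`
    -- cancel.
    ordering : ∃ λ L → (∀ {v} → v ∈ map inject₁ ws → v ∈ L) × tri (length ws) + latencies L base ≤ sumFin (m H) ρ
    ordering = L , in-losers , +-cancelʳ-≤ (p * m H) _ _ (begin
        tri p + latencies L base + p * m H                ≡⟨ cong (λ l → tri l + latencies L base + l * m H) l≡p ⟨
        tri l + latencies L base + l * m H                ≤⟨ progress ⟩
        sumBelow (m H) ρ̂ + l * (l + count L base)         ≡⟨ cong₂ _+_ (sym sumρ) (cong₂ _*_ l≡p (trans (cong₂ _+_ l≡p count≡) (sym m≡))) ⟩
        sumFin (m H) ρ + p * m H                          ∎)
      where
      open ≤-Reasoning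
      open State (states (m H) ≤-refl)
      L = losers part
      l = length L
      p = length ws
      m≡ : m H ≡ p + length base
      m≡ = trans (length-++ base) (trans (cong (length base +_) (length-map star ws)) (+-comm (length base) p))
      in-losers : ∀ {v} → v ∈ map inject₁ ws → v ∈ L
      in-losers v∈ with ∈-map⁻ inject₁ v∈
      ... | w , w∈ , refl = ⇒loser part λ eq → fromℕ≢inject₁ (trans (sym (lab-root part)) (trans (sym spoke-spanned) eq))
        where
        spoke∈ : star w ∈ coneEdges
        spoke∈ = ∈-++⁺ʳ base (∈-map⁺ star w∈)
        spoke-spanned : lab part (inject₁ w) ≡ lab part apex
        spoke-spanned = subst (λ f → lab part (proj₁ f) ≡ lab part (proj₂ f)) (sym (lookup-index spoke∈))
          (spanned (Any.index spoke∈) (toℕ<n (σ ⟨$⟩ʳ Any.index spoke∈)))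
      l≡p : l ≡ p
      l≡p = ≤-antisym
        (≤-trans (Unique-⊆⇒length≤ (losers-unique part) λ v∈ → Sum.[ (λ { refl → contradiction v∈ (root∉losers part) }) , id ] (losers-U part v∈))
          (≤-reflexive (length-map inject₁ ws)))
        (≤-trans (≤-reflexive (sym (length-map inject₁ ws))) (Unique-⊆⇒length≤ (Unique.map⁺ inject₁-injective ws-unique) in-losers))
      count≡ : count L base ≡ length base
      count≡ = cong length (filter-all (within? L) (All.map⁺ (All.tabulate λ uv∈ →
        in-losers (∈-map⁺ inject₁ (proj₁ (covers uv∈))) , in-losers (∈-map⁺ inject₁ (proj₂ (covers uv∈))))))

  -- Vertices outside L are put at the end.
  fromList : ∀ L → (∀ {v} → v ∈ map inject₁ ws → v ∈ L) → ∃ λ π → mlvcCost G π ≤ latencies L base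
  fromList L ws⊆L = π , bound (edges G) covers
    where
    key : Fin N → ℕ
    key v with inject₁ v ∈? L
    ... | yes _ = pos L (inject₁ v)
    ... | no _  = suc (length L)
    π : Permutation′ N
    π = Sorting.sorting key
    key-in : ∀ {v} → inject₁ v ∈ L → key v ≡ pos L (inject₁ v)
    key-in {v} v∈ with inject₁ v ∈? L
    ... | yes _ = refl
    ... | no v∉ = contradiction v∈ v∉
    key-≤ : ∀ {v} → key v ≤ length L → inject₁ v ∈ L
    key-≤ {v} le with inject₁ v ∈? L
    ... | yes v∈ = v∈
    ... | no _   = contradiction le 1+n≰n
    -- The vertices that `π` places up to `v` have distinct keys between 1 and the position of `v`
    -- in `L`, so there are no more of them than that.
    position≤ : ∀ {v} → inject₁ v ∈ L → suc (toℕ (π ⟨$⟩ʳ v)) ≤ pos L (inject₁ v)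
    position≤ {v} v∈ = ≤-trans (pigeonhole-∈ (key ∘ at) (map suc (upTo (pos L (inject₁ v)))) injective inRange)
        (≤-reflexive (trans (length-map suc (upTo (pos L (inject₁ v)))) (length-upTo _)))
      where
      t≤N : suc (toℕ (π ⟨$⟩ʳ v)) ≤ N
      t≤N = toℕ<n (π ⟨$⟩ʳ v)
      at : Fin (suc (toℕ (π ⟨$⟩ʳ v))) → Fin N
      at i = π ⟨$⟩ˡ inject≤ i t≤N
      π-at : ∀ i → toℕ (π ⟨$⟩ʳ at i) ≡ toℕ i
      π-at i = trans (cong toℕ (inverseʳ π)) (toℕ-inject≤ i t≤N)
      at≤ : ∀ i → key (at i) ≤ pos L (inject₁ v)
      at≤ i = subst (key (at i) ≤_) (key-in v∈) (≮⇒≥ λ lt → <⇒≱ (Sorting.sorting-mono key lt)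
        (≤-trans (≤-reflexive (π-at i)) (s≤s⁻¹ (toℕ<n i))))
      at∈ : ∀ i → inject₁ (at i) ∈ L
      at∈ i = key-≤ (≤-trans (at≤ i) (pos≤ L (inject₁ v)))
      injective : ∀ {i j} → key (at i) ≡ key (at j) → i ≡ j
      injective {i} {j} eq = toℕ-injective (trans (sym (π-at i)) (trans (cong (λ u → toℕ (π ⟨$⟩ʳ u))
        (inject₁-injective (pos-injective (at∈ i) (at∈ j) (trans (sym (key-in (at∈ i))) (trans eq (key-in (at∈ j))))))) (π-at j)))
      inRange : ∀ i → key (at i) ∈ map suc (upTo (pos L (inject₁ v)))
      inRange i with key (at i) | at≤ i | subst (0 <_) (sym (key-in (at∈ i))) (pos>0 (at∈ i))
      ... | suc _ | le | _ = ∈-map⁺ suc (∈-upTo⁺ le)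
    bound : ∀ es → (∀ {u v} → (u , v) ∈ es → u ∈ ws × v ∈ ws) →
      sum (map (λ uv → suc (toℕ (π ⟨$⟩ʳ proj₁ uv)) ⊔ suc (toℕ (π ⟨$⟩ʳ proj₂ uv))) es) ≤ latencies L (map lift es)
    bound []             cov = z≤n
    bound ((u , v) ∷ es) cov = +-mono-≤
      (≤-trans (⊔-mono-≤ (position≤ u∈) (position≤ v∈)) (≤-reflexive (sym (latency-in {L} (u∈ , v∈)))))
      (bound es (cov ∘ there))
      where
      u∈ : inject₁ u ∈ L
      u∈ = ws⊆L (∈-map⁺ inject₁ (proj₁ (cov (here refl))))
      v∈ : inject₁ v ∈ L
      v∈ = ws⊆L (∈-map⁺ inject₁ (proj₂ (cov (here refl))))

  mlop⇒mlvc : ∀ {k} → MLOP-yes (H , tri (length ws) + k) → MLVC-yes (G , k)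
  mlop⇒mlvc {k} (σ , ρ , ranks , le) with FromOrder.ordering σ ρ ranks
  ... | L , ws⊆L , cost with fromList L ws⊆L
  ... | π , π-cost = π , ≤-trans π-cost (+-cancelˡ-≤ (tri (length ws)) _ _ (≤-trans cost le))

  -- From an ordering of the vertices to a linear ordering of the edges of the cone

  module FromVertices (π : Permutation′ N) where

    place : Fin N → ℕ
    place w = suc (toℕ (π ⟨$⟩ʳ w))

    place-injective : ∀ {v w} → place v ≡ place w → v ≡ w
    place-injective {v} {w} eq = trans (sym (inverseˡ π)) (trans (cong (π ⟨$⟩ˡ_) (toℕ-injective (suc-injective eq))) (inverseˡ π))

    -- With the apex below every vertex, a spoke gets the level of its other end, and any edge gets
    -- the level of its later end.
    height : V → ℕ
    height = onTop 0 place

    height-apex : height apex ≡ 0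
    height-apex = onTop-fromℕ 0 place

    height-inject₁ : ∀ w → height (inject₁ w) ≡ place w
    height-inject₁ = onTop-inject₁ 0 place

    level : V × V → ℕ
    level (x , y) = height x ⊔ height y

    level-star : ∀ w → level (star w) ≡ place w
    level-star w = trans (cong₂ _⊔_ (height-inject₁ w) height-apex) (⊔-identityʳ (place w))

    offset : V → ℕ
    offset y with y ≟ᶠ apex
    ... | yes _ = 0
    ... | no _  = 1

    offset≤1 : ∀ y → offset y ≤ 1
    offset≤1 y with y ≟ᶠ apex
    ... | yes _ = z≤n
    ... | no _  = ≤-refl

    offset-apex : offset apex ≡ 0
    offset-apex with apex ≟ᶠ apex
    ... | yes _  = refl
    ... | no neq = contradiction refl neq

    offset-base : ∀ v → offset (inject₁ v) ≡ 1
    offset-base v with inject₁ v ≟ᶠ apex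
    ... | yes eq = contradiction (sym eq) fromℕ≢inject₁
    ... | no _   = refl

    -- Within each level, the spoke comes first.
    key : V × V → ℕ
    key e = level e * 2 + offset (proj₂ e)

    σ : Permutation′ (m H)
    σ = Sorting.sorting (key ∘ edge H)

    σ-sorts : ∀ {e f} → toℕ (σ ⟨$⟩ʳ e) ≤ toℕ (σ ⟨$⟩ʳ f) → key (edge H e) ≤ key (edge H f)
    σ-sorts le = ≮⇒≥ λ lt → <⇒≱ (Sorting.sorting-mono (key ∘ edge H) lt) le

    low : ℕ → List (Fin N) → List (Fin N)
    low ℓ = filter (λ w → place w ≤? ℓ)

    -- Only an upper bound, because vertices outside `ws` occupy places as well. This is why a base
    -- edge has a rank at most its latency and not equal to it.
    low-length : ∀ ℓ → length (low ℓ ws) ≤ ℓ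
    low-length ℓ = ≤-trans (≤-reflexive (sym (length-map place (low ℓ ws))))
      (≤-trans (Unique-⊆⇒length≤ {zs = map suc (upTo ℓ)} (Unique.map⁺ place-injective (Unique.filter⁺ (λ w → place w ≤? ℓ) ws-unique)) inRange)
        (≤-reflexive (trans (length-map suc (upTo ℓ)) (length-upTo ℓ))))
      where
      inRange : ∀ {i} → i ∈ map place (low ℓ ws) → i ∈ map suc (upTo ℓ)
      inRange i∈ with ∈-map⁻ place i∈
      ... | w , w∈ , refl = ∈-map⁺ suc (∈-upTo⁺ (proj₂ (∈-filter⁻ (λ w → place w ≤? ℓ) {xs = ws} w∈)))

    at : Fin (m H) → V × V
    at j = edge H (σ ⟨$⟩ˡ j)

    rank : Fin (m H) → ℕ
    rank j = length (low (level (at j)) ws)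

    total-rank : sumFin (m H) rank ≡ sum (map (λ e → length (low (level e) ws)) coneEdges)
    total-rank = trans (sym (sumFin-permute (λ e → length (low (level (edge H e)) ws)) (flip σ))) (sumFin-lookup (λ e → length (low (level e) ws)) coneEdges)

    base-ranks : ∀ es → sum (map (λ e → length (low (level e) ws)) (map lift es)) ≤ sum (map (λ uv → place (proj₁ uv) ⊔ place (proj₂ uv)) es)
    base-ranks []             = z≤n
    base-ranks ((u , v) ∷ es) = +-mono-≤
      (≤-trans (low-length _) (≤-reflexive (cong₂ _⊔_ (height-inject₁ u) (height-inject₁ v)))) (base-ranks es)

    rank-∷-yes : ∀ {w ℓ vs} → place w ≤ ℓ → length (low ℓ (w ∷ vs)) ≡ suc (length (low ℓ vs))
    rank-∷-yes {ℓ = ℓ} le = cong length (filter-accept (λ w → place w ≤? ℓ) le)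

    rank-∷-no : ∀ {w ℓ vs} → ¬ place w ≤ ℓ → length (low ℓ (w ∷ vs)) ≡ length (low ℓ vs)
    rank-∷-no {ℓ = ℓ} nle = cong length (filter-reject (λ w → place w ≤? ℓ) nle)

    -- Each x other than w is either below or above w.
    split-ranks : ∀ w us vs → w ∉ vs →
      length (low (place w) vs) + sum (map (λ x → length (low (place x) (w ∷ us))) vs)
        ≡ length vs + sum (map (λ x → length (low (place x) us)) vs)
    split-ranks w us []       w∉ = refl
    split-ranks w us (x ∷ vs) w∉ with <-cmp (place x) (place w)
    ... | tri≈ _ eq _ = contradiction (here (place-injective (sym eq))) w∉
    ... | tri< lt _ _ rewrite rank-∷-yes {vs = vs} (<⇒≤ lt) | rank-∷-no {vs = us} (<⇒≱ lt) =
      cong suc (insert-middle (length (low (place w) vs)) (length (low (place x) us)) (length vs) (split-ranks w us vs (w∉ ∘ there)))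
    ... | tri> _ _ gt rewrite rank-∷-no {vs = vs} (<⇒≱ gt) | rank-∷-yes {vs = us} (<⇒≤ gt) =
      trans (+-suc (length (low (place w) vs)) _)
        (cong suc (insert-middle (length (low (place w) vs)) (length (low (place x) us)) (length vs) (split-ranks w us vs (w∉ ∘ there))))

    -- Sorted by place, the terms would be 1, 2, and so on. The list is in no such order, so the
    -- induction removes its head `w`: each other vertex contributes exactly one, either by being
    -- counted in the rank of `w` or by having `w` counted in its own.
    sum-ranks : ∀ {vs} → Unique vs → sum (map (λ w → length (low (place w) vs)) vs) ≡ tri (length vs)
    sum-ranks {[]}     _         = refl
    sum-ranks {w ∷ vs} un@(_ ∷ un′) rewrite rank-∷-yes {vs = vs} (≤-refl {place w}) =
      cong suc (trans (split-ranks w vs vs (Unique-head un)) (cong (length vs +_) (sum-ranks un′)))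

    spoke-ranks : sum (map (λ e → length (low (level e) ws)) spokes) ≡ tri (length ws)
    spoke-ranks = trans (cong sum (trans (sym (map-∘ ws)) (map-cong (λ w → cong (λ ℓ → length (low ℓ ws)) (level-star w)) ws))) (sum-ranks ws-unique)

    cost : sumFin (m H) rank ≤ mlvcCost G π + tri (length ws)
    cost = begin
      sumFin (m H) rank                   ≡⟨ total-rank ⟩
      sum (map r (base ++ spokes))        ≡⟨ cong sum (map-++ r base spokes) ⟩
      sum (map r base ++ map r spokes)    ≡⟨ sum-++ (map r base) (map r spokes) ⟩
      sum (map r base) + sum (map r spokes) ≤⟨ +-mono-≤ (base-ranks (edges G)) (≤-reflexive spoke-ranks) ⟩
      mlvcCost G π + tri (length ws)      ∎
      where
      open ≤-Reasoning
      r : V × V → ℕ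
      r e = length (low (level e) ws)

    -- Ranks of the prefixes of the edge ordering

    Near : ℕ → V × V → Set
    Near ℓ (x , y) = y ≡ apex × height x ≤ ℓ

    near? : ∀ ℓ e → Dec (Near ℓ e)
    near? ℓ (x , y) = (y ≟ᶠ apex) ×-dec (height x ≤? ℓ)

    -- The key of a spoke `f` is even and at most twice the level of `g`. If `g` is a base edge, its
    -- key is odd and exceeds this; if `g` is a spoke, the two levels coincide, and distinct
    -- vertices have distinct places.
    spoke-first : ∀ {f g} → ConeEdge f → ConeEdge g → Near (level g) f → key g ≤ key f → f ≡ g
    spoke-first (is-base _) _ (y≡ , _) _ = contradiction (sym y≡) fromℕ≢inject₁
    spoke-first {g = g} (is-spoke {w} _) (is-base {v = v} _) (_ , le) k≤ = contradiction (begin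
        suc (level g * 2)             ≡⟨ +-comm 1 _ ⟩
        level g * 2 + 1               ≡⟨ cong (level g * 2 +_) (offset-base v) ⟨
        key g                         ≤⟨ k≤ ⟩
        key (star w)                  ≡⟨ cong₂ (λ a b → a * 2 + b) (trans (level-star w) (sym (height-inject₁ w))) offset-apex ⟩
        height (inject₁ w) * 2 + 0    ≡⟨ +-identityʳ _ ⟩
        height (inject₁ w) * 2        ≤⟨ *-monoˡ-≤ 2 le ⟩
        level g * 2                   ∎) 1+n≰n
      where open ≤-Reasoning
    spoke-first (is-spoke {w} _) (is-spoke {w₀} _) (_ , le) k≤ = cong star (place-injective (≤-antisym
      (subst₂ _≤_ (height-inject₁ w) (level-star w₀) le)
      (subst₂ _≤_ (level-star w₀) (level-star w) (*-cancelʳ-≤ (level (star w₀)) (level (star w)) 2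
        (+-cancelʳ-≤ (offset apex) (level (star w₀) * 2) (level (star w) * 2) k≤)))))

    key≤⇒level≤ : ∀ {f g} → key f ≤ key g → level f ≤ level g
    key≤⇒level≤ {f} {g} le = ≮⇒≥ λ lt → <⇒≱ (begin-strict
      key g               ≤⟨ +-monoʳ-≤ (level g * 2) (offset≤1 (proj₂ g)) ⟩
      level g * 2 + 1     <⟨ +-monoʳ-< (level g * 2) (s≤s (s≤s z≤n)) ⟩
      level g * 2 + 2     ≡⟨ +-comm (level g * 2) 2 ⟩
      suc (level g) * 2   ≤⟨ *-monoˡ-≤ 2 lt ⟩
      level f * 2         ≤⟨ m≤m+n _ _ ⟩
      key f               ∎) le
      where open ≤-Reasoning

    module _ (j : Fin (m H)) where

      ℓ₀ : ℕ
      ℓ₀ = level (at j)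

      time-at : toℕ (σ ⟨$⟩ʳ (σ ⟨$⟩ˡ j)) ≡ toℕ j
      time-at = cong toℕ (inverseʳ σ)

      inner : EdgeSet
      inner = Vec.tabulate (does ∘ near? ℓ₀ ∘ edge H)

      inner-∈ : ∀ {e} → e ∈ˢ inner → Near ℓ₀ (edge H e)
      inner-∈ {e} e∈ = does-true (near? ℓ₀ (edge H e)) (trans (sym (lookup∘tabulate (does ∘ near? ℓ₀ ∘ edge H) e)) ([]=⇒lookup e∈))

      -- An edge after position `j` has at least the key of the edge there; for a spoke of level at
      -- most `ℓ₀`, `spoke-first` makes it that very edge, which does not come after itself.
      inner⊆prefix : inner ⊆ prefix H σ j
      inner⊆prefix {e} e∈ = in-prefix σ (≮⇒≥ λ lt → <-irrefl refl (subst (toℕ j <_)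
        (trans (cong (λ f → toℕ (σ ⟨$⟩ʳ f)) (edge-injective (spoke-first (coneEdge′ e) (coneEdge′ (σ ⟨$⟩ˡ j)) (inner-∈ e∈)
          (σ-sorts (≤-trans (≤-reflexive time-at) (<⇒≤ lt)))))) time-at) lt))

      inner-Adj : ∀ {u v} → Adj H inner u v → u ≡ apex ⊎ v ≡ apex
      inner-Adj (e , e∈ , inj₁ eq) = inj₂ (trans (sym (cong proj₂ eq)) (proj₁ (inner-∈ e∈)))
      inner-Adj (e , e∈ , inj₂ eq) = inj₁ (trans (sym (cong proj₂ eq)) (proj₁ (inner-∈ e∈)))

      -- Every edge of `inner` contains the apex, but of three consecutive edges of a cycle one
      -- misses it.
      inner-acyclic : Acyclic H inner
      inner-acyclic (a , b , c , l , ((a≢b ∷ a≢c ∷ _) ∷ ((b≢c ∷ b≢l) ∷ _)) , ab , bc , w) with inner-Adj ab | inner-Adj bc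
      ... | inj₁ a≡ | inj₂ c≡ = a≢c (trans a≡ (sym c≡))
      ... | inj₁ a≡ | inj₁ b≡ = a≢b (trans a≡ (sym b≡))
      ... | inj₂ b≡ | inj₂ c≡ = b≢c (trans b≡ (sym c≡))
      ... | inj₂ b≡ | inj₁ _  = third l b≢l w
        where
        third : ∀ l → All (b ≢_) l → ¬ WalkIn H inner (c ∷ l ++ a ∷ [])
        third []      _          (ca , _) = Sum.[ (λ c≡ → b≢c (trans b≡ (sym c≡))) , (λ a≡ → a≢b (trans a≡ (sym b≡))) ] (inner-Adj ca)
        third (d ∷ l) (b≢d ∷ _) (cd , _) = Sum.[ (λ c≡ → b≢c (trans b≡ (sym c≡))) , (λ d≡ → b≢d (trans b≡ (sym d≡))) ] (inner-Adj cd)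

      near-spokes : ∀ vs → length (filter (near? ℓ₀) (map star vs)) ≡ length (low ℓ₀ vs)
      near-spokes []       = refl
      near-spokes (w ∷ vs) with place w ≤? ℓ₀
      ... | yes le = trans (cong length (filter-accept (near? ℓ₀) {star w} {map star vs} (refl , subst (_≤ ℓ₀) (sym (height-inject₁ w)) le)))
                       (trans (cong suc (near-spokes vs)) (sym (rank-∷-yes {vs = vs} le)))
      ... | no nle = trans (cong length (filter-reject (near? ℓ₀) {star w} {map star vs} (λ (_ , le) → nle (subst (_≤ ℓ₀) (height-inject₁ w) le))))
                       (trans (near-spokes vs) (sym (rank-∷-no {vs = vs} nle)))

      inner-size : ∣ inner ∣ ≡ rank j
      inner-size = trans (∣tabulate∣ (near? ℓ₀) coneEdges) (trans (cong length (trans (filter-++ (near? ℓ₀) base spokes)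
        (cong (_++ filter (near? ℓ₀) spokes) (filter-none (near? ℓ₀) {base} (All.map⁺ (All.tabulate (λ {(_ , v)} _ (y≡ , _) → fromℕ≢inject₁ {i = v} (sym y≡)))))))) (near-spokes ws))

      Low : V → Set
      Low v = v ≡ apex ⊎ v ∈ map inject₁ (low ℓ₀ ws)

      low-vertex : ∀ {w} → w ∈ ws → height (inject₁ w) ≤ ℓ₀ → Low (inject₁ w)
      low-vertex {w} w∈ le = inj₂ (∈-map⁺ inject₁ (∈-filter⁺ (λ w → place w ≤? ℓ₀) w∈ (subst (_≤ ℓ₀) (height-inject₁ w) le)))

      low-edge : ∀ {f} → ConeEdge f → level f ≤ ℓ₀ → Low (proj₁ f) × Low (proj₂ f)
      low-edge (is-base uv∈)  le = low-vertex (proj₁ (covers uv∈)) (≤-trans (m≤m⊔n _ _) le) , low-vertex (proj₂ (covers uv∈)) (≤-trans (m≤n⊔m _ _) le)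
      low-edge (is-spoke w∈) le = low-vertex w∈ (≤-trans (m≤m⊔n _ _) le) , inj₁ refl

      -- All edges of the prefix have level at most `ℓ₀`, so their ends are the apex or vertices
      -- counted by `rank j`. A forest among them has as many edges as losers, and the losers are
      -- distinct and never the apex.
      rank-maximal : ∀ B → B ⊆ prefix H σ j → Acyclic H B → ∣ B ∣ ≤ rank j
      rank-maximal B B⊆ ac = bound (forest-partition {apex} {Low} ∣ B ∣ B refl ac (λ {e} e∈ → low-edge (coneEdge′ e)
          (key≤⇒level≤ (σ-sorts (≤-trans (prefix-in σ (B⊆ e∈)) (≤-reflexive (sym time-at)))))))
        where
        bound : (Σ (Partition apex Low) λ P → length (losers P) ≡ ∣ B ∣ × (∀ {u v} → lab P u ≡ lab P v → Path B u v)) → ∣ B ∣ ≤ rank j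
        bound (P , len , _) = ≤-trans (≤-reflexive (sym len))
          (≤-trans (Unique-⊆⇒length≤ {zs = map inject₁ (low ℓ₀ ws)} (losers-unique P) λ v∈ → Sum.[ (λ { refl → contradiction v∈ (root∉losers P) }) , id ] (losers-U P v∈))
            (≤-reflexive (length-map inject₁ (low ℓ₀ ws))))

      isRank : IsRank H (prefix H σ j) (rank j)
      isRank = (inner , inner⊆prefix , inner-acyclic , inner-size) , rank-maximal

  mlvc⇒mlop : ∀ {k} → MLVC-yes (G , k) → MLOP-yes (H , tri (length ws) + k)
  mlvc⇒mlop {k} (π , le) = σ , rank , isRank , ≤-trans cost (≤-trans (≤-reflexive (+-comm (mlvcCost G π) _)) (+-monoʳ-≤ (tri (length ws)) le))
    where open FromVertices π

-- Finite types

-- A retract of `Fin size` is enough: codes need not be onto, since a run only meets states and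
-- symbols that are codes.
record Finite (A : Set) : Set where
  field
    size        : ℕ
    code        : A → Fin size
    decode      : Fin size → A
    decode-code : ∀ a → decode (code a) ≡ a
open Finite

Fin-finite : ∀ n → Finite (Fin n)
Fin-finite n = record { size = n ; code = id ; decode = id ; decode-code = λ _ → refl }

⊤-finite : Finite ⊤
⊤-finite = record { size = 1 ; code = λ _ → fzero ; decode = λ _ → tt ; decode-code = λ _ → refl }

_⊎-finite_ : ∀ {A B} → Finite A → Finite B → Finite (A ⊎ B)
FA ⊎-finite FB = record
  { size   = size FA + size FB
  ; code   = join (size FA) (size FB) ∘ Sum.map (code FA) (code FB)
  ; decode = Sum.map (decode FA) (decode FB) ∘ splitAt (size FA)
  ; decode-code = λ where
      (inj₁ a) → trans (cong (Sum.map (decode FA) (decode FB)) (splitAt-join (size FA) (size FB) (inj₁ (code FA a)))) (cong inj₁ (decode-code FA a))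
      (inj₂ b) → trans (cong (Sum.map (decode FA) (decode FB)) (splitAt-join (size FA) (size FB) (inj₂ (code FB b)))) (cong inj₂ (decode-code FB b))
  }

_×-finite_ : ∀ {A B} → Finite A → Finite B → Finite (A × B)
FA ×-finite FB = record
  { size   = size FA * size FB
  ; code   = λ (a , b) → combine (code FA a) (code FB b)
  ; decode = λ i → let (j , k) = remQuot (size FB) i in decode FA j , decode FB k
  ; decode-code = λ (a , b) → trans
      (cong (λ (j , k) → decode FA j , decode FB k) (remQuot-combine (code FA a) (code FB b)))
      (cong₂ _,_ (decode-code FA a) (decode-code FB b))
  }

retract-finite : ∀ {A B : Set} (f : A → B) (g : B → A) → (∀ a → g (f a) ≡ a) → Finite B → Finite A
retract-finite f g gf FB = record
  { size   = size FB
  ; code   = code FB ∘ f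
  ; decode = g ∘ decode FB
  ; decode-code = λ a → trans (cong g (decode-code FB (f a))) (gf a)
  }

Maybe-finite : ∀ {A} → Finite A → Finite (Maybe A)
Maybe-finite FA = retract-finite
  (λ { nothing → inj₁ tt ; (just a) → inj₂ a })
  (λ { (inj₁ _) → nothing ; (inj₂ a) → just a })
  (λ { nothing → refl ; (just _) → refl })
  (⊤-finite ⊎-finite FA)

Vec-finite : ∀ {A} → Finite A → ∀ k → Finite (Vec A k)
Vec-finite FA zero    = retract-finite (λ _ → tt) (λ _ → []) (λ { [] → refl }) ⊤-finite
Vec-finite FA (suc k) = retract-finite
  (λ { (a ∷ as) → a , as }) (λ (a , as) → a ∷ as) (λ { (_ ∷ _) → refl })
  (FA ×-finite Vec-finite FA k)

Σ-finite : ∀ n {F : Fin n → Set} → (∀ i → Finite (F i)) → Finite (Σ (Fin n) F)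
Σ-finite zero    FF = record { size = 0 ; code = λ () ; decode = λ () ; decode-code = λ () }
Σ-finite (suc n) {F} FF = retract-finite to from (λ { (fzero , _) → refl ; (fsuc _ , _) → refl })
  (FF fzero ⊎-finite Σ-finite n (λ i → FF (fsuc i)))
  where
  to : Σ (Fin (suc n)) F → F fzero ⊎ Σ (Fin n) (λ i → F (fsuc i))
  to (fzero  , x) = inj₁ x
  to (fsuc i , x) = inj₂ (i , x)
  from : F fzero ⊎ Σ (Fin n) (λ i → F (fsuc i)) → Σ (Fin (suc n)) F
  from (inj₁ x)       = fzero , x
  from (inj₂ (i , x)) = fsuc i , x

-- Stack machines

-- The result of popping a stack: zero when it was empty, suc a when a was on top.
Top : Set
Top = Fin 4

Stacks : ℕ → Set
Stacks k = Vec (List (Fin 3)) k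

top : List (Fin 3) → Top
top []      = fzero
top (a ∷ _) = fsuc a

pop : List (Fin 3) → List (Fin 3)
pop []       = []
pop (_ ∷ as) = as

data Instr (k : ℕ) (X : Set) : Set where
  nop   : X → Instr k X
  pushI : Fin k → Fin 3 → X → Instr k X
  popI  : Fin k → (Top → X) → Instr k X

mapI : ∀ {k X Y} → (X → Y) → Instr k X → Instr k Y
mapI f (nop x)       = nop (f x)
mapI f (pushI i a x) = pushI i a (f x)
mapI f (popI i h)    = popI i (f ∘ h)

exec : ∀ {k X} → Instr k X → Stacks k → X × Stacks k
exec (nop x)       s = x , s
exec (pushI i a x) s = x , (s [ i ]%= (a ∷_))
exec (popI i h)    s = h (top (Vec.lookup s i)) , (s [ i ]%= pop)

data Run {k : ℕ} {P : Set} (prog : P → Instr k (Maybe P)) : ℕ → Maybe P → Stacks k → Stacks k → Set where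
  stop : ∀ {s} → Run prog 0 nothing s s
  next : ∀ {t p s s′} → Run prog t (proj₁ (exec (prog p) s)) (proj₂ (exec (prog p) s)) s′ →
         Run prog (suc t) (just p) s s′

-- Time of a sweep over `h` cells and back, with one turn at either end.
roundTrip : ℕ → ℕ
roundTrip h = h + suc (h + 1)

roundTrip-mono : ∀ {h h′} → h ≤ h′ → roundTrip h ≤ roundTrip h′
roundTrip-mono le = +-mono-≤ le (s≤s (+-monoˡ-≤ 1 le))

loaded : ∀ {k} → Fin k → List (Fin 3) → Stacks k
loaded {k} i w = Vec.replicate k [] [ i ]≔ w

-- Simulation of a stack machine by a Turing machine

module Simulation {k : ℕ} {P : Set} (FP : Finite P) (prog : P → Instr k (Maybe P)) (p₀ : P) (inp out : Fin k) where

  -- Stack i is the i-th track of the cells, its top at the leftmost cell, followed by fzero's.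
  Cell : Set
  Cell = Vec Top k

  data Γ : Set where
    blank : Γ
    raw   : Fin 3 → Γ
    cell  : Cell → Γ

  data Ctl : Set where
    readR finR finL halt : Ctl
    at backL   : Maybe P → Ctl
    popR       : Fin k → Maybe P → Ctl
    pushR popL : Fin k → Top → Maybe P → Ctl

  none : Cell
  none = Vec.replicate k fzero

  -- Cells below the bottom of the output stack keep a symbol outside the input alphabet, and
  -- `readOut` stops at the first of these.
  conv : Cell → Γ
  conv v with Vec.lookup v out
  ... | fzero  = cell v
  ... | fsuc a = raw a

  perform : Instr k (Maybe P) → Cell → Ctl
  perform (nop p)       v = at p
  perform (pushI i a p) v = pushR i (fsuc a) p
  perform (popI i h)    v with Vec.lookup v i
  ... | fzero  = at (h fzero)
  ... | fsuc a = popR i (h (fsuc a))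

  -- A push shifts its track to the right on the outward sweep, with the displaced entry held in the
  -- state. A pop shifts to the left and can only do so on the way back, so `popR` merely runs to
  -- the right end. Sweeps are turned by the blanks that enclose the cells.
  transition : Ctl → Γ → Maybe (Ctl × Γ × Move)
  transition readR (raw a)  = just (readR , cell (none [ inp ]≔ fsuc a) , mvR)
  transition readR blank    = just (backL (just p₀) , blank , mvL)
  transition readR (cell _) = nothing
  transition finR blank     = just (finL , blank , mvL)
  transition finR (cell v)  = just (finR , conv v , mvR)
  transition finR (raw _)   = nothing
  transition finL blank     = just (halt , blank , mvR)
  transition finL g         = just (finL , g , mvL)
  transition halt _         = nothing
  transition (at (just p)) (cell v) = just (perform (prog p) v , cell v , mvS)
  transition (at nothing)  (cell v) = just (finR , cell v , mvS)
  transition (at _) _               = nothing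
  transition (backL p) blank        = just (at p , blank , mvR)
  transition (backL p) g            = just (backL p , g , mvL)
  transition (popR i p) (cell v)    = just (popR i p , cell v , mvR)
  transition (popR i p) blank       = just (popL i fzero p , blank , mvL)
  transition (popR i p) (raw _)     = nothing
  transition (pushR i b p) (cell v) = just (pushR i (Vec.lookup v i) p , cell (v [ i ]≔ b) , mvR)
  transition (pushR i b p) blank    = just (backL p , cell (none [ i ]≔ b) , mvL)
  transition (pushR i b p) (raw _)  = nothing
  transition (popL i b p) (cell v)  = just (popL i (Vec.lookup v i) p , cell (v [ i ]≔ b) , mvL)
  transition (popL i b p) blank     = just (at p , blank , mvR)
  transition (popL i b p) (raw _)   = nothing

  -- Coding of states and symbols by numbers

  Cell-finite : Finite Cell
  Cell-finite = Vec-finite (Fin-finite 4) k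

  Ctl-finite : Finite Ctl
  Ctl-finite = retract-finite to from from-to
    (Fin-finite 4 ⊎-finite ((Fin-finite 2 ×-finite MP) ⊎-finite
      ((Fin-finite k ×-finite MP) ⊎-finite (Fin-finite 2 ×-finite (Fin-finite k ×-finite (Fin-finite 4 ×-finite MP))))))
    where
    MP : Finite (Maybe P)
    MP = Maybe-finite FP
    Code : Set
    Code = Fin 4 ⊎ (Fin 2 × Maybe P ⊎ (Fin k × Maybe P ⊎ Fin 2 × (Fin k × (Fin 4 × Maybe P))))
    to : Ctl → Code
    to readR = inj₁ fzero
    to finR  = inj₁ (fsuc fzero)
    to finL  = inj₁ (fsuc (fsuc fzero))
    to halt  = inj₁ (fsuc (fsuc (fsuc fzero)))
    to (at p)        = inj₂ (inj₁ (fzero , p))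
    to (backL p)     = inj₂ (inj₁ (fsuc fzero , p))
    to (popR i p)    = inj₂ (inj₂ (inj₁ (i , p)))
    to (pushR i b p) = inj₂ (inj₂ (inj₂ (fzero , i , b , p)))
    to (popL i b p)  = inj₂ (inj₂ (inj₂ (fsuc fzero , i , b , p)))
    from : Code → Ctl
    from (inj₁ fzero)                      = readR
    from (inj₁ (fsuc fzero))               = finR
    from (inj₁ (fsuc (fsuc fzero)))        = finL
    from (inj₁ (fsuc (fsuc (fsuc fzero)))) = halt
    from (inj₂ (inj₁ (fzero , p)))         = at p
    from (inj₂ (inj₁ (fsuc _ , p)))        = backL p
    from (inj₂ (inj₂ (inj₁ (i , p))))      = popR i p
    from (inj₂ (inj₂ (inj₂ (fzero , i , b , p))))  = pushR i b p
    from (inj₂ (inj₂ (inj₂ (fsuc _ , i , b , p)))) = popL i b p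
    from-to : ∀ c → from (to c) ≡ c
    from-to readR = refl
    from-to finR  = refl
    from-to finL  = refl
    from-to halt  = refl
    from-to (at p)        = refl
    from-to (backL p)     = refl
    from-to (popR i p)    = refl
    from-to (pushR i b p) = refl
    from-to (popL i b p)  = refl

  #cells : ℕ
  #cells = size Cell-finite

  ⌜_⌝ : Γ → Fin (4 + #cells)
  ⌜ blank ⌝  = fzero
  ⌜ raw a ⌝  = fsuc (a ↑ˡ #cells)
  ⌜ cell v ⌝ = fsuc (fsuc (fsuc (fsuc (code Cell-finite v))))

  ⌞_⌟ : Fin (4 + #cells) → Γ
  ⌞ fzero ⌟                       = blank
  ⌞ fsuc fzero ⌟                  = raw fzero
  ⌞ fsuc (fsuc fzero) ⌟           = raw (fsuc fzero)
  ⌞ fsuc (fsuc (fsuc fzero)) ⌟    = raw (fsuc (fsuc fzero))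
  ⌞ fsuc (fsuc (fsuc (fsuc i))) ⌟ = cell (decode Cell-finite i)

  ⌞⌜⌝⌟ : ∀ g → ⌞ ⌜ g ⌝ ⌟ ≡ g
  ⌞⌜⌝⌟ blank                   = refl
  ⌞⌜⌝⌟ (raw fzero)             = refl
  ⌞⌜⌝⌟ (raw (fsuc fzero))      = refl
  ⌞⌜⌝⌟ (raw (fsuc (fsuc fzero))) = refl
  ⌞⌜⌝⌟ (cell v)                = cong cell (decode-code Cell-finite v)

  encode-action : Ctl × Γ × Move → Fin (size Ctl-finite) × Fin (4 + #cells) × Move
  encode-action (q , g , d) = code Ctl-finite q , ⌜ g ⌝ , d

  M : TM
  M = record
    { Q     = size Ctl-finite
    ; extra = #cells
    ; start = code Ctl-finite readR
    ; δ     = λ q a → Maybe.map encode-action (transition (decode Ctl-finite q) ⌞ a ⌟)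
    }

  δ-encode : ∀ q g → TM.δ M (code Ctl-finite q) ⌜ g ⌝ ≡ Maybe.map encode-action (transition q g)
  δ-encode q g = cong (Maybe.map encode-action) (cong₂ transition (decode-code Ctl-finite q) (⌞⌜⌝⌟ g))

  open Machine M using (cfg; Config; step; runWithin; initial; readOut; output)

  -- Tapes over the uncoded alphabet, and sweeps

  record Tape : Set where
    constructor tape
    field
      control   : Ctl
      leftward  : List Γ
      scanned   : Γ
      rightward : List Γ

  -- The head is described by the boundary between two lists, so that sweeps need no separate case
  -- for running off the written part of the tape.
  goRight goLeft : Ctl → List Γ → List Γ → Tape
  goRight q l []      = tape q l blank []
  goRight q l (g ∷ r) = tape q l g r
  goLeft q []      r = tape q [] blank r
  goLeft q (g ∷ l) r = tape q l g r

  act : Tape → Ctl × Γ × Move → Tape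
  act (tape _ l _ r) (q , g , mvS) = tape q l g r
  act (tape _ l _ r) (q , g , mvL) = goLeft q l (g ∷ r)
  act (tape _ l _ r) (q , g , mvR) = goRight q (g ∷ l) r

  ⟪_⟫ : Tape → Config
  ⟪ tape q l g r ⟫ = cfg (code Ctl-finite q) (map ⌜_⌝ l) ⌜ g ⌝ (map ⌜_⌝ r)

  step-⟪⟫ : ∀ c a → step ⟪ c ⟫ (encode-action a) ≡ ⟪ act c a ⟫
  step-⟪⟫ (tape _ l _ r)       (q , g , mvS) = refl
  step-⟪⟫ (tape _ [] _ r)      (q , g , mvL) = refl
  step-⟪⟫ (tape _ (_ ∷ _) _ r) (q , g , mvL) = refl
  step-⟪⟫ (tape _ l _ [])      (q , g , mvR) = refl
  step-⟪⟫ (tape _ l _ (_ ∷ _)) (q , g , mvR) = refl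

  data Steps : ℕ → Tape → Tape → Set where
    done : ∀ {c} → Steps 0 c c
    more : ∀ {t q l g r a c′} → transition q g ≡ just a → Steps t (act (tape q l g r) a) c′ →
           Steps (suc t) (tape q l g r) c′

  _▷▷_ : ∀ {t u c c′ c″} → Steps t c c′ → Steps u c′ c″ → Steps (t + u) c c″
  done ▷▷ ys      = ys
  more e xs ▷▷ ys = more e (xs ▷▷ ys)

  _▷_ : ∀ {t c c′ c″} → Steps t c c′ → Steps 1 c′ c″ → Steps (suc t) c c″
  done ▷ y      = y
  more e xs ▷ y = more e (xs ▷ y)

  runWithin-Steps : ∀ {t c c′} → Steps t c c′ → ∀ f → runWithin (t + f) ⟪ c ⟫ ≡ runWithin f ⟪ c′ ⟫
  runWithin-Steps done f = refl
  runWithin-Steps (more {q = q} {l} {g} {r} {a} e xs) f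
    with TM.δ M (code Ctl-finite q) ⌜ g ⌝ | trans (δ-encode q g) (cong (Maybe.map encode-action) e)
  ... | just _ | refl = trans (cong (runWithin _) (step-⟪⟫ (tape q l g r) a)) (runWithin-Steps xs f)

  runWithin-halted : ∀ f l g r → runWithin f ⟪ tape halt l g r ⟫ ≡ just ⟪ tape halt l g r ⟫
  runWithin-halted zero    l g r = refl
  runWithin-halted (suc f) l g r = refl

  single : ∀ {q g a l r} → transition q g ≡ just a → Steps 1 (tape q l g r) (act (tape q l g r) a)
  single e = more e done

  Blank : List Γ → Set
  Blank = All (_≡ blank)

  -- The blank that ends a sweep may be stored in the list or be implicit beyond it. Tapes are not
  -- normalized, so all that is remembered is that what lies outside is blank.
  turnL : ∀ {q q′ g′ l r} → transition q blank ≡ just (q′ , g′ , mvL) → Blank r →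
          ∃ λ r′ → Blank r′ × Steps 1 (goRight q l r) (goLeft q′ l (g′ ∷ r′))
  turnL e []        = [] , [] , single e
  turnL e (refl ∷ bs) = _ , bs , single e

  turnR : ∀ {q q′ l r} → transition q blank ≡ just (q′ , blank , mvR) → Blank l →
          ∃ λ l′ → Blank l′ × Steps 1 (goLeft q l r) (goRight q′ l′ r)
  turnR e []          = _ , refl ∷ [] , single e
  turnR e (refl ∷ bs) = _ , refl ∷ bs , single e

  sweepR : ∀ {q} {Good : Γ → Set} (ω : Γ → Γ) → (∀ {g} → Good g → transition q g ≡ just (q , ω g , mvR)) →
           ∀ gs {gs′} → map ω gs ≡ gs′ → All Good gs → ∀ l r →
           Steps (length gs) (goRight q l (gs ++ r)) (goRight q (gs′ ʳ++ l) r)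
  sweepR ω e []       refl []         l r = done
  sweepR ω e (g ∷ gs) refl (ok ∷ oks) l r = more (e ok) (sweepR ω e gs refl oks (ω g ∷ l) r)

  sweepL : ∀ {q} {Good : Γ → Set} → (∀ {g} → Good g → transition q g ≡ just (q , g , mvL)) →
           ∀ gs → All Good gs → ∀ l r →
           Steps (length gs) (goLeft q (gs ʳ++ l) r) (goLeft q l (gs ++ r))
  sweepL e []       []         l r = done
  sweepL e (g ∷ gs) (ok ∷ oks) l r = sweepL e gs oks (g ∷ l) r ▷ single (e ok)

  cells : List Cell → List Γ
  cells = map cell

  data NonBlank : Γ → Set where
    nbRaw  : ∀ a → NonBlank (raw a)
    nbCell : ∀ v → NonBlank (cell v)

  data IsRaw : Γ → Set where
    isRaw : ∀ a → IsRaw (raw a)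

  data IsCell : Γ → Set where
    isCell : ∀ v → IsCell (cell v)

  cells-IsCell : ∀ vs → All IsCell (cells vs)
  cells-IsCell []       = []
  cells-IsCell (v ∷ vs) = isCell v ∷ cells-IsCell vs

  shifted : Fin k → Top → List Cell → List Cell
  shifted i b []       = []
  shifted i b (v ∷ vs) = (v [ i ]≔ b) ∷ shifted i (Vec.lookup v i) vs

  carried : Fin k → Top → List Cell → Top
  carried i b []       = b
  carried i b (v ∷ vs) = carried i (Vec.lookup v i) vs

  pushed : Fin k → Top → List Cell → List Cell
  pushed i b vs = shifted i b vs ++ (none [ i ]≔ carried i b vs) ∷ []

  popped : Fin k → List Cell → List Cell
  popped i []            = []
  popped i (v ∷ [])      = (v [ i ]≔ fzero) ∷ []
  popped i (v ∷ v′ ∷ vs) = (v [ i ]≔ Vec.lookup v′ i) ∷ popped i (v′ ∷ vs)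

  front : Fin k → List Cell → Top
  front i []      = fzero
  front i (v ∷ _) = Vec.lookup v i

  sweep-pushR : ∀ i b p vs l r →
    Steps (length vs) (goRight (pushR i b p) l (cells vs ++ r))
                      (goRight (pushR i (carried i b vs) p) (cells (shifted i b vs) ʳ++ l) r)
  sweep-pushR i b p []       l r = done
  sweep-pushR i b p (v ∷ vs) l r = more refl (sweep-pushR i (Vec.lookup v i) p vs _ r)

  sweep-popL : ∀ i p vs l r →
    Steps (length vs) (goLeft (popL i fzero p) (cells vs ʳ++ l) r)
                      (goLeft (popL i (front i vs) p) l (cells (popped i vs) ++ r))
  sweep-popL i p []            l r = done
  sweep-popL i p (v ∷ [])      l r = single refl
  sweep-popL i p (v ∷ v′ ∷ vs) l r = sweep-popL i p (v′ ∷ vs) (cell v ∷ l) r ▷ single refl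

  length-shifted : ∀ i b vs → length (shifted i b vs) ≡ length vs
  length-shifted i b []       = refl
  length-shifted i b (v ∷ vs) = cong suc (length-shifted i _ vs)

  length-popped : ∀ i vs → length (popped i vs) ≡ length vs
  length-popped i []            = refl
  length-popped i (v ∷ [])      = refl
  length-popped i (v ∷ v′ ∷ vs) = cong suc (length-popped i (v′ ∷ vs))

  length-pushed : ∀ i b vs → length (pushed i b vs) ≡ suc (length vs)
  length-pushed i b vs = trans (length-++ (shifted i b vs)) (trans (cong (_+ 1) (length-shifted i b vs)) (+-comm _ 1))

  row : Fin k → List Cell → List Top
  row i = map (λ v → Vec.lookup v i)

  -- All tracks have the same number of cells, so a shorter stack is padded with an arbitrary number
  -- of empty entries.
  data Track : List Top → List (Fin 3) → Set where
    bottom : ∀ {ts} → All (_≡ fzero) ts → Track ts []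
    _∷_    : ∀ a {ts as} → Track ts as → Track (fsuc a ∷ ts) (a ∷ as)

  Track-pad : ∀ {ts as} → Track ts as → Track (ts ++ fzero ∷ []) as
  Track-pad (bottom zs) = bottom (pad zs)
    where
    pad : ∀ {ts} → All (_≡ fzero) ts → All (_≡ fzero) (ts ++ fzero ∷ [])
    pad []       = refl ∷ []
    pad (z ∷ zs) = z ∷ pad zs
  Track-pad (a ∷ tr) = a ∷ Track-pad tr

  Represents : List Cell → Stacks k → Set
  Represents vs s = ∀ i → Track (row i vs) (Vec.lookup s i)

  row-shifted : ∀ i b vs → row i (shifted i b vs) ++ carried i b vs ∷ [] ≡ b ∷ row i vs
  row-shifted i b []       = refl
  row-shifted i b (v ∷ vs) = cong₂ _∷_ (lookup∘updateAt i v) (row-shifted i _ vs)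

  row-pushed : ∀ i b vs → row i (pushed i b vs) ≡ b ∷ row i vs
  row-pushed i b vs = trans (map-++ _ (shifted i b vs) _)
    (trans (cong (λ t → row i (shifted i b vs) ++ t ∷ []) (lookup∘updateAt i none)) (row-shifted i b vs))

  row-shifted′ : ∀ {i j} → j ≢ i → ∀ b vs → row j (shifted i b vs) ≡ row j vs
  row-shifted′ j≢i b []       = refl
  row-shifted′ {i} {j} j≢i b (v ∷ vs) = cong₂ _∷_ (lookup∘updateAt′ j i j≢i v) (row-shifted′ j≢i _ vs)

  row-pushed′ : ∀ {i j} → j ≢ i → ∀ b vs → row j (pushed i b vs) ≡ row j vs ++ fzero ∷ []
  row-pushed′ {i} {j} j≢i b vs = trans (map-++ _ (shifted i b vs) _)
    (cong₂ (λ ts t → ts ++ t ∷ []) (row-shifted′ j≢i b vs)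
      (trans (lookup∘updateAt′ j i j≢i none) (lookup-replicate j fzero)))

  row-popped : ∀ i v vs → row i (popped i (v ∷ vs)) ≡ row i vs ++ fzero ∷ []
  row-popped i v []        = cong (_∷ []) (lookup∘updateAt i v)
  row-popped i v (v′ ∷ vs) = cong₂ _∷_ (lookup∘updateAt i v) (row-popped i v′ vs)

  row-popped′ : ∀ {i j} → j ≢ i → ∀ vs → row j (popped i vs) ≡ row j vs
  row-popped′ j≢i []            = refl
  row-popped′ {i} {j} j≢i (v ∷ [])      = cong (_∷ []) (lookup∘updateAt′ j i j≢i v)
  row-popped′ {i} {j} j≢i (v ∷ v′ ∷ vs) = cong₂ _∷_ (lookup∘updateAt′ j i j≢i v) (row-popped′ j≢i (v′ ∷ vs))

  Track-cast : ∀ {ts ts′ as as′} → ts ≡ ts′ → as ≡ as′ → Track ts′ as′ → Track ts as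
  Track-cast refl refl tr = tr

  Represents-update : ∀ vs vs′ s i f → Represents vs s →
    Track (row i vs′) (f (Vec.lookup s i)) →
    (∀ j → j ≢ i → Track (row j vs) (Vec.lookup s j) → Track (row j vs′) (Vec.lookup s j)) →
    Represents vs′ (s [ i ]%= f)
  Represents-update vs vs′ s i f R new old j with j ≟ᶠ i
  ... | yes refl = Track-cast refl (lookup∘updateAt i s) new
  ... | no j≢i   = Track-cast refl (lookup∘updateAt′ j i j≢i s) (old j j≢i (R j))

  -- There is always at least one cell, because `at` has no transition on a blank. A pop leaves the
  -- number of cells as it is, so the tape never shrinks, and `h` only bounds its length.
  record Home (p : Maybe P) (s : Stacks k) (h : ℕ) (c : Tape) : Set where
    constructor home
    field
      {l r}      : List Γ
      {v}        : Cell
      {vs}       : List Cell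
      blankˡ     : Blank l
      blankʳ     : Blank r
      represents : Represents (v ∷ vs) s
      height     : length (v ∷ vs) ≤ h
      is-tape    : c ≡ goRight (at p) l (cells (v ∷ vs) ++ r)

  mkHome : ∀ {p s h c l r} ws → 0 < length ws → Blank l → Blank r → Represents ws s → length ws ≤ h →
           c ≡ goRight (at p) l (cells ws ++ r) → Home p s h c
  mkHome (_ ∷ _) _ bl br R hh e = home bl br R hh e

  perform-sim : ∀ I {l r s} v vs → Blank l → Blank r → Represents (v ∷ vs) s →
    ∃ λ t → ∃ λ c → t ≤ roundTrip (length (v ∷ vs)) ×
      Steps t (tape (perform I v) l (cell v) (cells vs ++ r)) c ×
      Home (proj₁ (exec I s)) (proj₂ (exec I s)) (suc (length (v ∷ vs))) c
  perform-sim (nop p) v vs bl br R = 0 , _ , z≤n , done , home bl br R (n≤1+n _) refl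
  perform-sim (pushI i a p) {l} {r} {s} v vs bl br R
    with turnL {q = pushR i (carried i (fsuc a) (v ∷ vs)) p} {l = cells (shifted i (fsuc a) (v ∷ vs)) ʳ++ l} refl br
  ... | r′ , br′ , turn
    with turnR {q = backL p} {r = cells (shifted i (fsuc a) (v ∷ vs)) ++ cells ((none [ i ]≔ carried i (fsuc a) (v ∷ vs)) ∷ []) ++ r′} refl bl
  ... | l′ , bl′ , turn′ =
    _ , _ , ≤-reflexive (cong (λ h → length (v ∷ vs) + suc (h + 1)) (trans (length-map cell (shifted i (fsuc a) (v ∷ vs))) (length-shifted i (fsuc a) (v ∷ vs)))) ,
    (sweep-pushR i (fsuc a) p (v ∷ vs) l r ▷▷ (turn ▷▷
      (sweepL (λ { (isCell _) → refl }) (cells (shifted i (fsuc a) (v ∷ vs))) (cells-IsCell _) l _ ▷▷ turn′))) ,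
    mkHome (pushed i (fsuc a) (v ∷ vs)) (s≤s z≤n) bl′ br′
      (Represents-update (v ∷ vs) (pushed i (fsuc a) (v ∷ vs)) s i (a ∷_) R (Track-cast (row-pushed i (fsuc a) (v ∷ vs)) refl (a ∷ R i))
        (λ j j≢i tr → Track-cast (row-pushed′ j≢i (fsuc a) (v ∷ vs)) refl (Track-pad tr)))
      (≤-reflexive (length-pushed i (fsuc a) (v ∷ vs)))
      (cong (goRight (at p) l′) (trans (sym (++-assoc (cells (shifted i (fsuc a) (v ∷ vs))) _ r′))
        (cong (_++ r′) (sym (map-++ cell (shifted i (fsuc a) (v ∷ vs)) _)))))
  perform-sim (popI i h) {l} {r} {s} v vs bl br R with Vec.lookup v i | Vec.lookup s i in eq | R i
  ... | fzero  | []     | bottom zs = 0 , _ , z≤n , done ,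
    home bl br (Represents-update (v ∷ vs) (v ∷ vs) s i pop R (Track-cast refl (trans (cong pop eq) (sym eq)) (R i)) (λ _ _ tr → tr)) (n≤1+n _) refl
  ... | fsuc _ | []     | bottom (() ∷ _)
  ... | fsuc a | _ ∷ as | _ ∷ tr
    with turnL {q = popR i (h (fsuc a))} {l = cells (v ∷ vs) ʳ++ l} refl br
  ... | r′ , br′ , turn
    with turnR {q = popL i (front i (v ∷ vs)) (h (fsuc a))} {r = cells (popped i (v ∷ vs)) ++ blank ∷ r′} refl bl
  ... | l′ , bl′ , turn′ =
    _ , _ , ≤-reflexive (cong (λ x → suc (x + suc (suc (length vs + 1)))) (length-map cell vs)) ,
    (sweepR id (λ { (isCell _) → refl }) (cells (v ∷ vs)) (map-id (cells (v ∷ vs))) (cells-IsCell (v ∷ vs)) l r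
      ▷▷ (turn ▷▷ (sweep-popL i (h (fsuc a)) (v ∷ vs) l _ ▷▷ turn′))) ,
    mkHome (popped i (v ∷ vs)) (subst (0 <_) (sym (length-popped i (v ∷ vs))) (s≤s z≤n)) bl′ (refl ∷ br′)
      (Represents-update (v ∷ vs) _ s i pop R (Track-cast (row-popped i v vs) (cong pop eq) (Track-pad tr))
        (λ j j≢i tr′ → Track-cast (row-popped′ j≢i (v ∷ vs)) refl tr′))
      (≤-trans (≤-reflexive (length-popped i (v ∷ vs))) (n≤1+n _))
      refl

  -- Each instruction takes one step to be selected and one round trip, and may lengthen the tape by
  -- one cell.
  runBound : ℕ → ℕ → ℕ
  runBound zero    h = 0
  runBound (suc t) h = suc (roundTrip h) + runBound t (suc h)

  run-sim : ∀ {t p s s′ h c} → Run prog t p s s′ → Home p s h c →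
    ∃ λ u → ∃ λ c′ → u ≤ runBound t h × Steps u c c′ × Home nothing s′ (t + h) c′
  run-sim stop hm = 0 , _ , z≤n , done , hm
  run-sim {suc t} {just p} {s′ = s′} {h = h} (next run) (home {v = v} {vs} bl br R hh refl)
    with perform-sim (prog p) v vs bl br R
  ... | u , c₁ , u≤ , steps , home bl₁ br₁ R₁ hh₁ e₁
    with run-sim run (home bl₁ br₁ R₁ (≤-trans hh₁ (s≤s hh)) e₁)
  ... | u′ , c₂ , u′≤ , steps′ , hm₂ =
    suc (u + u′) , c₂ , s≤s (+-mono-≤ (≤-trans u≤ (roundTrip-mono hh)) u′≤) , more refl (steps ▷▷ steps′) ,
    subst (λ x → Home nothing s′ x c₂) (+-suc t h) hm₂

  readOut-conv : ∀ {as} ws r → Track (row out ws) as → readOut (map ⌜_⌝ (map conv ws ++ blank ∷ r)) ≡ as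
  readOut-conv [] r (bottom []) = refl
  readOut-conv (v ∷ ws) r tr with Vec.lookup v out
  readOut-conv (v ∷ ws) r (bottom (refl ∷ _)) | .fzero = refl
  readOut-conv (v ∷ ws) r (a ∷ tr) | fsuc fzero = cong (_ ∷_) (readOut-conv ws r tr)
  readOut-conv (v ∷ ws) r (a ∷ tr) | fsuc (fsuc fzero) = cong (_ ∷_) (readOut-conv ws r tr)
  readOut-conv (v ∷ ws) r (a ∷ tr) | fsuc (fsuc (fsuc fzero)) = cong (_ ∷_) (readOut-conv ws r tr)

  convΓ : Γ → Γ
  convΓ (cell v) = conv v
  convΓ g        = g

  conv-NonBlank : ∀ ws → All NonBlank (map conv ws)
  conv-NonBlank [] = []
  conv-NonBlank (v ∷ ws) with Vec.lookup v out
  ... | fzero  = nbCell v ∷ conv-NonBlank ws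
  ... | fsuc a = nbRaw a ∷ conv-NonBlank ws

  final-sim : ∀ {s h c} → Home nothing s h c →
    ∃ λ u → ∃ λ l → ∃ λ g → ∃ λ r → u ≤ suc (roundTrip h) × Steps u c (tape halt l g r) ×
      output ⟪ tape halt l g r ⟫ ≡ Vec.lookup s out
  final-sim {s} {h} (home {l} {r} {v} {vs} bl br R hh refl)
    with turnL {q = finR} {l = map conv (v ∷ vs) ʳ++ l} refl br
  ... | r′ , br′ , turn
    with turnR {q = finL} {r = map conv (v ∷ vs) ++ blank ∷ r′} refl bl
  ... | l′ , bl′ , turn′ =
    _ , _ , _ , _ ,
    s≤s (≤-trans (≤-reflexive (cong₂ (λ x y → suc (x + suc (suc (y + 1)))) (length-map cell vs) (length-map conv vs))) (roundTrip-mono hh)) ,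
    more refl (sweepR convΓ (λ { (isCell _) → refl }) (cells (v ∷ vs)) (sym (map-∘ (v ∷ vs))) (cells-IsCell (v ∷ vs)) l r
      ▷▷ (turn ▷▷ (sweepL (λ { (nbRaw _) → refl ; (nbCell _) → refl }) (map conv (v ∷ vs)) (conv-NonBlank (v ∷ vs)) l _ ▷▷ turn′))) ,
    readOut-conv (v ∷ vs) r′ (R out)

  load : Fin 3 → Cell
  load a = none [ inp ]≔ fsuc a

  loadΓ : Γ → Γ
  loadΓ (raw a) = cell (load a)
  loadΓ g       = g

  raws-IsRaw : ∀ w → All IsRaw (map raw w)
  raws-IsRaw []      = []
  raws-IsRaw (a ∷ w) = isRaw a ∷ raws-IsRaw w

  row-load : ∀ w → Track (row inp (map load w)) w
  row-load []      = bottom []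
  row-load (a ∷ w) = subst (λ t → Track (t ∷ _) _) (sym (lookup∘updateAt inp none)) (a ∷ row-load w)

  row-load′ : ∀ {j} → j ≢ inp → ∀ w → All (_≡ fzero) (row j (map load w))
  row-load′ j≢ []      = []
  row-load′ {j} j≢ (a ∷ w) = trans (lookup∘updateAt′ j inp j≢ none) (lookup-replicate j fzero) ∷ row-load′ j≢ w

  loaded-represents : ∀ w → Represents (map load w) (loaded inp w)
  loaded-represents w j with j ≟ᶠ inp
  ... | yes refl = subst (Track _) (sym (lookup∘updateAt inp (Vec.replicate k []))) (row-load w)
  ... | no j≢    = subst (Track _) (sym (trans (lookup∘updateAt′ j inp j≢ (Vec.replicate k [])) (lookup-replicate j []))) (bottom (row-load′ j≢ w))

  load-sim : ∀ a w → let L = length (a ∷ w) in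
    ∃ λ u → ∃ λ c → u ≤ roundTrip L × Steps u (goRight readR [] (map raw (a ∷ w))) c × Home (just p₀) (loaded inp (a ∷ w)) L c
  load-sim a w with turnR {q = backL (just p₀)} {r = cells (map load (a ∷ w)) ++ blank ∷ []} refl []
  ... | l′ , bl′ , turn′ =
    _ , _ , ≤-reflexive (cong₂ (λ x y → suc (x + suc (suc (y + 1)))) (length-map raw w)
              (trans (length-map cell (map load w)) (length-map load w))) ,
    (subst (λ gs → Steps (length (map raw (a ∷ w))) (goRight readR [] gs) (goRight readR (cells (map load (a ∷ w)) ʳ++ []) [])) (++-identityʳ (map raw (a ∷ w)))
       (sweepR loadΓ (λ { (isRaw _) → refl }) (map raw (a ∷ w)) (trans (sym (map-∘ {g = loadΓ} {f = raw} (a ∷ w))) (map-∘ {g = cell} {f = load} (a ∷ w)))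
         (raws-IsRaw (a ∷ w)) [] [])
      ▷▷ (proj₂ (proj₂ (turnL {q = readR} refl [])) ▷▷ (sweepL (λ { (isCell _) → refl }) (cells (map load (a ∷ w))) (cells-IsCell _) [] _ ▷▷ turn′))) ,
    mkHome (map load (a ∷ w)) (s≤s z≤n) bl′ (refl ∷ []) (loaded-represents (a ∷ w)) (≤-reflexive (length-map load (a ∷ w))) refl

  timeBound : ℕ → ℕ → ℕ
  timeBound t L = roundTrip L + (runBound t L + suc (roundTrip (t + L)))

  simulation : ∀ {t s a w} → Run prog t (just p₀) (loaded inp (a ∷ w)) s →
    ∀ {T} → timeBound t (length (a ∷ w)) ≤ T → ComputesWithin M T (a ∷ w) (Vec.lookup s out)
  simulation {t} {s} {a} {w} run {T} le
    with load-sim a w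
  ... | u₁ , c₁ , u₁≤ , steps₁ , hm₁ with run-sim run hm₁
  ... | u₂ , c₂ , u₂≤ , steps₂ , hm₂ with final-sim hm₂
  ... | u₃ , l , g , r , u₃≤ , steps₃ , out≡ =
    -- The fuel `T` is split into the steps of the three phases and a remainder, which a halted
    -- machine ignores.
    _ , trans (cong₂ runWithin (sym (m+[n∸m]≡n (≤-trans (+-mono-≤ u₁≤ (+-mono-≤ u₂≤ u₃≤)) le)))
                (cong (cfg (code Ctl-finite readR) [] ⌜ raw a ⌝) (map-∘ {g = ⌜_⌝} {f = raw} w)))
          (trans (runWithin-Steps (steps₁ ▷▷ (steps₂ ▷▷ steps₃)) _) (runWithin-halted (T ∸ (u₁ + (u₂ + u₃))) l g r)) , out≡

  runBound≤ : ∀ t h {H} → t + h ≤ H → runBound t h ≤ t * suc (roundTrip H)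
  runBound≤ zero    h le = z≤n
  runBound≤ (suc t) h {H} le = +-mono-≤ (s≤s (roundTrip-mono (≤-trans (m≤n+m h (suc t)) le)))
    (runBound≤ t (suc h) (≤-trans (≤-reflexive (+-suc t h)) le))

  timeBound≤ : ∀ t {t′} L → t ≤ t′ → timeBound t L ≤ (2 + t′) * suc (roundTrip (t′ + L))
  timeBound≤ t {t′} L t≤t′ = begin
    roundTrip L + (runBound t L + suc (roundTrip (t + L)))
      ≤⟨ +-mono-≤ (≤-trans (roundTrip-mono (m≤n+m L t′)) (n≤1+n _))
           (+-mono-≤ (≤-trans (runBound≤ t L (+-monoˡ-≤ L t≤t′)) (*-monoˡ-≤ c t≤t′))
             (s≤s (roundTrip-mono (+-monoˡ-≤ L t≤t′)))) ⟩
    c + (t′ * c + c) ≡⟨ cong (c +_) (+-comm (t′ * c) c) ⟩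
    c + (c + t′ * c) ∎
    where
    open ≤-Reasoning
    c = suc (roundTrip (t′ + L))

-- Programs on stacks

infixr 5 _⨟_

data Cmd (k : ℕ) : Set where
  skip : Cmd k
  push : Fin k → Fin 3 → Cmd k
  _⨟_  : Cmd k → Cmd k → Cmd k
  -- Pop stack i and run the command selected by the result; repeat while the flag says so.
  loop : (i : Fin k) (again : Top → Bool) (body : Top → Cmd k) → Cmd k

-- By `weaken` the last index is only an upper bound on the time, so costs can be rounded up to
-- uniform expressions at every stage. Even `skip` costs 1, since its position holds a `nop`.
data Exec {k : ℕ} : Cmd k → Stacks k → Stacks k → ℕ → Set where
  skip  : ∀ {s} → Exec skip s s 1
  push  : ∀ {i a s} → Exec (push i a) s (s [ i ]%= (a ∷_)) 1
  _⨟_   : ∀ {c d s s′ s″ t u} → Exec c s s′ t → Exec d s′ s″ u → Exec (c ⨟ d) s s″ (t + u)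
  again : ∀ {i b h s s′ s″ t u} → b (top (Vec.lookup s i)) ≡ true →
          Exec (h (top (Vec.lookup s i))) (s [ i ]%= pop) s′ t → Exec (loop i b h) s′ s″ u →
          Exec (loop i b h) s s″ (suc (t + u))
  break : ∀ {i b h s s′ t} → b (top (Vec.lookup s i)) ≡ false →
          Exec (h (top (Vec.lookup s i))) (s [ i ]%= pop) s′ t →
          Exec (loop i b h) s s′ (suc t)
  weaken : ∀ {c s s′ t u} → t ≤ u → Exec c s s′ t → Exec c s s′ u

module _ {k : ℕ} where

  -- Program counters as places in the syntax tree; the left summand for a loop is its test, and
  -- each result of the pop has its own copy of positions.
  Pos : Cmd k → Set
  Pos skip         = ⊤
  Pos (push _ _)   = ⊤
  Pos (c ⨟ d)      = Pos c ⊎ Pos d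
  Pos (loop _ _ h) = ⊤ ⊎ Σ Top (λ a → Pos (h a))

  Pos-finite : ∀ c → Finite (Pos c)
  Pos-finite skip         = ⊤-finite
  Pos-finite (push _ _)   = ⊤-finite
  Pos-finite (c ⨟ d)      = Pos-finite c ⊎-finite Pos-finite d
  Pos-finite (loop _ _ h) = ⊤-finite ⊎-finite Σ-finite 4 (λ a → Pos-finite (h a))

  entry : ∀ c → Pos c
  entry skip         = tt
  entry (push _ _)   = tt
  entry (c ⨟ d)      = inj₁ (entry c)
  entry (loop _ _ _) = inj₁ tt

  compile : ∀ c → Pos c → Instr k (Maybe (Pos c))
  compile skip _         = nop nothing
  compile (push i a) _   = pushI i a nothing
  compile (c ⨟ d) (inj₁ p) = mapI (Maybe.maybe (just ∘ inj₁) (just (inj₂ (entry d)))) (compile c p)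
  compile (c ⨟ d) (inj₂ p) = mapI (Maybe.maybe (just ∘ inj₂) nothing) (compile d p)
  compile (loop i b h) (inj₁ _)       = popI i (λ a → just (inj₂ (a , entry (h a))))
  compile (loop i b h) (inj₂ (a , p)) =
    mapI (Maybe.maybe (λ p′ → just (inj₂ (a , p′))) (if b a then just (inj₁ tt) else nothing)) (compile (h a) p)

  exec-mapI : ∀ {X Y : Set} (f : X → Y) I (s : Stacks k) → exec (mapI f I) s ≡ (f (proj₁ (exec I s)) , proj₂ (exec I s))
  exec-mapI f (nop x)       s = refl
  exec-mapI f (pushI i a x) s = refl
  exec-mapI f (popI i h)    s = refl

  -- Control leaves a subprogram only through `nothing`. Redirecting this exit to `z` is all that
  -- changes when the subprogram is placed inside a larger one.
  run-embed : ∀ {P P′ : Set} {prog : P → Instr k (Maybe P)} {prog′ : P′ → Instr k (Maybe P′)}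
    (f : P → P′) (z : Maybe P′) → (∀ p → prog′ (f p) ≡ mapI (Maybe.maybe (just ∘ f) z) (prog p)) →
    ∀ {t u p s s′ s″} → Run prog t p s s′ → Run prog′ u z s′ s″ → Run prog′ (t + u) (Maybe.maybe (just ∘ f) z p) s s″
  run-embed f z eq stop run′ = run′
  run-embed {prog = prog} {prog′} f z eq {p = just p} {s} (next run) run′ =
    next (subst (λ (q , s₁) → Run prog′ _ q s₁ _)
      (sym (trans (cong (λ I → exec I s) (eq p)) (exec-mapI _ (prog p) s)))
      (run-embed f z eq run run′))

  compile-correct : ∀ {c : Cmd k} {s s′ t} → Exec c s s′ t →
    ∃ λ t′ → t′ ≤ t × Run (compile c) t′ (just (entry c)) s s′
  compile-correct skip = 1 , ≤-refl , next stop
  compile-correct push = 1 , ≤-refl , next stop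
  compile-correct (x ⨟ y) with compile-correct x | compile-correct y
  ... | t , t≤ , r | u , u≤ , r′ = t + u , +-mono-≤ t≤ u≤ ,
    run-embed inj₁ _ (λ _ → refl) r
      (subst (λ x → Run _ x _ _ _) (+-identityʳ u) (run-embed inj₂ nothing (λ _ → refl) r′ stop))
  compile-correct (again {i} {b} {h} {s} e x y) with compile-correct x | compile-correct y
  ... | t , t≤ , r | u , u≤ , r′ = suc (t + u) , s≤s (+-mono-≤ t≤ u≤) ,
    next (run-embed (λ p → inj₂ (top (Vec.lookup s i) , p)) _ (λ _ → refl) r
      (subst (λ v → Run (compile (loop i b h)) u (if v then just (inj₁ tt) else nothing) _ _) (sym e) r′))
  compile-correct (break {i} {b} {h} {s} e x) with compile-correct x
  ... | t , t≤ , r = suc t , s≤s t≤ ,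
    next (subst (λ x → Run _ x _ _ _) (+-identityʳ t)
      (run-embed (λ p → inj₂ (top (Vec.lookup s i) , p)) _ (λ _ → refl) r
        (subst (λ v → Run (compile (loop i b h)) 0 (if v then just (inj₁ tt) else nothing) _ _) (sym e) stop)))
  compile-correct (weaken le x) with compile-correct x
  ... | t , t≤ , r = t , ≤-trans t≤ le , r

  abstract
    machine : Cmd k → (inp out : Fin k) → TM
    machine c inp out = Simulation.M (Pos-finite c) (compile c) (entry c) inp out

    machine-computes : ∀ (c : Cmd k) inp out {s t T a w} → Exec c (loaded inp (a ∷ w)) s t →
      (2 + t) * suc (roundTrip (t + length (a ∷ w))) ≤ T → ComputesWithin (machine c inp out) T (a ∷ w) (Vec.lookup s out)
    machine-computes c inp out {t = t} {a = a} {w} ex le with compile-correct ex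
    ... | t′ , t′≤t , run = simulation run (≤-trans (timeBound≤ t′ (length (a ∷ w)) t′≤t) le)
      where open Simulation (Pos-finite c) (compile c) (entry c) inp out

-- Polynomial bounds

-- Powers of `suc L`, unlike those of `L`, grow with the exponent even at 0, so two bounds can
-- always be raised to a common degree.
record PolyBounded (f : ℕ → ℕ) : Set where
  field
    factor degree : ℕ
    bound : ∀ L → f L ≤ factor * suc L ^ degree
open PolyBounded

constₚ : ∀ c → PolyBounded (const c)
constₚ c = record { factor = c ; degree = 0 ; bound = λ L → ≤-reflexive (sym (*-identityʳ c)) }

idₚ : PolyBounded id
idₚ = record { factor = 1 ; degree = 1 ; bound = λ L → ≤-trans (n≤1+n L) (≤-reflexive (sym (trans (*-identityˡ _) (*-identityʳ (suc L))))) }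

infixl 6 _+ₚ_
infixl 7 _*ₚ_

_+ₚ_ : ∀ {f g} → PolyBounded f → PolyBounded g → PolyBounded (λ L → f L + g L)
_+ₚ_ {f} {g} p q = record { factor = factor p + factor q ; degree = degree p + degree q ; bound = λ L → begin
  f L + g L                                                               ≤⟨ +-mono-≤ (bound p L) (bound q L) ⟩
  factor p * suc L ^ degree p + factor q * suc L ^ degree q
    ≤⟨ +-mono-≤ (*-monoʳ-≤ (factor p) (^-monoʳ-≤ (suc L) (m≤m+n (degree p) (degree q))))
                (*-monoʳ-≤ (factor q) (^-monoʳ-≤ (suc L) (m≤n+m (degree q) (degree p)))) ⟩
  factor p * suc L ^ (degree p + degree q) + factor q * suc L ^ (degree p + degree q) ≡⟨ *-distribʳ-+ _ (factor p) (factor q) ⟨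
  (factor p + factor q) * suc L ^ (degree p + degree q)                   ∎ }
  where open ≤-Reasoning

_*ₚ_ : ∀ {f g} → PolyBounded f → PolyBounded g → PolyBounded (λ L → f L * g L)
_*ₚ_ {f} {g} p q = record { factor = factor p * factor q ; degree = degree p + degree q ; bound = λ L → begin
  f L * g L                                                               ≤⟨ *-mono-≤ (bound p L) (bound q L) ⟩
  (factor p * suc L ^ degree p) * (factor q * suc L ^ degree q)
    ≡⟨ solve 4 (λ a b c d → (a :* b) :* (c :* d) := a :* c :* (b :* d)) refl (factor p) (suc L ^ degree p) (factor q) (suc L ^ degree q) ⟩
  factor p * factor q * (suc L ^ degree p * suc L ^ degree q)             ≡⟨ cong (factor p * factor q *_) (^-distribˡ-+-* (suc L) (degree p) (degree q)) ⟨
  factor p * factor q * suc L ^ (degree p + degree q)                     ∎ }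
  where open ≤-Reasoning

*-^ : ∀ a b d → (a * b) ^ d ≡ a ^ d * b ^ d
*-^ a b zero    = refl
*-^ a b (suc d) = trans (cong (a * b *_) (*-^ a b d))
  (solve 4 (λ a b c d → (a :* b) :* (c :* d) := a :* c :* (b :* d)) refl a b (a ^ d) (b ^ d))

-- For positive `L` the base `suc L` is at most `2 * L`; the second summand covers `L` equal to 0.
suc-^≤ : ∀ L d → suc L ^ d ≤ 2 ^ d * L ^ d + 2 ^ d
suc-^≤ zero    d = ≤-trans (≤-reflexive (^-zeroˡ d)) (≤-trans (m^n>0 2 d) (m≤n+m _ _))
suc-^≤ (suc L) d = ≤-trans (^-monoˡ-≤ d (s≤s (≤-trans (m≤n+m _ L) (+-monoʳ-≤ L (≤-reflexive (sym (+-identityʳ (suc L))))))))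
  (≤-trans (≤-reflexive (*-^ 2 (suc L) d)) (m≤m+n _ _))

poly-bound : ∀ {f} → PolyBounded f → ∃ λ c → ∃ λ d → ∀ L → f L ≤ c * L ^ d + c
poly-bound {f} p = factor p * 2 ^ degree p , degree p , λ L → begin
  f L                                               ≤⟨ bound p L ⟩
  factor p * suc L ^ degree p                       ≤⟨ *-monoʳ-≤ (factor p) (suc-^≤ L (degree p)) ⟩
  factor p * (2 ^ degree p * L ^ degree p + 2 ^ degree p)
    ≡⟨ solve 3 (λ a b c → a :* (b :* c :+ b) := a :* b :* c :+ a :* b) refl (factor p) (2 ^ degree p) (L ^ degree p) ⟩
  factor p * 2 ^ degree p * L ^ degree p + factor p * 2 ^ degree p ∎
  where open ≤-Reasoning


-- The program computing the reduction

open DecMembership _≟_ renaming (_∈?_ to _∈ℕ?_) using ()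

pattern ‵0 = fsuc fzero
pattern ‵1 = fsuc (fsuc fzero)
pattern ‵# = fsuc (fsuc (fsuc fzero))

data IsDigit : Fin 3 → Set where
  d0 : IsDigit b0
  d1 : IsDigit b1

nonempty isDigit never : Top → Bool
nonempty fzero    = false
nonempty (fsuc _) = true
isDigit ‵0 = true
isDigit ‵1 = true
isDigit _  = false
never _ = false

module _ {k : ℕ} where

  -- The symbol that fails the test is popped and discarded, so reading the digits of a number also
  -- consumes its separator. The symbols arrive in reverse order.
  transfer : (Top → Bool) → Fin k → Fin k → Cmd k
  transfer b i j = loop i b (λ { fzero → skip ; (fsuc a) → if b (fsuc a) then push j a else skip })

  move : Fin k → Fin k → Cmd k
  move = transfer nonempty

  clear : Fin k → Cmd k
  clear i = loop i nonempty (λ _ → skip)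

  branch : Fin k → (Top → Cmd k) → Cmd k
  branch i = loop i never

  again′ : ∀ {i b h} {s s′ s″ : Stacks k} {t u} a → top (Vec.lookup s i) ≡ a → b a ≡ true →
           Exec (h a) (s [ i ]%= pop) s′ t → Exec (loop i b h) s′ s″ u → Exec (loop i b h) s s″ (suc (t + u))
  again′ _ refl = again

  break′ : ∀ {i b h} {s s′ : Stacks k} {t} a → top (Vec.lookup s i) ≡ a → b a ≡ false →
           Exec (h a) (s [ i ]%= pop) s′ t → Exec (loop i b h) s s′ (suc t)
  break′ _ refl = break

  Exec-cast : ∀ {c : Cmd k} {s s₁ s₂ t} → s₁ ≡ s₂ → Exec c s s₁ t → Exec c s s₂ t
  Exec-cast refl x = x

  transfer-exec : ∀ {b i j} → i ≢ j → ∀ xs rest → All (λ a → b (fsuc a) ≡ true) xs → b (top rest) ≡ false →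
    ∀ s → Vec.lookup s i ≡ xs ++ rest →
    Exec (transfer b i j) s (s [ i ]≔ pop rest [ j ]%= (xs ʳ++_)) (2 + length xs * 2)
  transfer-exec {b} {i} {j} i≢j [] rest [] ends s eq =
    Exec-cast (trans (updateAt-cong-local i s (cong pop eq)) (sym (updateAt-id j (s [ i ]≔ pop rest)))) (body rest ends eq)
    where
    body : ∀ rest → b (top rest) ≡ false → Vec.lookup s i ≡ rest → Exec (transfer b i j) s (s [ i ]%= pop) 2
    body []      ends eq = break′ fzero (cong top eq) ends skip
    body (a ∷ _) ends eq = break′ (fsuc a) (cong top eq) ends (subst (λ v → Exec (if v then _ else skip) _ _ 1) (sym ends) skip)
  transfer-exec {b} {i} {j} i≢j (a ∷ xs) rest (ok ∷ oks) ends s eq =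
    again′ (fsuc a) (cong top eq) ok (subst (λ v → Exec (if v then push j a else skip) (s [ i ]%= pop) (s [ i ]%= pop [ j ]%= (a ∷_)) 1) (sym ok) push)
      (Exec-cast same (transfer-exec i≢j xs rest oks ends (s [ i ]%= pop [ j ]%= (a ∷_))
        (trans (lookup∘updateAt′ i j i≢j (s [ i ]%= pop)) (trans (lookup∘updateAt i s) (cong pop eq)))))
    where
    same : s [ i ]%= pop [ j ]%= (a ∷_) [ i ]≔ pop rest [ j ]%= (xs ʳ++_) ≡ s [ i ]≔ pop rest [ j ]%= ((a ∷ xs) ʳ++_)
    same = trans (cong (_[ j ]%= (xs ʳ++_)) (trans (updateAt-commutes i j i≢j (s [ i ]%= pop))
      (cong (_[ j ]%= (a ∷_)) (updateAt-updateAt i s)))) (updateAt-updateAt j (s [ i ]≔ pop rest))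

  all-nonempty : ∀ xs → All (λ a → nonempty (fsuc a) ≡ true) xs
  all-nonempty []       = []
  all-nonempty (_ ∷ xs) = refl ∷ all-nonempty xs

  move-exec : ∀ {i j} → i ≢ j → ∀ s →
    Exec (move i j) s (s [ i ]≔ [] [ j ]%= (Vec.lookup s i ʳ++_)) (2 + length (Vec.lookup s i) * 2)
  move-exec i≢j s = transfer-exec i≢j _ [] (all-nonempty _) refl s (sym (++-identityʳ _))

  clear-exec : ∀ {i} xs s → Vec.lookup s i ≡ xs → Exec (clear i) s (s [ i ]≔ []) (2 + length xs * 2)
  clear-exec {i} [] s eq = Exec-cast (updateAt-cong-local i s (cong pop eq)) (break′ fzero (cong top eq) refl skip)
  clear-exec {i} (a ∷ xs) s eq = again′ (fsuc a) (cong top eq) refl skip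
    (Exec-cast (updateAt-updateAt i s) (clear-exec xs (s [ i ]%= pop) (trans (lookup∘updateAt i s) (cong pop eq))))

k₀ : ℕ
k₀ = 12

-- ‵I: input; ‵A: n; ‵B: k; ‵X, ‵Y: current vertex; ‵E: edges read; ‵D: distinct vertices; ‵T: scratch;
-- ‵F: the current vertex is already on ‵D; ‵G: the comparison found a difference; ‵C: number of vertices on ‵D
-- in unary; ‵O: output. Numbers have the least significant digit on top, but are reversed on ‵A and ‵X.
pattern ‵I = fzero
pattern ‵A = fsuc ‵I
pattern ‵B = fsuc ‵A
pattern ‵X = fsuc ‵B
pattern ‵Y = fsuc ‵X
pattern ‵E = fsuc ‵Y
pattern ‵D = fsuc ‵E
pattern ‵T = fsuc ‵D
pattern ‵F = fsuc ‵T
pattern ‵G = fsuc ‵F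
pattern ‵C = fsuc ‵G
pattern ‵O = fsuc ‵C

Str : Set
Str = List (Fin 3)

st : (i a b x y e d t f g c o : Str) → Stacks k₀
st i a b x y e d t f g c o = i ∷ a ∷ b ∷ x ∷ y ∷ e ∷ d ∷ t ∷ f ∷ g ∷ c ∷ o ∷ []

-- In bijective base 2 the digits `b0` and `b1` have the values 1 and 2. From the least significant
-- end, each 2 becomes 1 with a carry and is parked on `‵X`, until a 1 becomes 2 or the number ends
-- and gains a digit 1.
carry : Cmd k₀
carry = loop ‵B (λ { ‵1 → true ; _ → false })
  (λ { fzero → push ‵B b0 ; ‵0 → push ‵B b1 ; ‵1 → push ‵X b0 ; ‵# → skip })

increment : Cmd k₀
increment = carry ⨟ move ‵X ‵B

-- The digits of `‵Y` are saved on `‵X` while they are compared, so that `‵Y` can be restored after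
-- each block. A block equals `‵Y` exactly if at its separator `‵Y` is used up and no difference is
-- recorded on `‵G`.
scan : Cmd k₀
scan = loop ‵D nonempty λ where
  fzero → skip
  ‵0    → push ‵T b0 ⨟ branch ‵Y (λ { fzero → push ‵G b0 ; ‵0 → push ‵X b0 ; ‵1 → push ‵X b1 ⨟ push ‵G b0 ; ‵# → skip })
  ‵1    → push ‵T b1 ⨟ branch ‵Y (λ { fzero → push ‵G b0 ; ‵0 → push ‵X b0 ⨟ push ‵G b0 ; ‵1 → push ‵X b1 ; ‵# → skip })
  ‵#    → push ‵T sep ⨟ branch ‵Y (λ { fzero    → branch ‵G (λ { fzero → push ‵F b0 ; (fsuc a) → push ‵G a })
                                   ; (fsuc a) → push ‵Y a })
          ⨟ move ‵X ‵Y ⨟ clear ‵G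

-- Addition by repeated increments is affordable because there are no more distinct vertices than
-- input symbols. The counter is parked on `‵T` and restored by `bump`.
addC : Cmd k₀
addC = loop ‵C nonempty (λ { fzero → skip ; (fsuc _) → push ‵T b0 ⨟ increment })

bump : Cmd k₀
bump = addC ⨟ move ‵T ‵C

new : Cmd k₀
new = move ‵Y ‵X ⨟ push ‵D sep ⨟ move ‵X ‵D ⨟ push ‵C b0 ⨟ bump

keep : Cmd k₀
keep = branch ‵F (λ { fzero → new ; (fsuc _) → clear ‵Y ⨟ clear ‵F })

process : Cmd k₀
process = move ‵X ‵Y ⨟ scan ⨟ move ‵T ‵D ⨟ keep

readEdges : Cmd k₀
readEdges = loop ‵I nonempty λ where
  fzero → skip
  ‵0    → push ‵E b0 ⨟ push ‵X b0
  ‵1    → push ‵E b1 ⨟ push ‵X b1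
  ‵#    → push ‵E sep ⨟ process

spreadA : Cmd k₀
spreadA = loop ‵A nonempty (λ { fzero → skip ; (fsuc a) → push ‵O a ⨟ push ‵X a })

-- Because `‵A` holds n reversed, popping it onto `‵O` yields the right order of digits; the second
-- copy on `‵X` serves to restore `‵A`.
copyN : Cmd k₀
copyN = spreadA ⨟ move ‵X ‵A

writeStars : Cmd k₀
writeStars = loop ‵T nonempty λ where
  fzero → skip
  ‵0    → push ‵O b0
  ‵1    → push ‵O b1
  ‵#    → push ‵O sep ⨟ copyN ⨟ push ‵O sep

-- The top of `‵O` is the beginning of the output, so the output is written from its end: spokes,
-- edges of `G`, the new bound, and the number of vertices. The last two numbers pass through `‵X`,
-- since a single move would reverse them.
program : Cmd k₀
program = transfer isDigit ‵I ‵A ⨟ transfer isDigit ‵I ‵T ⨟ move ‵T ‵B ⨟ readEdges ⨟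
  move ‵D ‵T ⨟ writeStars ⨟ move ‵E ‵O ⨟ push ‵O sep ⨟ move ‵B ‵X ⨟ move ‵X ‵O ⨟ push ‵O sep ⨟
  move ‵A ‵B ⨟ increment ⨟ move ‵B ‵X ⨟ move ‵X ‵O

-- Correctness of increment and addition

dig : ℕ → Str
dig n = encBin (toBin n)

encBin-digits : ∀ x → All IsDigit (encBin x)
encBin-digits zeroᵇ    = []
encBin-digits 2[1+ x ] = d1 ∷ encBin-digits x
encBin-digits 1+[2 x ] = d0 ∷ encBin-digits x

dig-suc : ∀ n → dig (suc n) ≡ encBin (sucᵇ (toBin n))
dig-suc n = cong encBin (trans (fromℕ≡fromℕ' (suc n)) (cong sucᵇ (sym (fromℕ≡fromℕ' n))))

length-encBin-suc : ∀ x → length (encBin (sucᵇ x)) ≤ suc (length (encBin x))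
length-encBin-suc zeroᵇ    = ≤-refl
length-encBin-suc 2[1+ x ] = s≤s (length-encBin-suc x)
length-encBin-suc 1+[2 x ] = n≤1+n _

-- One digit for each unit added is a crude bound, but the numbers added are at most quadratic in
-- the length of the input.
length-dig-+ : ∀ j n → length (dig (j + n)) ≤ j + length (dig n)
length-dig-+ zero    n = ≤-refl
length-dig-+ (suc j) n = ≤-trans (≤-reflexive (cong length (dig-suc (j + n))))
  (≤-trans (length-encBin-suc (toBin (j + n))) (s≤s (length-dig-+ j n)))

encBin-injective : ∀ x y → encBin x ≡ encBin y → x ≡ y
encBin-injective zeroᵇ    zeroᵇ    eq = refl
encBin-injective 2[1+ x ] 2[1+ y ] eq = cong 2[1+_] (encBin-injective x y (cong pop eq))
encBin-injective 1+[2 x ] 1+[2 y ] eq = cong 1+[2_] (encBin-injective x y (cong pop eq))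

dig-injective : ∀ {m n} → dig m ≡ dig n → m ≡ n
dig-injective {m} {n} eq = trans (sym (toℕ-fromℕ' m)) (trans (cong fromBin
  (trans (sym (fromℕ≡fromℕ' m)) (trans (encBin-injective _ _ eq) (fromℕ≡fromℕ' n)))) (toℕ-fromℕ' n))

rev-rev : (xs : Str) → (xs ʳ++ []) ʳ++ [] ≡ xs
rev-rev xs = trans (ʳ++-ʳ++ xs) (++-identityʳ xs)

-- Where the digits are split between `x′` and `w` depends on the number of carries, so only the
-- result of pouring `x′` back is described.
carry-exec : ∀ z {i a x y e d t f g c o} → ∃ λ x′ → ∃ λ w → x′ ʳ++ w ≡ x ʳ++ encBin (sucᵇ z) ×
  length x′ ≤ length x + length (encBin z) ×
  Exec carry (st i a (encBin z) x y e d t f g c o) (st i a w x′ y e d t f g c o) (2 + length (encBin z) * 2)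
carry-exec zeroᵇ = _ , _ , refl , m≤m+n _ _ , break refl push
carry-exec 1+[2 z ] = _ , _ , refl , m≤m+n _ _ , weaken (s≤s (s≤s z≤n)) (break refl push)
carry-exec 2[1+ z ] {x = x} with carry-exec z {x = b0 ∷ x}
... | x′ , w , eq , le , ex = x′ , w , eq , ≤-trans le (≤-reflexive (sym (+-suc (length x) _))) , again refl push ex

increment-exec : ∀ n {i a y e d t f g c o} →
  Exec increment (st i a (dig n) [] y e d t f g c o) (st i a (dig (suc n)) [] y e d t f g c o) (4 + length (dig n) * 4)
increment-exec n {i} {a} {y} {e} {d} {t} {f} {g} {c} {o} with carry-exec (toBin n) {i} {a} {[]} {y} {e} {d} {t} {f} {g} {c} {o}
... | x′ , w , eq , le , ex = weaken cost (ex ⨟ Exec-cast same (move-exec (λ ()) _))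
  where
  same : st i a (x′ ʳ++ w) [] y e d t f g c o ≡ st i a (dig (suc n)) [] y e d t f g c o
  same = cong (λ b → st i a b [] y e d t f g c o) (trans eq (sym (dig-suc n)))
  l = length (dig n)
  cost : 2 + l * 2 + (2 + length x′ * 2) ≤ 4 + l * 4
  cost = begin
    2 + l * 2 + (2 + length x′ * 2) ≤⟨ +-monoʳ-≤ (2 + l * 2) (s≤s (s≤s (*-monoˡ-≤ 2 le))) ⟩
    2 + l * 2 + (2 + l * 2)         ≡⟨ solve 1 (λ l → con 2 :+ l :* con 2 :+ (con 2 :+ l :* con 2) := con 4 :+ l :* con 4) refl l ⟩
    4 + l * 4                       ∎
    where open ≤-Reasoning

unary : ℕ → Str
unary l = replicate l b0

addC-exec : ∀ l n {β i a y e d t f g o} → length (dig n) + l ≤ β →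
  Exec addC (st i a (dig n) [] y e d t f g (unary l) o) (st i a (dig (l + n)) [] y e d (unary l ʳ++ t) f g [] o) (l * (6 + β * 4) + 2)
addC-exec zero    n le = break refl skip
addC-exec (suc l) n {β} {i} {a} {y} {e} {d} {t} {f} {g} {o} le = weaken cost
  (again refl (push ⨟ increment-exec n) (Exec-cast (cong (λ x → st i a (dig x) [] y e d (unary l ʳ++ (b0 ∷ t)) f g [] o) (+-suc l n))
    (addC-exec l (suc n) {β} (≤-trans (+-monoˡ-≤ l (length-dig-+ 1 n)) (≤-trans (≤-reflexive (sym (+-suc _ l))) le)))))
  where
  cost : suc (5 + length (dig n) * 4 + (l * (6 + β * 4) + 2)) ≤ suc l * (6 + β * 4) + 2
  cost = ≤-trans (s≤s (s≤s (s≤s (s≤s (s≤s (s≤s (+-monoˡ-≤ (l * (6 + β * 4) + 2) (*-monoˡ-≤ 4 (≤-trans (m≤m+n _ (suc l)) le)))))))))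
    (≤-reflexive (sym (+-assoc (6 + β * 4) (l * (6 + β * 4)) 2)))

length-unary : ∀ l → length (unary l) ≡ l
length-unary l = length-replicate l

bump-exec : ∀ l n {β i a y e d f g o} → length (dig n) + l ≤ β →
  Exec bump (st i a (dig n) [] y e d [] f g (unary l) o) (st i a (dig (l + n)) [] y e d [] f g (unary l) o)
    (l * (6 + β * 4) + 2 + (2 + l * 2))
bump-exec l n {β} {i} {a} {y} {e} {d} {f} {g} {o} le = addC-exec l n le ⨟
  weaken (≤-reflexive (cong (λ x → 2 + x * 2) (trans (length-ʳ++ (unary l)) (trans (+-identityʳ _) (length-unary l)))))
    (Exec-cast (cong (λ c → st i a (dig (l + n)) [] y e d [] f g c o) (rev-rev (unary l))) (move-exec (λ ()) _))

-- Effect on ‵X, ‵Y and ‵G of comparing ds with the string on ‵Y.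
record Compared (ds x y g x′ y′ g′ : Str) : Set where
  field
    restores : x′ ʳ++ y′ ≡ x ʳ++ y
    lengthX  : length x′ ≤ length x + length y
    lengthG  : length g′ ≤ length g + length ds
    sound    : y′ ≡ [] → g′ ≡ [] → g ≡ [] × ds ≡ y
    complete : ds ≡ y → g ≡ [] → y′ ≡ [] × g′ ≡ []
open Compared

compared-[] : ∀ {x y g} → Compared [] x y g x y g
compared-[] = record { restores = refl ; lengthX = m≤m+n _ _ ; lengthG = m≤m+n _ _
  ; sound = λ y≡ g≡ → g≡ , sym y≡ ; complete = λ y≡ g≡ → sym y≡ , g≡ }

compared-short : ∀ {d ds x g x′ y′ g′} → Compared ds x [] (b0 ∷ g) x′ y′ g′ → Compared (d ∷ ds) x [] g x′ y′ g′
compared-short {g = g} r = record { restores = restores r ; lengthX = lengthX r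
  ; lengthG = ≤-trans (lengthG r) (≤-reflexive (sym (+-suc (length g) _)))
  ; sound = λ y≡ g≡ → contradiction (proj₁ (sound r y≡ g≡)) λ () ; complete = λ () }

compared-same : ∀ {d ds x y g x′ y′ g′} → Compared ds (d ∷ x) y g x′ y′ g′ → Compared (d ∷ ds) x (d ∷ y) g x′ y′ g′
compared-same {x = x} {g = g} r = record { restores = restores r
  ; lengthX = ≤-trans (lengthX r) (≤-reflexive (sym (+-suc (length x) _)))
  ; lengthG = ≤-trans (lengthG r) (+-monoʳ-≤ (length g) (n≤1+n _))
  ; sound = λ y≡ g≡ → proj₁ (sound r y≡ g≡) , cong (_ ∷_) (proj₂ (sound r y≡ g≡))
  ; complete = λ y≡ → complete r (cong pop y≡) }

compared-differ : ∀ {d d′ ds x y g x′ y′ g′} → d ≢ d′ → Compared ds (d′ ∷ x) y (b0 ∷ g) x′ y′ g′ →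
                  Compared (d ∷ ds) x (d′ ∷ y) g x′ y′ g′
compared-differ {x = x} {g = g} d≢ r = record { restores = restores r
  ; lengthX = ≤-trans (lengthX r) (≤-reflexive (sym (+-suc (length x) _)))
  ; lengthG = ≤-trans (lengthG r) (≤-reflexive (sym (+-suc (length g) _)))
  ; sound = λ y≡ g≡ → contradiction (proj₁ (sound r y≡ g≡)) λ ()
  ; complete = λ { refl → contradiction refl d≢ } }

-- One loop runs through the digits and separators of all blocks, so the digits of one block are
-- only a segment of its run; hence the statement about an arbitrary continuation.
scan-digits : ∀ ds → All IsDigit ds → ∀ y → All IsDigit y → ∀ {i a b x e t f g c o rest} →
  ∃ λ x′ → ∃ λ y′ → ∃ λ g′ → Compared ds x y g x′ y′ g′ ×
    (∀ {s′ u} → Exec scan (st i a b x′ y′ e rest (ds ʳ++ t) f g′ c o) s′ u →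
                Exec scan (st i a b x y e (ds ++ rest) t f g c o) s′ (length ds * 5 + u))
scan-digits [] [] y _ = _ , _ , _ , compared-[] , id
scan-digits (_ ∷ ds) (d0 ∷ ps) [] [] =
  let _ , _ , _ , r , ex = scan-digits ds ps [] []
  in _ , _ , _ , compared-short r , λ z → weaken (n≤1+n _) (again refl (push ⨟ break refl push) (ex z))
scan-digits (_ ∷ ds) (d1 ∷ ps) [] [] =
  let _ , _ , _ , r , ex = scan-digits ds ps [] []
  in _ , _ , _ , compared-short r , λ z → weaken (n≤1+n _) (again refl (push ⨟ break refl push) (ex z))
scan-digits (_ ∷ ds) (d0 ∷ ps) (_ ∷ y) (d0 ∷ qs) =
  let _ , _ , _ , r , ex = scan-digits ds ps y qs
  in _ , _ , _ , compared-same r , λ z → weaken (n≤1+n _) (again refl (push ⨟ break refl push) (ex z))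
scan-digits (_ ∷ ds) (d1 ∷ ps) (_ ∷ y) (d1 ∷ qs) =
  let _ , _ , _ , r , ex = scan-digits ds ps y qs
  in _ , _ , _ , compared-same r , λ z → weaken (n≤1+n _) (again refl (push ⨟ break refl push) (ex z))
scan-digits (_ ∷ ds) (d0 ∷ ps) (_ ∷ y) (d1 ∷ qs) =
  let _ , _ , _ , r , ex = scan-digits ds ps y qs
  in _ , _ , _ , compared-differ (λ ()) r , λ z → again refl (push ⨟ break refl (push ⨟ push)) (ex z)
scan-digits (_ ∷ ds) (d1 ∷ ps) (_ ∷ y) (d0 ∷ qs) =
  let _ , _ , _ , r , ex = scan-digits ds ps y qs
  in _ , _ , _ , compared-differ (λ ()) r , λ z → again refl (push ⨟ break refl (push ⨟ push)) (ex z)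

_≟ˢ_ : (xs ys : Str) → Dec (xs ≡ ys)
_≟ˢ_ = ≡-dec _≟ᶠ_

record-hit : Str → Str → Str → Str
record-hit ds y f = if does (ds ≟ˢ y) then b0 ∷ f else f

scan-block : ∀ ds → All IsDigit ds → ∀ y → All IsDigit y → ∀ {i a b e t f c o rest s′ u} →
  Exec scan (st i a b [] y e rest (sep ∷ (ds ʳ++ t)) (record-hit ds y f) [] c o) s′ u →
  Exec scan (st i a b [] y e (ds ++ sep ∷ rest) t f [] c o) s′ (suc (length ds) * (9 + length y * 2) + u)
scan-block ds ps y qs {i} {a} {b} {e} {t} {f} {c} {o} {rest} {s′} {u} z
  with scan-digits ds ps y qs {i} {a} {b} {[]} {e} {t} {f} {[]} {c} {o} {sep ∷ rest}
... | x′ , y′ , g′ , r , ex = weaken cost (ex (decide y′ g′ r (ds ≟ˢ y) z))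
  where
  clean : ∀ {f} y″ g″ → x′ ʳ++ y″ ≡ y →
    Exec (move ‵X ‵Y ⨟ clear ‵G) (st i a b x′ y″ e rest (sep ∷ (ds ʳ++ t)) f g″ c o) (st i a b [] y e rest (sep ∷ (ds ʳ++ t)) f [] c o)
      (2 + length x′ * 2 + (2 + length g″ * 2))
  clean {f} y″ g″ refl = move-exec (λ ()) _ ⨟ clear-exec g″ _ refl
  l = length x′ * 2
  arrange : ∀ l g → suc (1 + (3 + (2 + l + (2 + g))) + u) ≡ 9 + l + g + u
  arrange l g = solve 3 (λ l g u → con 1 :+ (con 1 :+ (con 3 :+ (con 2 :+ l :+ (con 2 :+ g))) :+ u) := con 9 :+ l :+ g :+ u) refl l g u
  -- The program sees whether `y′` and `g′` are empty, the specification whether `ds` is `y`;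
  -- `sound` and `complete` rule out the cases in which these disagree.
  decide : ∀ y′ g′ → Compared ds [] y [] x′ y′ g′ → (dec : Dec (ds ≡ y)) →
    Exec scan (st i a b [] y e rest (sep ∷ (ds ʳ++ t)) (if does dec then b0 ∷ f else f) [] c o) s′ u →
    Exec scan (st i a b x′ y′ e (sep ∷ rest) (ds ʳ++ t) f g′ c o) s′ (9 + l + length g′ * 2 + u)
  decide []       []       r (yes _) z = weaken (≤-reflexive (arrange l 0)) (again refl (push ⨟ break refl (break refl push) ⨟ clean [] [] (restores r)) z)
  decide []       []       r (no ≢y) z = contradiction (proj₂ (sound r refl refl)) ≢y
  decide []       (h ∷ g′) r (yes ≡y) z = contradiction (proj₂ (complete r ≡y refl)) λ ()
  decide []       (h ∷ g′) r (no _)  z = weaken (≤-reflexive (arrange l _)) (again refl (push ⨟ break refl (break refl push) ⨟ clean [] (h ∷ g′) (restores r)) z)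
  decide (v ∷ y′) g′       r (yes ≡y) z = contradiction (proj₁ (complete r ≡y refl)) λ ()
  decide (v ∷ y′) g′       r (no _)  z = weaken (≤-trans (n≤1+n _) (≤-reflexive (arrange l _))) (again refl (push ⨟ break refl push ⨟ clean (v ∷ y′) g′ (restores r)) z)
  cost : length ds * 5 + (9 + l + length g′ * 2 + u) ≤ suc (length ds) * (9 + length y * 2) + u
  cost = begin
    d * 5 + (9 + l + length g′ * 2 + u)
      ≤⟨ +-monoʳ-≤ (d * 5) (+-monoˡ-≤ u (+-mono-≤ (+-monoʳ-≤ 9 (*-monoˡ-≤ 2 (lengthX r))) (*-monoˡ-≤ 2 (lengthG r)))) ⟩
    d * 5 + (9 + v * 2 + d * 2 + u)
      ≤⟨ m≤m+n _ (d * 2 + d * (v * 2)) ⟩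
    d * 5 + (9 + v * 2 + d * 2 + u) + (d * 2 + d * (v * 2))
      ≡⟨ solve 3 (λ d v u → d :* con 5 :+ (con 9 :+ v :* con 2 :+ d :* con 2 :+ u) :+ (d :* con 2 :+ d :* (v :* con 2))
                   := (con 1 :+ d) :* (con 9 :+ v :* con 2) :+ u) refl d v u ⟩
    suc d * (9 + v * 2) + u ∎
    where
    open ≤-Reasoning
    d = length ds
    v = length y

hits : List ℕ → Str → Str → Str
hits []       y f = f
hits (w ∷ ws) y f = hits ws y (record-hit (dig w) y f)

blocks : List ℕ → Str
blocks = concatMap encℕ

encℕ-++ : ∀ n (xs : Str) → encℕ n ++ xs ≡ dig n ++ sep ∷ xs
encℕ-++ n xs = ++-assoc (dig n) (sep ∷ []) xs

scan-exec : ∀ ws y → All IsDigit y → ∀ {i a b e t f c o} →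
  Exec scan (st i a b [] y e (blocks ws) t f [] c o) (st i a b [] y e [] (blocks ws ʳ++ t) (hits ws y f) [] c o)
    (length (blocks ws) * (9 + length y * 2) + 2)
scan-exec []       y yd = break refl skip
scan-exec (w ∷ ws) y yd {i} {a} {b} {e} {t} {f} {c} {o} rewrite encℕ-++ w (blocks ws) | ++-ʳ++ (dig w) {sep ∷ blocks ws} {t} =
  weaken (≤-reflexive (trans (sym (+-assoc (suc (length (dig w)) * v) _ 2))
    (cong (_+ 2) (trans (sym (*-distribʳ-+ v (suc (length (dig w))) _))
      (cong (_* v) (trans (sym (+-suc (length (dig w)) _)) (sym (length-++ (dig w)))))))))
    (scan-block (dig w) (encBin-digits _) y yd (scan-exec ws y yd))
  where
  v = 9 + length y * 2

tri≤ : ∀ p → tri p ≤ p * p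
tri≤ zero    = z≤n
tri≤ (suc p) = s≤s (+-monoʳ-≤ p (≤-trans (tri≤ p) (*-monoʳ-≤ p (n≤1+n p))))

insert : ℕ → List ℕ → List ℕ
insert w ws = if does (w ∈ℕ? ws) then ws else w ∷ ws

hits-∉ : ∀ {w} ws {f} → w ∉ ws → hits ws (dig w) f ≡ f
hits-∉ [] w∉ = refl
hits-∉ {w} (v ∷ ws) w∉ with dig v ≟ˢ dig w
... | yes eq = contradiction (here (sym (dig-injective eq))) w∉
... | no _   = hits-∉ ws (w∉ ∘ there)

hits-∷ : ∀ ws y a f → ∃ λ a′ → ∃ λ f′ → hits ws y (a ∷ f) ≡ a′ ∷ f′
hits-∷ []       y a f = a , f , refl
hits-∷ (v ∷ ws) y a f with does (dig v ≟ˢ y)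
... | true  = hits-∷ ws y b0 (a ∷ f)
... | false = hits-∷ ws y a f

hits-∈ : ∀ {w ws f} → w ∈ ws → ∃ λ a′ → ∃ λ f′ → hits ws (dig w) f ≡ a′ ∷ f′
hits-∈ {w} {ws = v ∷ ws} {f} (here refl) with dig v ≟ˢ dig w
... | yes _ = hits-∷ ws (dig w) b0 f
... | no ≢  = contradiction refl ≢
hits-∈ {w} {ws = v ∷ ws} (there w∈) = hits-∈ w∈

length-hits : ∀ ws y f → length (hits ws y f) ≤ length ws + length f
length-hits []       y f = ≤-refl
length-hits (w ∷ ws) y f with does (dig w ≟ˢ y)
... | true  = ≤-trans (length-hits ws y (b0 ∷ f)) (≤-reflexive (+-suc (length ws) (length f)))
... | false = ≤-trans (length-hits ws y f) (n≤1+n _)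

length-blocks : ∀ ws → length ws ≤ length (blocks ws)
length-blocks []       = z≤n
length-blocks (w ∷ ws) = ≤-trans (s≤s (length-blocks ws)) (≤-trans (≤-trans (m≤n+m _ (length (dig w))) (≤-reflexive (sym (length-++ (dig w)))))
  (≤-reflexive (cong length (sym (encℕ-++ w (blocks ws))))))

length-encℕ : ∀ w → length (encℕ w) ≡ suc (length (dig w))
length-encℕ w = trans (length-++ (dig w)) (+-comm _ 1)

moveCost processCost : ℕ → ℕ
moveCost M = 2 + M * 2
processCost M = moveCost M + (M * (9 + M * 2) + 2 + (moveCost M + suc (moveCost M + (1 + (moveCost M + (1 +
  (M * (6 + (M * M + M) * 4) + 2 + moveCost M)))))))

moveCost-mono : ∀ {l M} → l ≤ M → moveCost l ≤ moveCost M
moveCost-mono le = s≤s (s≤s (*-monoˡ-≤ 2 le))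

length-rev : (xs : Str) → length (xs ʳ++ []) ≡ length xs
length-rev xs = trans (length-ʳ++ xs) (+-identityʳ _)

process-exec : ∀ w ws k {M i a e o} → length (encℕ w) + length (blocks ws) ≤ M → length (dig k) ≤ M →
  Exec process
    (st i a (dig (tri (length ws) + k)) (dig w ʳ++ []) [] e (blocks ws) [] [] [] (unary (length ws)) o)
    (st i a (dig (tri (length (insert w ws)) + k)) [] [] e (blocks (insert w ws)) [] [] [] (unary (length (insert w ws))) o)
    (processCost M)
process-exec w ws k {M} {i} {a} {e} {o} le lek =
  weaken (moveCost-mono (≤-trans (≤-reflexive (length-rev (dig w))) lw))
    (Exec-cast (cong (λ y → st i a b [] y e (blocks ws) [] [] [] c o) (rev-rev (dig w))) (move-exec (λ ()) _)) ⨟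
  weaken (+-monoˡ-≤ 2 (*-mono-≤ lD (+-monoʳ-≤ 9 (*-monoˡ-≤ 2 lw)))) (scan-exec ws (dig w) (encBin-digits _)) ⨟
  weaken (moveCost-mono (≤-trans (≤-reflexive (length-rev (blocks ws))) lD))
    (Exec-cast (cong (λ d → st i a b [] (dig w) e d [] (hits ws (dig w) []) [] c o) (rev-rev (blocks ws))) (move-exec (λ ()) _)) ⨟
  decide (w ∈ℕ? ws)
  where
  b = dig (tri (length ws) + k)
  c = unary (length ws)
  lD : length (blocks ws) ≤ M
  lD = ≤-trans (m≤n+m _ _) le
  lw : length (dig w) ≤ M
  lw = ≤-trans (≤-trans (n≤1+n _) (≤-reflexive (sym (length-encℕ w)))) (≤-trans (m≤m+n _ _) le)
  l≤ : suc (length ws) ≤ M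
  l≤ = ≤-trans (≤-trans (+-mono-≤ (s≤s z≤n) (length-blocks ws)) (+-monoˡ-≤ _ (≤-reflexive (sym (length-encℕ w))))) le
  -- The old triangular number and the increments about to be made add up to the next triangular
  -- number, which is at most `M * M`; the last `M` covers the digits of `k`.
  β≤ : length b + suc (length ws) ≤ M * M + M
  β≤ = begin
    length b + suc (length ws)                            ≤⟨ +-monoˡ-≤ _ (length-dig-+ (tri (length ws)) k) ⟩
    tri (length ws) + length (dig k) + suc (length ws)    ≡⟨ solve 3 (λ x y z → x :+ y :+ z := z :+ x :+ y) refl (tri (length ws)) (length (dig k)) (suc (length ws)) ⟩
    tri (suc (length ws)) + length (dig k)                ≤⟨ +-mono-≤ (≤-trans (tri≤ (suc (length ws))) (*-mono-≤ l≤ l≤)) lek ⟩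
    M * M + M                                             ∎
    where open ≤-Reasoning
  decide : (dec : Dec (w ∈ ws)) → let ws′ = if does dec then ws else w ∷ ws in
    Exec keep
      (st i a b [] (dig w) e (blocks ws) [] (hits ws (dig w) []) [] c o)
      (st i a (dig (tri (length ws′) + k)) [] [] e (blocks ws′) [] [] [] (unary (length ws′)) o)
      (suc (moveCost M + (1 + (moveCost M + (1 + (M * (6 + (M * M + M) * 4) + 2 + moveCost M))))))
  decide (yes w∈) with hits ws (dig w) [] | hits-∈ {f = []} w∈ | ≤-trans (length-hits ws (dig w) []) (≤-reflexive (+-identityʳ (length ws)))
  ... | _ | _ , f′ , refl | lf = weaken (s≤s (+-monoʳ-≤ (moveCost M) (≤-trans (m≤m+n _ _) (n≤1+n _)))) (break refl
    (weaken (moveCost-mono lw) (clear-exec (dig w) _ refl) ⨟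
     weaken (moveCost-mono (≤-trans (n≤1+n _) (≤-trans lf (≤-trans (n≤1+n _) l≤)))) (clear-exec f′ _ refl)))
  decide (no w∉) rewrite hits-∉ ws {[]} w∉ = break refl
    (weaken (moveCost-mono lw) (move-exec (λ ()) _) ⨟ push ⨟
     weaken (moveCost-mono (≤-trans (≤-reflexive (length-rev (dig w))) lw))
       (Exec-cast (cong (λ d → st i a b [] [] e d [] [] [] c o) (trans (ʳ++-ʳ++ (dig w)) (sym (encℕ-++ w (blocks ws))))) (move-exec (λ ()) _)) ⨟
     push ⨟
     weaken (+-mono-≤ (+-monoˡ-≤ 2 (*-monoˡ-≤ (6 + (M * M + M) * 4) l≤)) (moveCost-mono l≤))
       (Exec-cast (cong (λ x → st i a (dig x) [] [] e (blocks (w ∷ ws)) [] [] [] (unary (suc (length ws))) o)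
          (sym (+-assoc (suc (length ws)) (tri (length ws)) k)))
         (bump-exec (suc (length ws)) (tri (length ws) + k) β≤)))

-- Reading the edges

collect : List ℕ → List ℕ → List ℕ
collect ws []       = ws
collect ws (x ∷ xs) = collect (insert x ws) xs

length-blocks-∷ : ∀ w ws → length (blocks (w ∷ ws)) ≡ length (encℕ w) + length (blocks ws)
length-blocks-∷ w ws = length-++ (encℕ w)

length-insert : ∀ w ws → length (blocks (insert w ws)) ≤ length (encℕ w) + length (blocks ws)
length-insert w ws with does (w ∈ℕ? ws)
... | true  = m≤n+m _ (length (encℕ w))
... | false = ≤-reflexive (length-blocks-∷ w ws)

length-collect : ∀ ws xs → length (blocks (collect ws xs)) ≤ length (blocks xs) + length (blocks ws)
length-collect ws []       = ≤-refl
length-collect ws (x ∷ xs) = begin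
  length (blocks (collect (insert x ws) xs))                  ≤⟨ length-collect (insert x ws) xs ⟩
  length (blocks xs) + length (blocks (insert x ws))          ≤⟨ +-monoʳ-≤ (length (blocks xs)) (length-insert x ws) ⟩
  length (blocks xs) + (length (encℕ x) + length (blocks ws)) ≡⟨ +-assoc (length (blocks xs)) _ _ ⟨
  length (blocks xs) + length (encℕ x) + length (blocks ws)   ≡⟨ cong (_+ _) (trans (+-comm (length (blocks xs)) _) (sym (length-blocks-∷ x xs))) ⟩
  length (blocks (x ∷ xs)) + length (blocks ws)               ∎
  where open ≤-Reasoning

readEdges-digits : ∀ ds → All IsDigit ds → ∀ {a b x y e d t f g c o rest s′ u} →
  Exec readEdges (st rest a b (ds ʳ++ x) y (ds ʳ++ e) d t f g c o) s′ u →
  Exec readEdges (st (ds ++ rest) a b x y e d t f g c o) s′ (length ds * 3 + u)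
readEdges-digits []       []        z = z
readEdges-digits (_ ∷ ds) (d0 ∷ ps) z = again refl (push ⨟ push) (readEdges-digits ds ps z)
readEdges-digits (_ ∷ ds) (d1 ∷ ps) z = again refl (push ⨟ push) (readEdges-digits ds ps z)

readEdges-exec : ∀ xs ws k {M a e o} → length (blocks xs) + length (blocks ws) ≤ M → length (dig k) ≤ M →
  let ws′ = collect ws xs in
  Exec readEdges
    (st (blocks xs) a (dig (tri (length ws) + k)) [] [] e (blocks ws) [] [] [] (unary (length ws)) o)
    (st [] a (dig (tri (length ws′) + k)) [] [] (blocks xs ʳ++ e) (blocks ws′) [] [] [] (unary (length ws′)) o)
    (length (blocks xs) * (3 + processCost M) + 2)
readEdges-exec []       ws k le lek = break refl skip
readEdges-exec (x ∷ xs) ws k {M} {a} {e} {o} le lek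
  rewrite length-blocks-∷ x xs | length-encℕ x | encℕ-++ x (blocks xs) | ++-ʳ++ (dig x) {sep ∷ blocks xs} {e} =
  weaken cost (readEdges-digits (dig x) (encBin-digits _)
    (again refl (push ⨟ process-exec x ws k le₁ lek) (readEdges-exec xs (insert x ws) k le₂ lek)))
  where
  P = processCost M
  v = length (blocks xs) * (3 + P) + 2
  le₁ : length (encℕ x) + length (blocks ws) ≤ M
  le₁ = ≤-trans (+-monoˡ-≤ _ (≤-trans (≤-reflexive (length-encℕ x)) (s≤s (m≤m+n _ _)))) le
  le₂ : length (blocks xs) + length (blocks (insert x ws)) ≤ M
  le₂ = begin
    length (blocks xs) + length (blocks (insert x ws))                 ≤⟨ +-monoʳ-≤ (length (blocks xs)) (length-insert x ws) ⟩
    length (blocks xs) + (length (encℕ x) + length (blocks ws))        ≡⟨ cong (λ l → length (blocks xs) + (l + length (blocks ws))) (length-encℕ x) ⟩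
    length (blocks xs) + (suc (length (dig x)) + length (blocks ws))
      ≡⟨ solve 3 (λ p q r → p :+ (q :+ r) := q :+ p :+ r) refl (length (blocks xs)) (suc (length (dig x))) (length (blocks ws)) ⟩
    suc (length (dig x)) + length (blocks xs) + length (blocks ws)     ≤⟨ le ⟩
    M ∎
    where open ≤-Reasoning
  cost : length (dig x) * 3 + suc (suc P + v) ≤ (suc (length (dig x)) + length (blocks xs)) * (3 + P) + 2
  cost = begin
    l * 3 + suc (suc P + v)                       ≤⟨ m≤m+n _ (l * P + 1) ⟩
    l * 3 + suc (suc P + v) + (l * P + 1)
      ≡⟨ solve 3 (λ l P r → l :* con 3 :+ (con 1 :+ (con 1 :+ P :+ (r :* (con 3 :+ P) :+ con 2))) :+ (l :* P :+ con 1)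
                   := (con 1 :+ l :+ r) :* (con 3 :+ P) :+ con 2) refl l P (length (blocks xs)) ⟩
    (suc l + length (blocks xs)) * (3 + P) + 2    ∎
    where
    open ≤-Reasoning
    l = length (dig x)

-- Writing the output

spreadA-exec : ∀ as {i b x y e d t f g c o} →
  Exec spreadA (st i as b x y e d t f g c o) (st i [] b (as ʳ++ x) y e d t f g c (as ʳ++ o)) (length as * 3 + 2)
spreadA-exec []       = break refl skip
spreadA-exec (a ∷ as) = again refl (push ⨟ push) (spreadA-exec as)

copyCost : ℕ → ℕ
copyCost M = M * 3 + 2 + moveCost M

copyN-exec : ∀ n {M i b y e d t f g c o} → length (dig n) ≤ M →
  Exec copyN (st i (dig n ʳ++ []) b [] y e d t f g c o) (st i (dig n ʳ++ []) b [] y e d t f g c (dig n ++ o)) (copyCost M)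
copyN-exec n {M} {i} {b} {y} {e} {d} {t} {f} {g} {c} {o} le =
  weaken (+-monoˡ-≤ 2 (*-monoˡ-≤ 3 (≤-trans (≤-reflexive (length-rev (dig n))) le))) (spreadA-exec (dig n ʳ++ [])) ⨟
  weaken (moveCost-mono (≤-trans (≤-reflexive (trans (length-rev (dig n ʳ++ [])) (length-rev (dig n)))) le))
    (Exec-cast (cong₂ (λ a o → st i a b [] y e d t f g c o) (rev-rev (dig n ʳ++ []))
      (trans (ʳ++-ʳ++ (dig n)) refl)) (move-exec (λ ()) _))

stars : ℕ → List ℕ → Str
stars n = concatMap (λ w → encℕ w ++ encℕ n)

writeStars-digits : ∀ ds → All IsDigit ds → ∀ {i a b x y e d t f g c o s′ u} →
  Exec writeStars (st i a b x y e d t f g c (ds ʳ++ o)) s′ u →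
  Exec writeStars (st i a b x y e d (ds ++ t) f g c o) s′ (length ds * 2 + u)
writeStars-digits []       []        z = z
writeStars-digits (_ ∷ ds) (d0 ∷ ps) z = again refl push (writeStars-digits ds ps z)
writeStars-digits (_ ∷ ds) (d1 ∷ ps) z = again refl push (writeStars-digits ds ps z)

rev-digits : ∀ {ds es} → All IsDigit ds → All IsDigit es → All IsDigit (ds ʳ++ es)
rev-digits []       qs = qs
rev-digits (p ∷ ps) qs = rev-digits ps (p ∷ qs)

-- On `‵T` the blocks lie reversed, the last one on top. The induction therefore runs the blocks of
-- the tail first and treats the head of the list in the continuation.
writeStars-blocks : ∀ n {M} → length (dig n) ≤ M → ∀ ws {i b y e d t f g c o s′ u} →
  Exec writeStars (st i (dig n ʳ++ []) b [] y e d t f g c (stars n ws ++ o)) s′ u →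
  Exec writeStars (st i (dig n ʳ++ []) b [] y e d (blocks ws ʳ++ t) f g c o) s′ (length (blocks ws) * (4 + copyCost M) + u)
writeStars-blocks n le [] z = z
writeStars-blocks n {M} le (w ∷ ws) {i} {b} {y} {e} {d} {t} {f} {g} {c} {o} {s′} {u} z
  rewrite length-blocks-∷ w ws | length-encℕ w | encℕ-++ w (blocks ws) | ++-ʳ++ (dig w) {sep ∷ blocks ws} {t} =
  weaken cost (writeStars-blocks n le ws (again refl (push ⨟ copyN-exec n le ⨟ push) digits))
  where
  o₁ = sep ∷ dig n ++ sep ∷ stars n ws ++ o
  out≡ : (dig w ʳ++ []) ʳ++ o₁ ≡ stars n (w ∷ ws) ++ o
  out≡ = trans (ʳ++-ʳ++ (dig w)) (sym (trans (++-assoc (encℕ w ++ encℕ n) (stars n ws) o)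
    (trans (++-assoc (encℕ w) (encℕ n) _) (trans (encℕ-++ w _) (cong (λ q → dig w ++ sep ∷ q) (encℕ-++ n _))))))
  digits : Exec writeStars (st i (dig n ʳ++ []) b [] y e d (dig w ʳ++ t) f g c o₁) s′ (length (dig w) * 2 + u)
  digits = subst₂ (λ t′ l → Exec writeStars (st i (dig n ʳ++ []) b [] y e d t′ f g c o₁) s′ (l * 2 + u))
    (trans (cong (_++ t) (ʳ++-defn (dig w))) (trans (cong (_++ t) (++-identityʳ _)) (sym (ʳ++-defn (dig w))))) (length-rev (dig w))
    (writeStars-digits (dig w ʳ++ []) (rev-digits (encBin-digits (toBin w)) []) {t = t}
      (subst (λ o′ → Exec writeStars (st i (dig n ʳ++ []) b [] y e d t f g c o′) s′ u) (sym out≡) z))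
  cost : length (blocks ws) * (4 + copyCost M) + suc (1 + (copyCost M + 1) + (length (dig w) * 2 + u))
         ≤ (suc (length (dig w)) + length (blocks ws)) * (4 + copyCost M) + u
  cost = begin
    r * (4 + V) + suc (1 + (V + 1) + (l * 2 + u))                       ≤⟨ m≤m+n _ (l * (2 + V) + 1) ⟩
    r * (4 + V) + suc (1 + (V + 1) + (l * 2 + u)) + (l * (2 + V) + 1)
      ≡⟨ solve 4 (λ r V l u → r :* (con 4 :+ V) :+ (con 1 :+ (con 1 :+ (V :+ con 1) :+ (l :* con 2 :+ u))) :+ (l :* (con 2 :+ V) :+ con 1)
                   := (con 1 :+ l :+ r) :* (con 4 :+ V) :+ u) refl r V l u ⟩
    (suc l + r) * (4 + V) + u ∎
    where
    open ≤-Reasoning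
    l = length (dig w)
    r = length (blocks ws)
    V = copyCost M

digits-true : ∀ {ds} → All IsDigit ds → All (λ a → isDigit (fsuc a) ≡ true) ds
digits-true = All.map λ { d0 → refl ; d1 → refl }

reduced : ℕ → ℕ → List ℕ → Str
reduced n k xs = encℕ (suc n) ++ encℕ (tri (length ws) + k) ++ blocks xs ++ stars n ws
  where ws = collect [] xs

programCost : ℕ → ℕ
programCost M = moveCost M + (moveCost M + (moveCost M + (M * (3 + processCost M) + 2 + (moveCost M +
  (M * (4 + copyCost M) + 2 + (moveCost M + (1 + (moveCost (M * M + M) + (moveCost (M * M + M) + (1 +
  (moveCost M + (4 + M * 4 + (moveCost (1 + M) + moveCost (1 + M))))))))))))))

program-exec : ∀ n k xs → let w = encℕ n ++ encℕ k ++ blocks xs in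
  ∃ λ s′ → Vec.lookup s′ ‵O ≡ reduced n k xs × Exec program (st w [] [] [] [] [] [] [] [] [] [] []) s′ (programCost (length w))
program-exec n k xs = _ , out≡ ,
  (weaken (moveCost-mono ln) (transfer-exec (λ ()) (dig n) (sep ∷ encℕ k ++ blocks xs) (digits-true (encBin-digits _)) refl _ (encℕ-++ n _)) ⨟
   weaken (moveCost-mono lk) (transfer-exec (λ ()) (dig k) (sep ∷ blocks xs) (digits-true (encBin-digits _)) refl _ (encℕ-++ k _)) ⨟
   weaken (moveCost-mono (≤-trans (≤-reflexive (length-rev (dig k))) lk))
     (Exec-cast (cong (λ b → st (blocks xs) a b [] [] [] [] [] [] [] [] []) (rev-rev (dig k))) (move-exec (λ ()) _)) ⨟
   weaken (+-monoˡ-≤ 2 (*-monoˡ-≤ (3 + processCost M) lx)) (readEdges-exec xs [] k (≤-trans (≤-reflexive (+-identityʳ _)) lx) lk) ⨟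
   weaken (moveCost-mono lD) (move-exec (λ ()) _) ⨟
   weaken (+-monoˡ-≤ 2 (*-monoˡ-≤ (4 + copyCost M) lD)) (writeStars-blocks n ln ws (break refl skip)) ⨟
   weaken (moveCost-mono (≤-trans (≤-reflexive (length-rev (blocks xs))) lx))
     (Exec-cast (cong (st [] a (dig k′) [] [] [] [] [] [] [] c) (ʳ++-ʳ++ (blocks xs))) (move-exec (λ ()) _)) ⨟
   push ⨟
   weaken (moveCost-mono lB) (move-exec (λ ()) _) ⨟
   weaken (moveCost-mono (≤-trans (≤-reflexive (length-rev (dig k′))) lB))
     (Exec-cast (cong (st [] a [] [] [] [] [] [] [] [] c) (ʳ++-ʳ++ (dig k′))) (move-exec (λ ()) _)) ⨟
   push ⨟
   weaken (moveCost-mono (≤-trans (≤-reflexive (length-rev (dig n))) ln))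
     (Exec-cast (cong (λ b → st [] [] b [] [] [] [] [] [] [] c (sep ∷ o₂)) (rev-rev (dig n))) (move-exec (λ ()) _)) ⨟
   weaken (+-monoʳ-≤ 4 (*-monoˡ-≤ 4 ln)) (increment-exec n) ⨟
   weaken (moveCost-mono lsn) (move-exec (λ ()) _) ⨟
   weaken (moveCost-mono (≤-trans (≤-reflexive (length-rev (dig (suc n)))) lsn)) (move-exec (λ ()) _))
  where
  a = dig n ʳ++ []
  ws = collect [] xs
  k′ = tri (length ws) + k
  c = unary (length ws)
  o₁ = blocks xs ++ stars n ws ++ []
  o₂ = dig k′ ++ sep ∷ o₁
  M = length (encℕ n ++ encℕ k ++ blocks xs)
  M≡ : M ≡ length (encℕ n) + (length (encℕ k) + length (blocks xs))
  M≡ = trans (length-++ (encℕ n)) (cong (length (encℕ n) +_) (length-++ (encℕ k)))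
  dig≤ : ∀ n → length (dig n) ≤ length (encℕ n)
  dig≤ n = ≤-trans (n≤1+n _) (≤-reflexive (sym (length-encℕ n)))
  ln : length (dig n) ≤ M
  ln = ≤-trans (dig≤ n) (≤-trans (m≤m+n _ _) (≤-reflexive (sym M≡)))
  lk : length (dig k) ≤ M
  lk = ≤-trans (dig≤ k) (≤-trans (≤-trans (m≤m+n _ _) (m≤n+m _ (length (encℕ n)))) (≤-reflexive (sym M≡)))
  lx : length (blocks xs) ≤ M
  lx = ≤-trans (≤-trans (m≤n+m _ (length (encℕ k))) (m≤n+m _ (length (encℕ n)))) (≤-reflexive (sym M≡))
  lD : length (blocks ws) ≤ M
  lD = ≤-trans (length-collect [] xs) (≤-trans (≤-reflexive (+-identityʳ _)) lx)
  lB : length (dig k′) ≤ M * M + M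
  lB = ≤-trans (length-dig-+ (tri (length ws)) k) (+-mono-≤ (≤-trans (tri≤ (length ws)) (*-mono-≤ lw lw)) lk)
    where
    lw : length ws ≤ M
    lw = ≤-trans (length-blocks ws) lD
  lsn : length (dig (suc n)) ≤ 1 + M
  lsn = ≤-trans (length-dig-+ 1 n) (s≤s ln)
  out≡ : (dig (suc n) ʳ++ []) ʳ++ (sep ∷ o₂) ≡ reduced n k xs
  out≡ = trans (ʳ++-ʳ++ (dig (suc n))) (trans (sym (encℕ-++ (suc n) o₂))
    (cong (encℕ (suc n) ++_) (trans (sym (encℕ-++ k′ o₁)) (cong (λ o → encℕ k′ ++ blocks xs ++ o) (++-identityʳ (stars n ws))))))

-- The running time is polynomial

moveCostₚ : ∀ {f} → PolyBounded f → PolyBounded (λ L → moveCost (f L))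
moveCostₚ p = constₚ 2 +ₚ p *ₚ constₚ 2

processCostₚ : PolyBounded processCost
processCostₚ = moveCostₚ idₚ +ₚ (idₚ *ₚ (constₚ 9 +ₚ idₚ *ₚ constₚ 2) +ₚ constₚ 2 +ₚ (moveCostₚ idₚ +ₚ (constₚ 1 +ₚ (moveCostₚ idₚ +ₚ
  (constₚ 1 +ₚ (moveCostₚ idₚ +ₚ (constₚ 1 +ₚ (idₚ *ₚ (constₚ 6 +ₚ (idₚ *ₚ idₚ +ₚ idₚ) *ₚ constₚ 4) +ₚ constₚ 2 +ₚ moveCostₚ idₚ))))))))

programCostₚ : PolyBounded programCost
programCostₚ = μ +ₚ (μ +ₚ (μ +ₚ (idₚ *ₚ (constₚ 3 +ₚ processCostₚ) +ₚ constₚ 2 +ₚ (μ +ₚ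
  (idₚ *ₚ (constₚ 4 +ₚ (idₚ *ₚ constₚ 3 +ₚ constₚ 2 +ₚ μ)) +ₚ constₚ 2 +ₚ (μ +ₚ (constₚ 1 +ₚ (μ² +ₚ (μ² +ₚ (constₚ 1 +ₚ
  (μ +ₚ (constₚ 4 +ₚ idₚ *ₚ constₚ 4 +ₚ (μ¹ +ₚ μ¹)))))))))))))
  where
  μ  = moveCostₚ idₚ
  μ² = moveCostₚ (idₚ *ₚ idₚ +ₚ idₚ)
  μ¹ = moveCostₚ (constₚ 1 +ₚ idₚ)

turingCost : ℕ → ℕ
turingCost L = (2 + programCost L) * suc (roundTrip (programCost L + L))

turingCostₚ : PolyBounded turingCost
turingCostₚ = (constₚ 2 +ₚ programCostₚ) *ₚ (constₚ 1 +ₚ (h +ₚ (constₚ 1 +ₚ (h +ₚ constₚ 1))))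
  where h = programCostₚ +ₚ idₚ

input : ℕ → ℕ → List ℕ → Str
input n k xs = encℕ n ++ encℕ k ++ blocks xs

reducer : TM
reducer = machine program ‵I ‵O

program-computes : ∀ {τ} n k xs w → w ≡ input n k xs → turingCost (length w) ≤ τ → ComputesWithin reducer τ w (reduced n k xs)
-- An encoded instance is never empty, since it contains the separator after n.
program-computes n k xs [] eq le with dig n | trans eq (encℕ-++ n (encℕ k ++ blocks xs))
... | []    | ()
... | _ ∷ _ | ()
program-computes {τ} n k xs (a ∷ w) eq le = subst (ComputesWithin reducer τ (a ∷ w)) (proj₁ (proj₂ run))
  (machine-computes program ‵I ‵O
    (subst (λ w → Exec program (st w [] [] [] [] [] [] [] [] [] [] []) (proj₁ run) (programCost (length w))) (sym eq) (proj₂ (proj₂ run))) le)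
  where run = program-exec n k xs

abstract
  turingBound : ∃ λ c → ∃ λ d → ∀ L → turingCost L ≤ c * L ^ d + c
  turingBound = poly-bound turingCostₚ

reduced-computable : ∃ λ c → ∃ λ d → ∀ n k xs →
  ComputesWithin reducer (c * length (input n k xs) ^ d + c) (input n k xs) (reduced n k xs)
reduced-computable = proj₁ turingBound , proj₁ (proj₂ turingBound) ,
  λ n k xs → program-computes n k xs (input n k xs) refl (proj₂ (proj₂ turingBound) (length (input n k xs)))

-- The reduction

insert-∈ : ∀ {w ws} → w ∈ ws → insert w ws ≡ ws
insert-∈ {w} {ws} w∈ with w ∈ℕ? ws
... | yes _ = refl
... | no w∉ = contradiction w∈ w∉

insert-∉ : ∀ {w ws} → w ∉ ws → insert w ws ≡ w ∷ ws
insert-∉ {w} {ws} w∉ with w ∈ℕ? ws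
... | yes w∈ = contradiction w∈ w∉
... | no _   = refl

module _ {n : ℕ} where
  open DecMembership (_≟ᶠ_ {n}) using (_∈?_)

  insertV : Fin n → List (Fin n) → List (Fin n)
  insertV w ws with w ∈? ws
  ... | yes _ = ws
  ... | no _  = w ∷ ws

  -- Follows `collect` step by step on vertices, so that the spokes of the cone come in the very
  -- order in which the program writes them.
  collectV : List (Fin n) → List (Fin n) → List (Fin n)
  collectV ws []       = ws
  collectV ws (x ∷ xs) = collectV (insertV x ws) xs

  insertV-unique : ∀ w {ws} → Unique ws → Unique (insertV w ws)
  insertV-unique w {ws} un with w ∈? ws
  ... | yes _ = un
  ... | no w∉ = All.¬Any⇒All¬ ws w∉ ∷ un

  collectV-unique : ∀ xs {ws} → Unique ws → Unique (collectV ws xs)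
  collectV-unique []       un = un
  collectV-unique (x ∷ xs) un = collectV-unique xs (insertV-unique x un)

  insertV-⊇ : ∀ w {ws v} → v ∈ ws → v ∈ insertV w ws
  insertV-⊇ w {ws} v∈ with w ∈? ws
  ... | yes _ = v∈
  ... | no _  = there v∈

  insertV-∋ : ∀ w {ws} → w ∈ insertV w ws
  insertV-∋ w {ws} with w ∈? ws
  ... | yes w∈ = w∈
  ... | no _   = here refl

  collectV-⊇ : ∀ xs {ws v} → v ∈ ws → v ∈ collectV ws xs
  collectV-⊇ []       v∈ = v∈
  collectV-⊇ (x ∷ xs) v∈ = collectV-⊇ xs (insertV-⊇ x v∈)

  collectV-∋ : ∀ {xs ws v} → v ∈ xs → v ∈ collectV ws xs
  collectV-∋ {x ∷ xs} {ws} (here refl) = collectV-⊇ xs (insertV-∋ x {ws})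
  collectV-∋ {x ∷ xs} (there v∈)  = collectV-∋ v∈

  toℕ-insertV : ∀ w ws → map toℕ (insertV w ws) ≡ insert (toℕ w) (map toℕ ws)
  toℕ-insertV w ws with w ∈? ws
  ... | yes w∈ = sym (insert-∈ (∈-map⁺ toℕ w∈))
  ... | no w∉  = sym (insert-∉ λ w∈ → let v , v∈ , eq = ∈-map⁻ toℕ w∈ in w∉ (subst (_∈ ws) (sym (toℕ-injective eq)) v∈))

  toℕ-collectV : ∀ ws xs → map toℕ (collectV ws xs) ≡ collect (map toℕ ws) (map toℕ xs)
  toℕ-collectV ws []       = refl
  toℕ-collectV ws (x ∷ xs) = trans (toℕ-collectV (insertV x ws) xs) (cong (λ vs → collect vs (map toℕ xs)) (toℕ-insertV x ws))

  -- The encoding does not mark where a pair ends, so to the program the edges are one stream of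
  -- vertex numbers.
  endpoints : List (Fin n × Fin n) → List (Fin n)
  endpoints []             = []
  endpoints ((u , v) ∷ es) = u ∷ v ∷ endpoints es

  ∈-endpoints : ∀ {u v es} → (u , v) ∈ es → u ∈ endpoints es × v ∈ endpoints es
  ∈-endpoints (here refl) = here refl , there (here refl)
  ∈-endpoints (there uv∈) with ∈-endpoints uv∈
  ... | u∈ , v∈ = there (there u∈) , there (there v∈)

  encEdge : Fin n × Fin n → Str
  encEdge (u , v) = encℕ (toℕ u) ++ encℕ (toℕ v)

  encEdges≡blocks : ∀ es → concat (map encEdge es) ≡ blocks (map toℕ (endpoints es))
  encEdges≡blocks []             = refl
  encEdges≡blocks ((u , v) ∷ es) = trans (++-assoc (encℕ (toℕ u)) _ _) (cong (λ z → encℕ (toℕ u) ++ encℕ (toℕ v) ++ z) (encEdges≡blocks es))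

module Reduction (G : Graph) where
  support : List (Fin (n G))
  support = collectV [] (endpoints (edges G))

  covers : ∀ {u v} → (u , v) ∈ edges G → u ∈ support × v ∈ support
  covers uv∈ with ∈-endpoints uv∈
  ... | u∈ , v∈ = collectV-∋ u∈ , collectV-∋ v∈

  open Cone G support (collectV-unique (endpoints (edges G)) []) covers public

  xs : List ℕ
  xs = map toℕ (endpoints (edges G))

  support≡ : map toℕ support ≡ collect [] xs
  support≡ = toℕ-collectV [] (endpoints (edges G))

  enc-base : concat (map encEdge base) ≡ blocks xs
  enc-base = trans (cong concat (trans (sym (map-∘ (edges G))) (map-cong (λ (u , v) →
    cong₂ (λ a b → encℕ a ++ encℕ b) (toℕ-inject₁ u) (toℕ-inject₁ v)) (edges G)))) (encEdges≡blocks (edges G))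

  enc-spokes : ∀ vs → concat (map encEdge (map star vs)) ≡ stars (n G) (map toℕ vs)
  enc-spokes []       = refl
  enc-spokes (w ∷ vs) = cong₂ _++_ (cong₂ (λ a b → encℕ a ++ encℕ b) (toℕ-inject₁ w) (toℕ-fromℕ (n G))) (enc-spokes vs)

  enc-H : ∀ k → reduced (n G) k xs ≡ encInstance (H , tri (length support) + k)
  enc-H k = cong₂ (λ l es → encℕ (suc (n G)) ++ encℕ (tri l + k) ++ es)
    (trans (cong length (sym support≡)) (length-map toℕ support))
    (sym (trans (cong concat (map-++ encEdge base spokes)) (trans (sym (concat-++ (map encEdge base) (map encEdge spokes)))
      (cong₂ _++_ enc-base (trans (enc-spokes support) (cong (stars (n G)) support≡))))))

reduction : Graph × ℕ → Graph × ℕ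
reduction (G , k) = Reduction.H G , tri (length (Reduction.support G)) + k

enc-input : ∀ G k → input (n G) k (Reduction.xs G) ≡ encInstance (G , k)
enc-input G k = cong (λ es → encℕ (n G) ++ encℕ k ++ es) (sym (encEdges≡blocks (edges G)))

theorem8 : PolyReduction MLVC-yes MLOP-yes
theorem8 = reduction , (λ (G , k) → mk⇔ (Reduction.mlvc⇒mlop G) (Reduction.mlop⇒mlvc G)) , reducer , c , d ,
  λ (G , k) → subst₂ (λ w v → ComputesWithin reducer (c * length w ^ d + c) w v) (enc-input G k) (Reduction.enc-H G k)
    (proj₂ (proj₂ reduced-computable) (n G) k (Reduction.xs G))
  where
  c = proj₁ reduced-computable
  d = proj₁ (proj₂ reduced-computable)
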